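{- For any fixed integer $d \ge 4$, asymptotically almost surely $$H(\mathcal{G}_{n,d}) \le (1+o(1))\,\frac{(d-1)!\,(d-2)^{d-1}}{\prod_{i=1}^{d-1}\big(i(d-2)+1\big)}\, n.$$
   Context: Hopping forcing: given a graph $G$ with each vertex coloured blue or white, the hopping forcing rule allows a blue vertex $b$ to force (recolour blue) a white vertex $w$ at distance exactly two from $b$, provided that every neighbour of $b$ is blue and $b$ has not previously performed a force (each vertex can perform at most one force). A set $B\subseteq V(G)$ is feasible if, starting with exactly the vertices of $B$ blue, repeated sequential applications of the rule can make all vertices blue. The hopping forcing number $H(G)$ is the minimum size of a feasible set. $\mathcal{G}_{n,d}$ is a uniformly random $d$-regular simple graph on $n$ labelled vertices ($dn$ even), $d$ fixed, $n\to\infty$. An event holds asymptotically almost surely (a.a.s.) if its probability tends to $1$ as $n\to\infty$. -}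

module Defs where

open import Data.Bool using (Bool; true; false; _∧_; T)
open import Data.Nat using (ℕ; zero; suc; _+_; _*_; _∸_; _^_; _≡ᵇ_; _!)
open import Data.Fin using (Fin; _≟_)
open import Data.Fin.Subset using (Subset; _∈_; _∉_; _∪_; ⁅_⁆; ⊥; ⊤; ∣_∣)
open import Data.Vec using (Vec; lookup; countᵇ) renaming ([] to []ᵥ; _∷_ to _∷ᵥ_)
open import Data.List using (List; []; _∷_; [_]; concatMap; map; length; filterᵇ; allFin)
open import Data.Product using (Σ; _×_; _,_)
open import Data.Bool.ListAction using (and)
open import Relation.Nullary using (¬_; does)
open import Relation.Binary.PropositionalEquality using (_≡_)
open import Relation.Binary.Construct.Closure.ReflexiveTransitive using (Star)
open import Data.Integer using (+_)
open import Data.Rational using (ℚ; _/_)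

-- A labelled graph on vertex set Fin n, given by its adjacency matrix.
-- (Simple graphs on [n] correspond bijectively to symmetric irreflexive
-- Boolean matrices.)
Adj : ℕ → Set
Adj n = Vec (Vec Bool n) n

adj? : ∀ {n} → Adj n → Fin n → Fin n → Bool
adj? A i j = lookup (lookup A i) j

Adjacent : ∀ {n} → Adj n → Fin n → Fin n → Set
Adjacent A i j = adj? A i j ≡ true

boolEq : Bool → Bool → Bool
boolEq true  true  = true
boolEq false false = true
boolEq _     _     = false

not : Bool → Bool
not true = false
not false = true

isSimpleRegular : ∀ {n} → ℕ → Adj n → Bool
isSimpleRegular {n} d A =
  and (map (λ i → and (map (λ j → boolEq (adj? A i j) (adj? A j i)) (allFin n))) (allFin n))
  ∧ and (map (λ i → not (adj? A i i)) (allFin n))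
  ∧ and (map (λ i → countᵇ (λ b → b) (lookup A i) ≡ᵇ d) (allFin n))

IsSimpleRegular : ∀ {n} → ℕ → Adj n → Set
IsSimpleRegular d A = T (isSimpleRegular d A)

allVecs : ∀ {a} {A : Set a} (n : ℕ) → List A → List (Vec A n)
allVecs zero    xs = [ []ᵥ ]
allVecs (suc n) xs = concatMap (λ x → map (x ∷ᵥ_) (allVecs n xs)) xs

allAdj : (n : ℕ) → List (Adj n)
allAdj n = allVecs n (allVecs n (true ∷ false ∷ []))

numRegular : ℕ → ℕ → ℕ
numRegular d n = length (filterᵇ (isSimpleRegular d) (allAdj n))

Dist2 : ∀ {n} → Adj n → Fin n → Fin n → Set
Dist2 A b w = ¬ (b ≡ w) × ¬ Adjacent A b w × Σ _ (λ v → Adjacent A b v × Adjacent A v w)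

-- State of the hopping forcing process: (blue set, set of vertices that have forced).
State : ℕ → Set
State n = Subset n × Subset n

data HopStep {n} (A : Adj n) : State n → State n → Set where
  hop : ∀ {S U} (b w : Fin n) →
        b ∈ S → b ∉ U →
        (∀ v → Adjacent A b v → v ∈ S) →
        Dist2 A b w → w ∉ S →
        HopStep A (S , U) (S ∪ ⁅ w ⁆ , U ∪ ⁅ b ⁆)

Feasible : ∀ {n} → Adj n → Subset n → Set
Feasible {n} A B = Σ (Subset n) λ U → Star (HopStep A) (B , ⊥) (⊤ , U)

prod1 : ℕ → (ℕ → ℕ) → ℕ
prod1 zero    f = 1
prod1 (suc m) f = prod1 m f * f (suc m)

cNumer : ℕ → ℕ
cNumer d = ((d ∸ 1) !) * ((d ∸ 2) ^ (d ∸ 1))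

cDenom : ℕ → ℕ
cDenom d = prod1 (d ∸ 1) (λ i → i * (d ∸ 2) + 1)

toℚ : ℕ → ℚ
toℚ k = (+ k) / 1

{-# OPTIONS --safe #-}
-- Suppose the vertices are processed as "hubs" along vertex-disjoint paths. When hub v is reached, its predecessor b
-- on the path has only blue neighbours, so b may hop to one white neighbour w of v; every other white neighbour of v
-- is put into B beforehand. Hence |B| is the number of hubs that have no such w, where w is white at v exactly when
-- v is the first hub among the neighbours of w.
--
-- Order the paths by independent uniform labels. If the neighbourhood of v is a tree meeting all the paths involved
-- only once, then each of the d − 1 neighbours w ≠ b of v is white iff d − 2 labels are on the right side of the
-- label of v, so v fails with probability ∫₀¹ (1 − x^(d−2))^(d−1) dx = cNumer d / cDenom d. Averaging over the
-- labels gives a deterministic bound for every graph with few short cycles and a cover by few paths.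
--
-- Such a cover comes from two disjoint near-perfect matchings, each obtained from a maximum matching of the bipartite
-- double cover: its cycles have length 2, or are long, or lie near a short cycle, so that few odd ones occur.
-- Their union is a disjoint union of paths and even cycles, cut into short pieces.
--
-- The only random input is that short cycles are rare. It is proved by switching: replacing an edge of a short cycle
-- and a distant edge by two other edges maps pairs (graph, cycle) injectively to pairs (graph, path).

module Submission where

import Data.Integer as ℤ
import Data.Integer.Properties as ℤP
import Data.List.Relation.Unary.All as All
import Data.List.Relation.Unary.All.Properties as AllP
import Data.List.Relation.Unary.AllPairs as AllPairs
import Data.List.Relation.Unary.Any as Any
import Data.List.Relation.Unary.Linked as Linked
import Data.List.Relation.Unary.Unique.Propositional.Properties as Unique
import Data.Maybe.Properties as Maybe
import Data.Rational as ℚ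
import Data.Rational.Properties as ℚP
import Data.Rational.Unnormalised as ℚᵘ
import Data.Rational.Unnormalised.Properties as ℚᵘP
import Data.Vec as Vec

-- The exponent d - 2 is owed to the paths: a neighbour `w` of `v` has d - 1 further neighbours, but
-- the path successor of `w` comes after the path predecessor of `w`, so it needs no condition of
-- its own.
--
-- Independence dictates the rest. The label of a path is attached to its first vertex, so two
-- labels seen from `v` can agree only if two walks lead from a common root to `v`. Cutting the
-- paths to at most `g` vertices keeps these walks within the radius `R` = 2 g + 2 in which a cycle
-- would make `v` bad. Cutting in turn creates ends, and a hub that starts a path or is next to an
-- end may fail, so the number of paths has to be a small multiple of n.
--
-- A d-regular graph need not have a perfect matching, but its bipartite double cover has one by
-- Hall's theorem; this is why the matchings are taken there and are only near-perfect in the graph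
-- itself.
--
-- All constants are fixed before n: the required precision gives `K` and `g`, these give `R`, and
-- the expected number of cycles met within radius `R` is then bounded independently of n.

module Prelude where
  open import Defs renaming (not to notᵇ) public
  open import Data.Bool using (Bool; true; false; if_then_else_; T; T?) renaming (_≟_ to _≟ᵇ_) public
  open import Data.Bool.ListAction using (and) public
  open import Data.Bool.Properties using (T-∧; ¬-not) public
  open import Data.Empty using (⊥; ⊥-elim) public
  open import Data.Fin using (Fin; zero; suc; toℕ; fromℕ<; _≟_) public
  open import Data.Fin.Properties using (toℕ<n; toℕ-injective; any?; all?) public
  open import Data.Fin.Subset using (Subset; ⁅_⁆; _∪_; ∣_∣) renaming (_∈_ to _∈ˢ_; _∉_ to _∉ˢ_; ⊥ to ∅; ⊤ to full) public
  open import Data.Fin.Subset.Properties using (x∈p∪q⁻; x∈p∪q⁺; x∈⁅x⁆; x∈⁅y⁆⇒x≡y; ∉⊥; ∈⊤; ⊆-antisym) public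
  open import Data.List using (List; []; _∷_; _++_; map; length; concat; concatMap; filter; filterᵇ; allFin; reverse; _ʳ++_; _∷ʳ_; take; drop) public
  open import Data.List.Membership.Propositional using (_∈_; _∉_; find; lose) public
  open import Data.List.Membership.Propositional.Properties using (∈-allFin; ∈-++⁺ˡ; ∈-++⁺ʳ; ∈-++⁻; ∈-map⁺; ∈-map⁻; ∈-filter⁺; ∈-filter⁻; ∈-∃++; ∈-concat⁺′; ∈-concat⁻′; ∈-length) public
  open import Data.List.Properties using (length-++; length-map; ++-assoc; ++-identityʳ; length-tabulate; map-tabulate; ∷-injectiveˡ; ∷-injectiveʳ; concat-++; reverse-++; ∷ʳ-injective; ++-conicalʳ; length-ʳ++; take++drop≡id; length-take; length-drop) public
  open import Data.List.Relation.Binary.Permutation.Propositional using (_↭_; ↭-sym; prep; swap; refl; trans; ↭-reflexive) public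
  open import Data.List.Relation.Binary.Permutation.Propositional.Properties using (shift; shifts; ∈-resp-↭; All-resp-↭; ↭-length; ↭-reverse; ++↭ʳ++) renaming (++⁺ˡ to ↭-++⁺ˡ; ++⁺ʳ to ↭-++⁺ʳ; ++⁺ to ↭-++⁺) public
  open import Data.List.Relation.Unary.All using (All; []; _∷_) public
  open import Data.List.Relation.Unary.AllPairs using (AllPairs; []; _∷_) public
  open import Data.List.Relation.Unary.Any using (Any; here; there) public
  open import Data.List.Relation.Unary.Linked using (Linked; []; [-]; _∷_; linked?) public
  open import Data.List.Relation.Unary.Unique.Propositional using (Unique) public
  open import Data.List.Relation.Unary.Unique.Propositional.Properties using (allFin⁺) renaming (filter⁺ to filter-unique) public
  open import Data.Maybe using (Maybe; just; nothing) public
  open import Data.Maybe.Properties using (just-injective) public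
  open import Data.Nat using (ℕ; zero; suc; _+_; _*_; _∸_; _^_; _≤_; _<_; z≤n; s≤s; _!; NonZero; nonZero; >-nonZero; _≤?_; _<?_) public
  open import Data.Nat.Properties renaming (_≟_ to _≟ℕ_) public
  open import Data.Nat.Tactic.RingSolver using (solve-∀) public
  open import Data.Product using (Σ; ∃; _×_; _,_; proj₁; proj₂; ∃-syntax) public
  open import Data.Sum using (_⊎_; inj₁; inj₂) public
  open import Data.Unit using (tt) public
  open import Data.Vec using (Vec; lookup; tabulate; _[_]≔_; countᵇ) renaming ([] to []ᵥ; _∷_ to _∷ᵥ_) public
  open import Data.Vec.Properties using (lookup∘tabulate; lookup⇒[]=; []=⇒lookup; tabulate∘lookup; tabulate-cong; lookup∘update; lookup∘update′) public
  open import Function using (_∘_; id; case_of_) public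
  open import Function.Bundles using (Equivalence) public
  open import Level using (Level) public
  open import Relation.Binary.Construct.Closure.ReflexiveTransitive using (Star; _◅_; _◅◅_) renaming (ε to stay) public
  open import Relation.Binary.Definitions using (tri<; tri≈; tri>) public
  open import Relation.Binary.PropositionalEquality using (_≡_; _≢_; refl; sym; cong; cong₂; subst; subst₂) renaming (trans to ≡-trans) public
  open import Relation.Nullary using (¬_; Dec; yes; no; does) public
  open import Relation.Nullary.Decidable using (_×-dec_; _⊎-dec_; _→-dec_; ¬?; dec-true; dec-false) public

-- Finite sums over lists and indicator functions

module Sums where
  open Prelude public

  private variable
    a b p q : Level
    A : Set a
    B : Set b
    P : Set p
    Q : Set q

  infixr 2 _⨾_
  _⨾_ : {x y z : A} → x ≡ y → y ≡ z → x ≡ z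
  _⨾_ = ≡-trans

  ∑ : List A → (A → ℕ) → ℕ
  ∑ []       f = 0
  ∑ (x ∷ xs) f = f x + ∑ xs f

  ⟦_⟧ : Dec P → ℕ
  ⟦ yes _ ⟧ = 1
  ⟦ no  _ ⟧ = 0

  ⟦⟧-yes : (d : Dec P) → P → ⟦ d ⟧ ≡ 1
  ⟦⟧-yes (yes _) _ = refl
  ⟦⟧-yes (no ¬p) x = ⊥-elim (¬p x)

  ⟦⟧-no : (d : Dec P) → ¬ P → ⟦ d ⟧ ≡ 0
  ⟦⟧-no (yes x) ¬p = ⊥-elim (¬p x)
  ⟦⟧-no (no _)  _  = refl

  ⟦⟧-mono : (d : Dec P) (e : Dec Q) → (P → Q) → ⟦ d ⟧ ≤ ⟦ e ⟧
  ⟦⟧-mono (yes x) e f rewrite ⟦⟧-yes e (f x) = ≤-refl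
  ⟦⟧-mono (no _)  e f = z≤n

  ⟦⟧-≤1 : (d : Dec P) → ⟦ d ⟧ ≤ 1
  ⟦⟧-≤1 (yes _) = ≤-refl
  ⟦⟧-≤1 (no _)  = z≤n

  ⟦⟧-≢0 : (d : Dec P) → ⟦ d ⟧ ≢ 0 → P
  ⟦⟧-≢0 (yes x) _ = x
  ⟦⟧-≢0 (no _)  h = ⊥-elim (h refl)

  ∑-mono-∈ : (xs : List A) {f g : A → ℕ} → (∀ x → x ∈ xs → f x ≤ g x) → ∑ xs f ≤ ∑ xs g
  ∑-mono-∈ []       h = z≤n
  ∑-mono-∈ (x ∷ xs) h = +-mono-≤ (h x (here refl)) (∑-mono-∈ xs (λ y y∈ → h y (there y∈)))

  ∑-mono : (xs : List A) {f g : A → ℕ} → (∀ x → f x ≤ g x) → ∑ xs f ≤ ∑ xs g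
  ∑-mono xs h = ∑-mono-∈ xs (λ x _ → h x)

  ∑-cong-∈ : (xs : List A) {f g : A → ℕ} → (∀ x → x ∈ xs → f x ≡ g x) → ∑ xs f ≡ ∑ xs g
  ∑-cong-∈ []       h = refl
  ∑-cong-∈ (x ∷ xs) h = cong₂ _+_ (h x (here refl)) (∑-cong-∈ xs (λ y y∈ → h y (there y∈)))

  ∑-cong : (xs : List A) {f g : A → ℕ} → (∀ x → f x ≡ g x) → ∑ xs f ≡ ∑ xs g
  ∑-cong xs h = ∑-cong-∈ xs (λ x _ → h x)

  +-interchange : ∀ m n o p → (m + n) + (o + p) ≡ (m + o) + (n + p)
  +-interchange = solve-∀

  ∑-+ : (xs : List A) (f g : A → ℕ) → ∑ xs (λ x → f x + g x) ≡ ∑ xs f + ∑ xs g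
  ∑-+ []       f g = refl
  ∑-+ (x ∷ xs) f g = cong (f x + g x +_) (∑-+ xs f g) ⨾ +-interchange (f x) (g x) (∑ xs f) (∑ xs g)

  ∑-*ˡ : (xs : List A) (c : ℕ) (f : A → ℕ) → ∑ xs (λ x → c * f x) ≡ c * ∑ xs f
  ∑-*ˡ []       c f = sym (*-zeroʳ c)
  ∑-*ˡ (x ∷ xs) c f = cong (c * f x +_) (∑-*ˡ xs c f) ⨾ sym (*-distribˡ-+ c (f x) (∑ xs f))

  ∑-*ʳ : (xs : List A) (c : ℕ) (f : A → ℕ) → ∑ xs (λ x → f x * c) ≡ ∑ xs f * c
  ∑-*ʳ xs c f = ∑-cong xs (λ x → *-comm (f x) c) ⨾ ∑-*ˡ xs c f ⨾ *-comm c _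

  ∑-const : (xs : List A) (c : ℕ) → ∑ xs (λ _ → c) ≡ length xs * c
  ∑-const []       c = refl
  ∑-const (x ∷ xs) c = cong (c +_) (∑-const xs c)

  ∑-zero : (xs : List A) → ∑ xs (λ _ → 0) ≡ 0
  ∑-zero xs = ∑-const xs 0 ⨾ *-zeroʳ (length xs)

  ∑-1 : (xs : List A) → ∑ xs (λ _ → 1) ≡ length xs
  ∑-1 xs = ∑-const xs 1 ⨾ *-identityʳ _

  ∑-bound : (xs : List A) {f : A → ℕ} {c : ℕ} → (∀ x → x ∈ xs → f x ≤ c) → ∑ xs f ≤ length xs * c
  ∑-bound xs {c = c} h = ≤-trans (∑-mono-∈ xs h) (≤-reflexive (∑-const xs c))

  ∑-swap : (xs : List A) (ys : List B) (f : A → B → ℕ) →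
           ∑ xs (λ x → ∑ ys (f x)) ≡ ∑ ys (λ y → ∑ xs (λ x → f x y))
  ∑-swap []       ys f = sym (∑-zero ys)
  ∑-swap (x ∷ xs) ys f =
    cong (∑ ys (f x) +_) (∑-swap xs ys f) ⨾ sym (∑-+ ys (f x) (λ y → ∑ xs (λ x → f x y)))

  ∑-++ : (xs ys : List A) (f : A → ℕ) → ∑ (xs ++ ys) f ≡ ∑ xs f + ∑ ys f
  ∑-++ []       ys f = refl
  ∑-++ (x ∷ xs) ys f = cong (f x +_) (∑-++ xs ys f) ⨾ sym (+-assoc (f x) _ _)

  ∑-map : (h : A → B) (xs : List A) (f : B → ℕ) → ∑ (map h xs) f ≡ ∑ xs (f ∘ h)
  ∑-map h []       f = refl
  ∑-map h (x ∷ xs) f = cong (f (h x) +_) (∑-map h xs f)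

  ∑-concat : (xss : List (List A)) (f : A → ℕ) → ∑ (concat xss) f ≡ ∑ xss (λ xs → ∑ xs f)
  ∑-concat []         f = refl
  ∑-concat (xs ∷ xss) f = ∑-++ xs (concat xss) f ⨾ cong (∑ xs f +_) (∑-concat xss f)

  ∑-↭ : {xs ys : List A} (f : A → ℕ) → xs ↭ ys → ∑ xs f ≡ ∑ ys f
  ∑-↭ f refl         = refl
  ∑-↭ f (prep x r)   = cong (f x +_) (∑-↭ f r)
  ∑-↭ f (swap {xs = xs} {ys = ys} x y r) = sym (+-assoc (f x) (f y) _) ⨾ cong₂ _+_ (+-comm (f x) (f y)) (∑-↭ f r)
                       ⨾ +-assoc (f y) (f x) _
  ∑-↭ f (trans r s)  = ∑-↭ f r ⨾ ∑-↭ f s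

  ∈⇒≤∑ : {xs : List A} (f : A → ℕ) {x : A} → x ∈ xs → f x ≤ ∑ xs f
  ∈⇒≤∑ f (here refl) = m≤m+n _ _
  ∈⇒≤∑ f (there x∈)  = ≤-trans (∈⇒≤∑ f x∈) (m≤n+m _ _)

  -- Each entry of the duplicate-free `zs` can be cut out of `ys` separately; repetitions in `ys`
  -- only enlarge the right side.
  ∑-⊆ : (zs ys : List A) (f : A → ℕ) → Unique zs → (∀ z → z ∈ zs → z ∈ ys) → ∑ zs f ≤ ∑ ys f
  ∑-⊆ []       ys f _        h = z≤n
  ∑-⊆ (z ∷ zs) ys f (z∉ ∷ u) h with ∈-∃++ (h z (here refl))
  ... | us , vs , refl = ≤-trans (+-monoʳ-≤ (f z) (∑-⊆ zs (us ++ vs) f u zs⊆))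
                          (≤-reflexive (∑-↭ f (↭-sym (shift z us vs))))
    where
    zs⊆ : ∀ w → w ∈ zs → w ∈ us ++ vs
    zs⊆ w w∈ with ∈-resp-↭ (shift z us vs) (h w (there w∈))
    ... | here refl = ⊥-elim (All.lookup z∉ w∈ refl)
    ... | there w∈′ = w∈′

  length-⊆ : (zs ys : List A) → Unique zs → (∀ z → z ∈ zs → z ∈ ys) → length zs ≤ length ys
  length-⊆ zs ys u h = subst₂ _≤_ (∑-1 zs) (∑-1 ys) (∑-⊆ zs ys (λ _ → 1) u h)

  ∑-unique-≤1 : (xs : List A) {P : A → Set p} (P? : ∀ x → Dec (P x)) → Unique xs →
                (∀ x y → P x → P y → x ≡ y) → ∑ xs (λ x → ⟦ P? x ⟧) ≤ 1
  ∑-unique-≤1 []       P? _        h = z≤n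
  ∑-unique-≤1 (x ∷ xs) P? (x∉ ∷ u) h with P? x
  ... | no _  = ∑-unique-≤1 xs P? u h
  ... | yes p = ≤-reflexive (cong suc (∑-cong-∈ xs (λ y y∈ → ⟦⟧-no (P? y) (λ q → All.lookup x∉ y∈ (h x y p q))) ⨾ ∑-zero xs))

  ∑-single : ∀ {n} (c : Fin n) → ∑ (allFin n) (λ x → ⟦ x ≟ c ⟧) ≡ 1
  ∑-single {n} c = ≤-antisym (∑-unique-≤1 (allFin n) (_≟ c) (allFin⁺ n) (λ x y p q → p ⨾ sym q))
    (≤-trans (≤-reflexive (sym (⟦⟧-yes (c ≟ c) refl))) (∈⇒≤∑ (λ x → ⟦ x ≟ c ⟧) (∈-allFin c)))

  ∑-single′ : ∀ {n} (c : Fin n) (f : Fin n → ℕ) → ∑ (allFin n) (λ x → ⟦ x ≟ c ⟧ * f x) ≡ f c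
  ∑-single′ {n} c f = ∑-cong (allFin n) (λ x → lem x (x ≟ c)) ⨾ ∑-*ʳ (allFin n) (f c) (λ x → ⟦ x ≟ c ⟧)
      ⨾ cong (_* f c) (∑-single c) ⨾ *-identityˡ (f c)
    where
    lem : ∀ x (d : Dec (x ≡ c)) → ⟦ d ⟧ * f x ≡ ⟦ d ⟧ * f c
    lem x (yes refl) = refl
    lem x (no _)     = refl

  ∑≢0⇒∃ : (xs : List A) (f : A → ℕ) → ∑ xs f ≢ 0 → ∃[ x ] (x ∈ xs × f x ≢ 0)
  ∑≢0⇒∃ []       f h = ⊥-elim (h refl)
  ∑≢0⇒∃ (x ∷ xs) f h with f x ≟ℕ 0
  ... | no ¬0 = x , here refl , ¬0
  ... | yes e with ∑≢0⇒∃ xs f (λ e′ → h (cong₂ _+_ e e′))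
  ...   | y , y∈ , p = y , there y∈ , p

  -- The first moment method without division: if every `c * f x` exceeded `M`, so would their
  -- average.
  ∑-pick : (xs : List A) (f : A → ℕ) (c M : ℕ) → 0 < length xs → c * ∑ xs f ≤ length xs * M →
           ∃[ x ] (c * f x ≤ M)
  ∑-pick xs f c M 0<l h with Any.any? (λ x → c * f x ≤? M) xs
  ... | yes i = let x , _ , q = find i in x , q
  ... | no ¬i = ⊥-elim (<⇒≱ big h)
    where
    all> : ∀ x → x ∈ xs → suc M ≤ c * f x
    all> x x∈ = ≰⇒> (λ q → ¬i (lose x∈ q))
    big : length xs * M < c * ∑ xs f
    big = begin-strict
      length xs * M  <⟨ *-monoʳ-< (length xs) {{>-nonZero 0<l}} (n<1+n M) ⟩
      length xs * suc M  ≡⟨ sym (∑-const xs (suc M)) ⟩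
      ∑ xs (λ _ → suc M)  ≤⟨ ∑-mono-∈ xs all> ⟩
      ∑ xs (λ x → c * f x)  ≡⟨ ∑-*ˡ xs c f ⟩
      c * ∑ xs f  ∎
      where open ≤-Reasoning

  length-allFin : ∀ n → length (allFin n) ≡ n
  length-allFin n = length-tabulate {n = n} id

  ∑-strict : {xs : List A} {f g : A → ℕ} {x : A} → (∀ y → f y ≤ g y) → x ∈ xs → f x < g x → ∑ xs f < ∑ xs g
  ∑-strict {xs = _ ∷ xs} h (here refl) f<g = +-mono-<-≤ f<g (∑-mono xs h)
  ∑-strict               h (there x∈)  f<g = +-mono-≤-< (h _) (∑-strict h x∈ f<g)

  ∑-filter : (xs : List A) {P : A → Set p} (P? : ∀ x → Dec (P x)) → ∑ xs (λ x → ⟦ P? x ⟧) ≡ ∑ (filter P? xs) (λ x → ⟦ P? x ⟧)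
  ∑-filter []       P? = refl
  ∑-filter (x ∷ xs) P? with P? x in eq
  ... | yes _ = cong₂ _+_ (sym (cong ⟦_⟧ eq)) (∑-filter xs P?)
  ... | no _  = ∑-filter xs P?

  ∑-⊆-supp : (xs ys : List A) {P : A → Set p} (P? : ∀ x → Dec (P x)) → Unique xs →
             (∀ x → x ∈ xs → P x → x ∈ ys) → ∑ xs (λ x → ⟦ P? x ⟧) ≤ ∑ ys (λ x → ⟦ P? x ⟧)
  ∑-⊆-supp xs ys P? u h = ≤-trans (≤-reflexive (∑-filter xs P?))
    (∑-⊆ (filter P? xs) ys (λ x → ⟦ P? x ⟧) (filter-unique P? u)
         (λ z z∈ → let z∈xs , pz = ∈-filter⁻ P? z∈ in h z z∈xs pz))

  𝟙 : Bool → ℕ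
  𝟙 true  = 1
  𝟙 false = 0

  degree : ∀ {n} → (Fin n → Fin n → Bool) → Fin n → ℕ
  degree {n} e x = ∑ (allFin n) (λ y → 𝟙 (e x y))

  ∑-member : ∀ {n} (l : List (Fin n)) → ∑ (allFin n) (λ x → ⟦ Any.any? (x ≟_) l ⟧) ≤ length l
  ∑-member {n} l = ≤-trans (∑-⊆-supp (allFin n) l (λ x → Any.any? (x ≟_) l) (allFin⁺ n) (λ _ _ x∈ → x∈))
    (≤-trans (∑-bound l (λ x _ → ⟦⟧-≤1 (Any.any? (x ≟_) l))) (≤-reflexive (*-identityʳ (length l))))

  tuples : (n k : ℕ) → List (List (Fin n))
  tuples n zero    = [] ∷ []
  tuples n (suc k) = concatMap (λ x → map (x ∷_) (tuples n k)) (allFin n)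

  ∑-tuples-suc : ∀ n k (f : List (Fin n) → ℕ) →
                 ∑ (tuples n (suc k)) f ≡ ∑ (allFin n) (λ x → ∑ (tuples n k) (λ t → f (x ∷ t)))
  ∑-tuples-suc n k f = ∑-concat (map (λ x → map (x ∷_) (tuples n k)) (allFin n)) f ⨾ ∑-map _ (allFin n) _
    ⨾ ∑-cong (allFin n) (λ x → ∑-map (x ∷_) (tuples n k) f)

  ∈-tuples : ∀ {n} (l : List (Fin n)) → l ∈ tuples n (length l)
  ∈-tuples []      = here refl
  ∈-tuples {n} (x ∷ l) = ∈-concat⁺′ (∈-map⁺ (x ∷_) (∈-tuples l)) (∈-map⁺ (λ x → map (x ∷_) (tuples n (length l))) (∈-allFin x))

  length-tuples : ∀ {n} k {l : List (Fin n)} → l ∈ tuples n k → length l ≡ k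
  length-tuples zero (here refl) = refl
  length-tuples {n} (suc k) l∈ with ∈-concat⁻′ (map (λ x → map (x ∷_) (tuples n k)) (allFin n)) l∈
  ... | zs , l∈zs , zs∈ with ∈-map⁻ (λ x → map (x ∷_) (tuples n k)) zs∈
  ...   | x , _ , refl with ∈-map⁻ (x ∷_) l∈zs
  ...     | t , t∈ , refl = cong suc (length-tuples k t∈)

-- Riemann sums for the integral of (1 - x^m)^j

module Riemann where
  open Sums public

  ∑< : ℕ → (ℕ → ℕ) → ℕ
  ∑< zero    f = 0
  ∑< (suc k) f = ∑< k f + f k

  ∑<-mono : ∀ K {f g : ℕ → ℕ} → (∀ k → k < K → f k ≤ g k) → ∑< K f ≤ ∑< K g
  ∑<-mono zero    h = z≤n
  ∑<-mono (suc K) h = +-mono-≤ (∑<-mono K (λ k k< → h k (m<n⇒m<1+n k<))) (h K ≤-refl)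

  ∑<-+ : ∀ K (f g : ℕ → ℕ) → ∑< K (λ k → f k + g k) ≡ ∑< K f + ∑< K g
  ∑<-+ zero    f g = refl
  ∑<-+ (suc K) f g = cong (_+ (f K + g K)) (∑<-+ K f g) ⨾ +-interchange (∑< K f) (∑< K g) (f K) (g K)

  ∑<-*ˡ : ∀ K c (f : ℕ → ℕ) → ∑< K (λ k → c * f k) ≡ c * ∑< K f
  ∑<-*ˡ zero    c f = sym (*-zeroʳ c)
  ∑<-*ˡ (suc K) c f = cong (_+ c * f K) (∑<-*ˡ K c f) ⨾ sym (*-distribˡ-+ c (∑< K f) (f K))

  ∑<-const : ∀ K c → ∑< K (λ _ → c) ≡ K * c
  ∑<-const zero    c = refl
  ∑<-const (suc K) c = cong (_+ c) (∑<-const K c) ⨾ +-comm (K * c) c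

  ∑<-suc : ∀ K (f : ℕ → ℕ) → ∑< (suc K) f ≡ f 0 + ∑< K (f ∘ suc)
  ∑<-suc zero    f = +-comm 0 (f 0)
  ∑<-suc (suc K) f = cong (_+ f (suc K)) (∑<-suc K f) ⨾ +-assoc (f 0) _ _

  ∑-allFin-suc : ∀ {n} (g : Fin (suc n) → ℕ) → ∑ (allFin (suc n)) g ≡ g zero + ∑ (allFin n) (g ∘ suc)
  ∑-allFin-suc {n} g = cong (g zero +_)
    (cong (λ xs → ∑ xs g) (sym (map-tabulate id suc)) ⨾ ∑-map suc (allFin n) g)

  ∑-toℕ : ∀ K (f : ℕ → ℕ) → ∑ (allFin K) (f ∘ toℕ) ≡ ∑< K f
  ∑-toℕ zero    f = refl
  ∑-toℕ (suc K) f = ∑-allFin-suc {K} (f ∘ toℕ) ⨾ cong (f 0 +_) (∑-toℕ K (f ∘ suc)) ⨾ sym (∑<-suc K f)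

  -- Summation by parts: the increment `g k` contributes to the `suc k` values f 0, ..., f k, and
  -- the boundary term vanishes with `f K`.
  abel : ∀ K (f g : ℕ → ℕ) → f K ≡ 0 → (∀ k → f k ≤ f (suc k) + g k) →
         ∑< K f ≤ ∑< K (λ k → suc k * g k)
  abel K f g fK≡0 h = ≤-trans (partial K) (≤-reflexive
      (cong (λ z → K * z + ∑< K (λ k → suc k * g k)) fK≡0 ⨾ cong (_+ ∑< K (λ k → suc k * g k)) (*-zeroʳ K)))
    where
    open ≤-Reasoning
    rearrange : ∀ j x y s → suc j * (x + y) + s ≡ suc j * x + (s + suc j * y)
    rearrange = solve-∀
    partial : ∀ j → ∑< j f ≤ j * f j + ∑< j (λ k → suc k * g k)
    partial zero    = z≤n
    partial (suc j) = begin
      ∑< j f + f j  ≤⟨ +-monoˡ-≤ (f j) (partial j) ⟩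
      j * f j + s + f j  ≡⟨ +-comm (j * f j + s) (f j) ⨾ sym (+-assoc (f j) _ s) ⟩
      suc j * f j + s  ≤⟨ +-monoˡ-≤ s (*-monoʳ-≤ (suc j) (h j)) ⟩
      suc j * (f (suc j) + g j) + s  ≡⟨ rearrange j (f (suc j)) (g j) s ⟩
      suc j * f (suc j) + (s + suc j * g j)  ∎
      where s = ∑< j (λ k → suc k * g k)

  -- The mean value inequality for x^(s+1) between `b` and `a`, with the derivative taken at the
  -- larger end.
  ^-diff : ∀ s {a b c} → b ≤ a → a ≤ b + c → a ^ suc s ≤ b ^ suc s + suc s * (c * a ^ s)
  ^-diff zero {a} {b} {c} b≤a h = ≤-trans (≤-reflexive (*-identityʳ a)) (≤-trans h (≤-reflexive (lem b c)))
    where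
    lem : ∀ b c → b + c ≡ b * 1 + 1 * (c * 1)
    lem = solve-∀
  ^-diff (suc s) {a} {b} {c} b≤a h = begin
    a * a ^ suc s  ≤⟨ *-monoʳ-≤ a (^-diff s b≤a h) ⟩
    a * (b ^ suc s + suc s * (c * a ^ s))  ≡⟨ lem₁ a (b ^ suc s) s c (a ^ s) ⟩
    a * b ^ suc s + suc s * (c * a ^ suc s)  ≤⟨ +-monoˡ-≤ _ (*-monoˡ-≤ (b ^ suc s) h) ⟩
    (b + c) * b ^ suc s + suc s * (c * a ^ suc s)  ≡⟨ lem₂ b c (b ^ suc s) _ ⟩
    b * b ^ suc s + (c * b ^ suc s + suc s * (c * a ^ suc s)) ≤⟨ +-monoʳ-≤ (b * b ^ suc s)
        (+-monoˡ-≤ _ (*-monoʳ-≤ c (^-monoˡ-≤ (suc s) b≤a))) ⟩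
    b ^ suc (suc s) + suc (suc s) * (c * a ^ suc s)  ∎
    where
    open ≤-Reasoning
    lem₁ : ∀ a x s c y → a * (x + suc s * (c * y)) ≡ a * x + suc s * (c * (a * y))
    lem₁ = solve-∀
    lem₂ : ∀ b c x y → (b + c) * x + y ≡ b * x + (c * x + y)
    lem₂ = solve-∀

  -- K^(m j + 1) times the Riemann sum of ∫₀¹ (1 − xᵐ)ʲ dx with step 1/K.
  riemannSum : ℕ → ℕ → ℕ → ℕ
  riemannSum m K j = ∑< K (λ k → (K ^ m ∸ k ^ m) ^ j)

  -- Collects the errors of the repeated integration by parts. It does not depend on `K`, whereas
  -- the main term is linear in `K`, so a large `K` makes the discretisation harmless.
  riemannError : ℕ → ℕ → ℕ
  riemannError m zero    = 0
  riemannError m (suc j) = suc j * m * (riemannError m j + prod1 j (λ i → i * m + 1) * m)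

  -- Discrete form of the integration by parts (j m + 1) ∫ (1 − xᵐ)ʲ = j m ∫ (1 − xᵐ)ʲ⁻¹.
  riemannSum-step : ∀ m′ K j → let m = suc m′ in
    (suc j * m + 1) * riemannSum m K (suc j) ≤ suc j * m * (K ^ m * riemannSum m K j + m * (K ^ m) ^ suc j)
  riemannSum-step m′ K j = begin
    (suc j * m + 1) * I (suc j)  ≡⟨ cong (_* I (suc j)) (+-comm (suc j * m) 1) ⟩
    I (suc j) + suc j * m * I (suc j)  ≤⟨ +-monoˡ-≤ _ upper ⟩
    suc j * m * (X + Y) + suc j * m * I (suc j)  ≡⟨ collect (suc j * m) X Y (I (suc j)) ⟩
    suc j * m * ((X + I (suc j)) + Y)  ≤⟨ *-monoʳ-≤ (suc j * m) (+-mono-≤ (≤-reflexive complement) Y≤) ⟩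
    suc j * m * (K ^ m * I j + m * (K ^ m) ^ suc j)  ∎
    where
    open ≤-Reasoning
    m = suc m′
    I = riemannSum m K
    b : ℕ → ℕ
    b k = K ^ m ∸ k ^ m
    -- Bounds the increment of k^m by the derivative at the right end of the step.
    c : ℕ → ℕ
    c k = m * suc k ^ m′
    X = ∑< K (λ k → k ^ m * b k ^ j)
    Y = ∑< K (λ k → m * K ^ m′ * b k ^ j)
    collect : ∀ w x y z → w * (x + y) + w * z ≡ w * ((x + z) + y)
    collect = solve-∀
    suc^≤ : ∀ k → suc k ^ m ≤ k ^ m + c k
    suc^≤ k = ≤-trans (^-diff m′ {suc k} {k} {1} (n≤1+n k) (≤-reflexive (+-comm 1 k)))
                      (≤-reflexive (cong (λ z → k ^ m + m * z) (*-identityˡ (suc k ^ m′))))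
    b≤ : ∀ k → b k ≤ b (suc k) + c k
    b≤ k = m≤n+o⇒m∸n≤o (K ^ m) (k ^ m) (begin
      K ^ m  ≤⟨ m≤n+m∸n (K ^ m) (suc k ^ m) ⟩
      suc k ^ m + b (suc k)  ≤⟨ +-monoˡ-≤ _ (suc^≤ k) ⟩
      k ^ m + c k + b (suc k)  ≡⟨ +-assoc (k ^ m) (c k) _ ⟩
      k ^ m + (c k + b (suc k))  ≡⟨ cong (k ^ m +_) (+-comm (c k) _) ⟩
      k ^ m + (b (suc k) + c k)  ∎)
    b-anti : ∀ k → b (suc k) ≤ b k
    b-anti k = ∸-monoʳ-≤ (K ^ m) (^-monoˡ-≤ m (n≤1+n k))
    bK≡0 : b K ^ suc j ≡ 0
    bK≡0 = cong (_^ suc j) (n∸n≡0 (K ^ m))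
    shuffle : ∀ k j c x → suc k * (suc j * (c * x)) ≡ suc j * (suc k * c * x)
    shuffle = solve-∀
    -- Here `suc k * c k` equals m (k + 1)^m. Moving the argument back from `suc k` to `k` costs at
    -- most m K^(m - 1), which is collected in `Y`.
    term : ∀ k → k < K → suc k * (suc j * (c k * b k ^ j)) ≤ suc j * m * (k ^ m * b k ^ j + m * K ^ m′ * b k ^ j)
    term k k<K = begin
      suc k * (suc j * (c k * b k ^ j))  ≡⟨ shuffle k j (c k) (b k ^ j) ⟩
      suc j * (suc k * c k * b k ^ j)  ≡⟨ lem k j m (suc k ^ m′) (b k ^ j) ⟩
      suc j * m * (suc k ^ m * b k ^ j)             ≤⟨ *-monoʳ-≤ (suc j * m) (*-monoˡ-≤ (b k ^ j) (≤-trans (suc^≤ k)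
           (+-monoʳ-≤ (k ^ m) (*-monoʳ-≤ m (^-monoˡ-≤ m′ k<K))))) ⟩
      suc j * m * ((k ^ m + m * K ^ m′) * b k ^ j)  ≡⟨ cong (suc j * m *_) (*-distribʳ-+ (b k ^ j) (k ^ m) (m * K ^ m′)) ⟩
      suc j * m * (k ^ m * b k ^ j + m * K ^ m′ * b k ^ j) ∎
      where
      lem : ∀ k j m x y → suc j * (suc k * (m * x) * y) ≡ suc j * m * (suc k * x * y)
      lem = solve-∀
    upper : I (suc j) ≤ suc j * m * (X + Y)
    upper = begin
      I (suc j)                                                ≤⟨ abel K (λ k → b k ^ suc j) (λ k → suc j * (c k * b k ^ j)) bK≡0
                          (λ k → ^-diff j (b-anti k) (b≤ k)) ⟩
      ∑< K (λ k → suc k * (suc j * (c k * b k ^ j)))  ≤⟨ ∑<-mono K term ⟩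
      ∑< K (λ k → suc j * m * (k ^ m * b k ^ j + m * K ^ m′ * b k ^ j)) ≡⟨ ∑<-*ˡ K (suc j * m) _ ⟩
      suc j * m * ∑< K (λ k → k ^ m * b k ^ j + m * K ^ m′ * b k ^ j)  ≡⟨ cong (suc j * m *_) (∑<-+ K _ _) ⟩
      suc j * m * (X + Y)  ∎
    pointwise : ∀ k → k < K → k ^ m * b k ^ j + b k ^ suc j ≡ K ^ m * b k ^ j
    pointwise k k<K = sym (*-distribʳ-+ (b k ^ j) (k ^ m) (b k)) ⨾
      cong (_* b k ^ j) (m+[n∸m]≡n (^-monoˡ-≤ m (<⇒≤ k<K)))
    -- Splits k^m as K^m minus (K^m - k^m). The sum with exponent `suc j` thereby reappears and is
    -- moved to the left side, which is where the factor j m + 1 comes from.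
    complement : X + I (suc j) ≡ K ^ m * I j
    complement = sym (∑<-+ K _ _) ⨾ ≤-antisym (∑<-mono K (λ k k<K → ≤-reflexive (pointwise k k<K)))
        (∑<-mono K (λ k k<K → ≤-reflexive (sym (pointwise k k<K)))) ⨾ ∑<-*ˡ K (K ^ m) _
    Y≤ : Y ≤ m * (K ^ m) ^ suc j
    Y≤ = begin
      Y  ≤⟨ ∑<-mono K (λ k _ → *-monoʳ-≤ (m * K ^ m′) (^-monoˡ-≤ j (m∸n≤m (K ^ m) (k ^ m)))) ⟩
      ∑< K (λ _ → m * K ^ m′ * (K ^ m) ^ j)  ≡⟨ ∑<-const K _ ⟩
      K * (m * K ^ m′ * (K ^ m) ^ j)  ≡⟨ lem K m (K ^ m′) ((K ^ m) ^ j) ⟩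
      m * (K ^ m) ^ suc j  ∎
      where
      lem : ∀ k m x y → k * (m * x * y) ≡ m * ((k * x) * y)
      lem = solve-∀

  -- Iterates the integration by parts down to exponent 0. For m = d - 2 and j = d - 1 the product
  -- on the left is `cDenom d` and the coefficient of `K` is `cNumer d`.
  riemannSum-bound : ∀ m′ K j → let m = suc m′ in
    prod1 j (λ i → i * m + 1) * riemannSum m K j ≤ (j ! * m ^ j * K + riemannError m j) * (K ^ m) ^ j
  riemannSum-bound m′ K zero = ≤-reflexive (lem K (∑< K (λ _ → 1)) (∑<-const K 1))
    where
    lem : ∀ K s → s ≡ K * 1 → 1 * s ≡ (1 * 1 * K + 0) * 1
    lem K _ refl = solve-lem K
      where
      solve-lem : ∀ K → 1 * (K * 1) ≡ (1 * 1 * K + 0) * 1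
      solve-lem = solve-∀
  riemannSum-bound m′ K (suc j) = begin
    P * (suc j * m + 1) * riemannSum m K (suc j)  ≡⟨ *-assoc P (suc j * m + 1) _ ⟩
    P * ((suc j * m + 1) * riemannSum m K (suc j))  ≤⟨ *-monoʳ-≤ P (riemannSum-step m′ K j) ⟩
    P * (suc j * m * (q * I + m * q ^ suc j))  ≡⟨ lem₁ P (suc j * m) q I m (q ^ j) ⟩
    suc j * m * (q * (P * I) + P * m * q ^ suc j)  ≤⟨ *-monoʳ-≤ (suc j * m) (+-monoˡ-≤ _ (*-monoʳ-≤ q (riemannSum-bound m′ K j))) ⟩
    suc j * m * (q * ((j ! * m ^ j * K + e) * q ^ j) + P * m * q ^ suc j) ≡⟨ lem₂ (suc j) m q (j !) (m ^ j) K e (q ^ j) P ⟩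
    (suc j ! * m ^ suc j * K + riemannError m (suc j)) * q ^ suc j ∎
    where
    open ≤-Reasoning
    m = suc m′
    P = prod1 j (λ i → i * m + 1)
    q = K ^ m
    I = riemannSum m K j
    e = riemannError m j
    lem₁ : ∀ P w q I m x → P * (w * (q * I + m * (q * x))) ≡ w * (q * (P * I) + P * m * (q * x))
    lem₁ = solve-∀
    lem₂ : ∀ s m q f y K e x P → s * m * (q * ((f * y * K + e) * x) + P * m * (q * x))
           ≡ (s * f * (m * y) * K + s * m * (e + P * m)) * (q * x)
    lem₂ = solve-∀

-- From an order of the hubs to a feasible set

module Hop where
  open Riemann public

  ≟just-dec : ∀ {n} (m : Maybe (Fin n)) (w : Fin n) → Dec (m ≡ just w)
  ≟just-dec m w = Maybe.≡-dec _≟_ m (just w)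

  nothing? : ∀ {a} {A : Set a} (m : Maybe A) → Dec (m ≡ nothing)
  nothing? nothing  = yes refl
  nothing? (just _) = no λ ()

  toSubset : ∀ {n p} {P : Fin n → Set p} → (∀ x → Dec (P x)) → Subset n
  toSubset P? = tabulate (λ x → does (P? x))

  ∈-toSubset⁺ : ∀ {n p} {P : Fin n → Set p} (P? : ∀ x → Dec (P x)) {x} → P x → x ∈ˢ toSubset P?
  ∈-toSubset⁺ P? {x} px = lookup⇒[]= x _ (lookup∘tabulate (λ y → does (P? y)) x ⨾ dec-true (P? x) px)

  ∈-toSubset⁻ : ∀ {n p} {P : Fin n → Set p} (P? : ∀ x → Dec (P x)) {x} → x ∈ˢ toSubset P? → P x
  ∈-toSubset⁻ P? {x} x∈ = of (P? x) (sym (lookup∘tabulate (λ y → does (P? y)) x) ⨾ []=⇒lookup x∈)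
    where
    of : ∀ {p} {P : Set p} (d : Dec P) → does d ≡ true → P
    of (yes p) _ = p

  ∣toSubset∣ : ∀ {n p} {P : Fin n → Set p} (P? : ∀ x → Dec (P x)) → ∣ toSubset P? ∣ ≡ ∑ (allFin n) (λ x → ⟦ P? x ⟧)
  ∣toSubset∣ {zero}  P? = refl
  ∣toSubset∣ {suc n} P? with P? zero | ∑-allFin-suc {n} (λ x → ⟦ P? x ⟧)
  ... | yes _ | e = cong suc (∣toSubset∣ (P? ∘ suc)) ⨾ sym e
  ... | no _  | e = ∣toSubset∣ (P? ∘ suc) ⨾ sym e

  -- In `target-ok` the vertex `b` hops to `w` over `v`. Asking all other neighbours of `w` to come
  -- later than `v` gives every `w` at most one source, and it ensures that the neighbours of `b`
  -- are blue in time.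
  record HopPlan {n : ℕ} (A : Adj n) : Set where
    field
      adj-sym  : ∀ {x y} → Adjacent A x y → Adjacent A y x
      rank     : Fin n → ℕ
      rank-inj : ∀ {x y} → rank x ≡ rank y → x ≡ y
      bound    : ℕ
      rank<    : ∀ x → rank x < bound
      prev     : Fin n → Maybe (Fin n)
      prev-inj : ∀ {u v b} → prev u ≡ just b → prev v ≡ just b → u ≡ v
      target   : Fin n → Maybe (Fin n)
      target-ok : ∀ {v w} → target v ≡ just w → ∃[ b ] (prev v ≡ just b × rank b < rank v × Adjacent A b v × Adjacent A v w
                  × b ≢ w × ¬ Adjacent A b w × (∀ x → Adjacent A w x → x ≢ v → rank v < rank x))

  module _ {n : ℕ} {A : Adj n} (plan : HopPlan A) where
    open HopPlan plan

    private
      -- Two sources of `w` would each have to precede the other as a neighbour of `w`.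
      target-inj : ∀ {u v w} → target u ≡ just w → target v ≡ just w → u ≡ v
      target-inj {u} {v} tu tv with u ≟ v
      ... | yes e = e
      ... | no u≢v with target-ok tu | target-ok tv
      ...   | _ , _ , _ , _ , uw , _ , _ , fu | _ , _ , _ , _ , vw , _ , _ , fv =
        ⊥-elim (<-asym (fu v (adj-sym vw) (λ e → u≢v (sym e))) (fv u (adj-sym uw) u≢v))

      IsTarget : Fin n → Set
      IsTarget w = ∃[ v ] target v ≡ just w

      isTarget? : ∀ w → Dec (IsTarget w)
      isTarget? w = any? (λ v → ≟just-dec (target v) w)

      -- The state just before the hub of rank `k` is treated: blue from the start because nobody
      -- targets the vertex, or reached by an earlier hop.
      Blue : ℕ → Fin n → Set
      Blue k w = (¬ IsTarget w) ⊎ (∃[ v ] (target v ≡ just w × rank v < k))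

      blue? : ∀ k w → Dec (Blue k w)
      blue? k w = ¬? (isTarget? w) ⊎-dec any? (λ v → ≟just-dec (target v) w ×-dec (rank v <? k))

      S : ℕ → Subset n
      S k = toSubset (blue? k)

      blue-suc : ∀ {k w} → Blue k w → Blue (suc k) w
      blue-suc (inj₁ h)           = inj₁ h
      blue-suc (inj₂ (v , t , <k)) = inj₂ (v , t , m<n⇒m<1+n <k)

      blue-or-late : ∀ k w → Blue k w ⊎ (∃[ v ] target v ≡ just w × k ≤ rank v)
      blue-or-late k w with isTarget? w
      ... | no h        = inj₁ (inj₁ h)
      ... | yes (v , t) with rank v <? k
      ...   | yes <k = inj₁ (inj₂ (v , t , <k))
      ...   | no ≮k  = inj₂ (v , t , ≮⇒≥ ≮k)

      Active : ℕ → Fin n → Set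
      Active k v = rank v ≡ k × ∃[ w ] target v ≡ just w

      active? : ∀ k → Dec (∃ (Active k))
      active? k = any? (λ v → (rank v ≟ℕ k) ×-dec any? (λ w → ≟just-dec (target v) w))

      UsedBefore : ℕ → Subset n → Set
      UsedBefore k U = ∀ b → b ∈ˢ U → ∃[ v ] (rank v < k × prev v ≡ just b)

      -- Time runs through the ranks, not through the hops: by `rank-inj` at most one vertex is
      -- active at a rank, and a rank without one leaves the state unchanged.
      run : ∀ k → ∃[ U ] (Star (HopStep A) (S 0 , ∅) (S k , U) × UsedBefore k U)
      run zero    = ∅ , stay , λ b b∈ → ⊥-elim (∉⊥ b∈)
      run (suc k) with run k | active? k
      ... | U , st , used | no ¬act = U , subst (λ T → Star (HopStep A) (S 0 , ∅) (T , U)) same st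
                          , λ b b∈ → let v , <k , p = used b b∈ in v , m<n⇒m<1+n <k , p
        where
        back : ∀ {w} → Blue (suc k) w → Blue k w
        back (inj₁ h) = inj₁ h
        back {w} (inj₂ (v , t , s≤s ≤k)) with m≤n⇒m<n∨m≡n ≤k
        ... | inj₁ <k = inj₂ (v , t , <k)
        ... | inj₂ e  = ⊥-elim (¬act (v , e , w , t))
        same : S k ≡ S (suc k)
        same = ⊆-antisym (λ x∈ → ∈-toSubset⁺ (blue? (suc k)) (blue-suc (∈-toSubset⁻ (blue? k) x∈)))
                         (λ x∈ → ∈-toSubset⁺ (blue? k) (back (∈-toSubset⁻ (blue? (suc k)) x∈)))
      ... | U , st , used | yes (v , rv , w , t) with target-ok t
      ...   | b , pv , b<v , bv , vw , b≢w , ¬bw , first =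
        U ∪ ⁅ b ⁆ , subst (λ T → Star (HopStep A) (S 0 , ∅) (T , U ∪ ⁅ b ⁆)) grow (st ◅◅ (step ◅ stay)) , used′
        where
        b<k : rank b < k
        b<k = subst (rank b <_) rv b<v
        -- If `b` were still white, its source would precede the neighbour `v` of `b`, unless the
        -- source is `v` itself; but the target of `v` is `w`, not `b`.
        blue-b : Blue k b
        blue-b with blue-or-late k b
        ... | inj₁ h = h
        ... | inj₂ (v′ , t′ , k≤) with target-ok t′
        ...   | _ , _ , _ , _ , _ , _ , _ , first′ with v ≟ v′
        ...     | yes refl = ⊥-elim (b≢w (just-injective (sym t′ ⨾ t)))
        ...     | no v≢    = ⊥-elim (<⇒≱ (subst (rank v′ <_) rv (first′ v bv v≢)) k≤)
        -- The source of a target `x` is the earliest neighbour of `x`, hence `b` or something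
        -- before `b`, and that rank has passed.
        blue-nbr : ∀ x → Adjacent A b x → Blue k x
        blue-nbr x bx with blue-or-late k x
        ... | inj₁ h = h
        ... | inj₂ (v′ , t′ , k≤) with target-ok t′
        ...   | _ , _ , _ , _ , _ , _ , _ , first′ with b ≟ v′
        ...     | yes refl = ⊥-elim (<⇒≱ b<k k≤)
        ...     | no b≢    = ⊥-elim (<⇒≱ (<-trans (first′ b (adj-sym bx) b≢) b<k) k≤)
        white-w : ¬ Blue k w
        white-w (inj₁ h) = h (v , t)
        white-w (inj₂ (v′ , t′ , <k)) rewrite target-inj t′ t = <⇒≢ <k rv
        fresh : b ∉ˢ U
        fresh b∈ with used b b∈
        ... | v′ , <k , p rewrite prev-inj p pv = <⇒≢ <k rv
        step : HopStep A (S k , U) (S k ∪ ⁅ w ⁆ , U ∪ ⁅ b ⁆)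
        step = hop b w (∈-toSubset⁺ (blue? k) blue-b) fresh (λ x bx → ∈-toSubset⁺ (blue? k) (blue-nbr x bx))
                   (b≢w , ¬bw , v , bv , vw) (λ w∈ → white-w (∈-toSubset⁻ (blue? k) w∈))
        to : ∀ {x} → Blue (suc k) x → Blue k x ⊎ x ≡ w
        to (inj₁ h) = inj₁ (inj₁ h)
        to (inj₂ (v′ , t′ , s≤s ≤k)) with m≤n⇒m<n∨m≡n ≤k
        ... | inj₁ <k = inj₁ (inj₂ (v′ , t′ , <k))
        ... | inj₂ e rewrite rank-inj (e ⨾ sym rv) = inj₂ (just-injective (sym t′ ⨾ t))
        ∪⊆ : ∀ {x} → x ∈ˢ S k ∪ ⁅ w ⁆ → x ∈ˢ S (suc k)
        ∪⊆ x∈ with x∈p∪q⁻ (S k) ⁅ w ⁆ x∈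
        ... | inj₁ x∈S = ∈-toSubset⁺ (blue? (suc k)) (blue-suc (∈-toSubset⁻ (blue? k) x∈S))
        ... | inj₂ x∈w rewrite x∈⁅y⁆⇒x≡y w x∈w = ∈-toSubset⁺ (blue? (suc k)) (inj₂ (v , t , s≤s (≤-reflexive rv)))
        ⊆∪ : ∀ {x} → x ∈ˢ S (suc k) → x ∈ˢ S k ∪ ⁅ w ⁆
        ⊆∪ {x} x∈ with to (∈-toSubset⁻ (blue? (suc k)) x∈)
        ... | inj₁ h    = x∈p∪q⁺ (inj₁ (∈-toSubset⁺ (blue? k) h))
        ... | inj₂ refl = x∈p∪q⁺ (inj₂ (x∈⁅x⁆ x))
        grow : S k ∪ ⁅ w ⁆ ≡ S (suc k)
        grow = ⊆-antisym ∪⊆ ⊆∪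
        used′ : UsedBefore (suc k) (U ∪ ⁅ b ⁆)
        used′ c c∈ with x∈p∪q⁻ U ⁅ b ⁆ c∈
        ... | inj₁ c∈U = let v′ , <k , p = used c c∈U in v′ , m<n⇒m<1+n <k , p
        ... | inj₂ c∈b rewrite x∈⁅y⁆⇒x≡y b c∈b = v , s≤s (≤-reflexive rv) , pv

    fails : ℕ
    fails = ∑ (allFin n) (λ v → ⟦ nothing? (target v) ⟧)

    feasible-plan : ∃[ B ] (Feasible A B × ∣ B ∣ ≤ fails)
    feasible-plan = S 0 , (proj₁ end , subst (λ T → Star (HopStep A) (S 0 , ∅) (T , proj₁ end)) S≡full (proj₁ (proj₂ end))) , small
      where
      end = run bound
      S≡full : S bound ≡ full
      S≡full = ⊆-antisym (λ _ → ∈⊤) (λ {x} _ → ∈-toSubset⁺ (blue? bound) (all-blue x))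
        where
        all-blue : ∀ x → Blue bound x
        all-blue x with blue-or-late bound x
        ... | inj₁ h = h
        ... | inj₂ (v , _ , ≤r) = ⊥-elim (<⇒≱ (rank< v) ≤r)
      V = allFin n
      hits = ∑ V (λ w → ⟦ isTarget? w ⟧)
      one : ∀ v → 1 ≤ ⟦ nothing? (target v) ⟧ + ∑ V (λ w → ⟦ ≟just-dec (target v) w ⟧)
      one v with target v
      ... | nothing = s≤s z≤n
      ... | just w  = ≤-trans (≤-reflexive (sym (⟦⟧-yes (≟just-dec (just w) w) refl)))
                              (∈⇒≤∑ (λ u → ⟦ ≟just-dec (just w) u ⟧) (∈-allFin w))
      at-most : ∀ w → ∑ V (λ v → ⟦ ≟just-dec (target v) w ⟧) ≤ ⟦ isTarget? w ⟧
      at-most w with isTarget? w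
      ... | yes _ = ∑-unique-≤1 V (λ v → ≟just-dec (target v) w) (allFin⁺ n) (λ _ _ → target-inj)
      ... | no h  = ≤-reflexive (∑-cong V (λ v → ⟦⟧-no (≟just-dec (target v) w) (λ t → h (v , t))) ⨾ ∑-zero V)
      exclusive : ∀ w → ⟦ blue? 0 w ⟧ + ⟦ isTarget? w ⟧ ≤ 1
      exclusive w = of (blue? 0 w) (isTarget? w)
        where
        of : (d : Dec (Blue 0 w)) (e : Dec (IsTarget w)) → ⟦ d ⟧ + ⟦ e ⟧ ≤ 1
        of (yes (inj₁ h)) (yes t) = ⊥-elim (h t)
        of (yes (inj₁ _)) (no _)  = ≤-refl
        of (no _)         e       = ⟦⟧-≤1 e
      open ≤-Reasoning
      -- Comparison with `n` from both sides: a vertex is not both initially blue and a target, and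
      -- every hub either fails or hits a target of its own.
      small : ∣ S 0 ∣ ≤ fails
      small = +-cancelʳ-≤ hits _ _ (begin
        ∣ S 0 ∣ + hits  ≡⟨ cong (_+ hits) (∣toSubset∣ (blue? 0)) ⟩
        ∑ V (λ w → ⟦ blue? 0 w ⟧) + hits  ≡⟨ sym (∑-+ V _ _) ⟩
        ∑ V (λ w → ⟦ blue? 0 w ⟧ + ⟦ isTarget? w ⟧)  ≤⟨ ∑-mono V exclusive ⟩
        ∑ V (λ _ → 1)  ≤⟨ ∑-mono V one ⟩
        ∑ V (λ v → ⟦ nothing? (target v) ⟧ + ∑ V (λ w → ⟦ ≟just-dec (target v) w ⟧)) ≡⟨ ∑-+ V _ _ ⟩
        fails + ∑ V (λ v → ∑ V (λ w → ⟦ ≟just-dec (target v) w ⟧)) ≡⟨ cong (fails +_) (∑-swap V V _) ⟩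
        fails + ∑ V (λ w → ∑ V (λ v → ⟦ ≟just-dec (target v) w ⟧)) ≤⟨ +-monoʳ-≤ fails (∑-mono V at-most) ⟩
        fails + hits  ∎)

-- Maximum matchings of the bipartite double cover

module Kuhn where
  open Hop public

  module Matching {n : ℕ} (e : Fin n → Fin n → Bool) where

    -- A partial injection along edges: arguments are the left copies of the vertices in the double
    -- cover, values are the right copies.
    record IsMatching (h : Fin n → Maybe (Fin n)) : Set where
      field
        edge : ∀ {x y} → h x ≡ just y → e x y ≡ true
        inj  : ∀ {x x′ y} → h x ≡ just y → h x′ ≡ just y → x ≡ x′
    open IsMatching

    unmatched : (Fin n → Maybe (Fin n)) → ℕ
    unmatched h = ∑ (allFin n) (λ x → ⟦ nothing? (h x) ⟧)

    private
      -- Alternating walks, latest vertex first, starting at an unmatched vertex.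
      data Alternating (h : Fin n → Maybe (Fin n)) : List (Fin n) → Set where
        start : ∀ {x} → h x ≡ nothing → Alternating h (x ∷ [])
        step  : ∀ {x xs x′ y} → Alternating h (x ∷ xs) → e x y ≡ true → h x′ ≡ just y → Alternating h (x′ ∷ x ∷ xs)

      assign : (Fin n → Maybe (Fin n)) → Fin n → Fin n → Fin n → Maybe (Fin n)
      assign h x y z with z ≟ x
      ... | yes _ = just y
      ... | no _  = h z

      assign-≢ : ∀ h {x y z} → z ≢ x → assign h x y z ≡ h z
      assign-≢ h {x} {y} {z} z≢x with z ≟ x
      ... | yes z≡x = ⊥-elim (z≢x z≡x)
      ... | no _    = refl

      assign-≡ : ∀ h x y → assign h x y x ≡ just y
      assign-≡ h x y with x ≟ x
      ... | yes _  = refl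
      ... | no x≢x = ⊥-elim (x≢x refl)

      Free : (Fin n → Maybe (Fin n)) → Fin n → Set
      Free h y = ∀ x → h x ≢ just y

      assign-matching : ∀ {h x y} → IsMatching h → e x y ≡ true → Free h y → IsMatching (assign h x y)
      assign-matching {h} {x} {y} m exy free = record { edge = edge′ ; inj = inj′ }
        where
        edge′ : ∀ {z w} → assign h x y z ≡ just w → e z w ≡ true
        edge′ {z} eq with z ≟ x
        edge′ refl | yes refl = exy
        ... | no _ = edge m eq
        inj′ : ∀ {z z′ w} → assign h x y z ≡ just w → assign h x y z′ ≡ just w → z ≡ z′
        inj′ {z} {z′} eq eq′ with z ≟ x | z′ ≟ x
        ... | yes refl | yes refl = refl
        inj′ refl eq′ | yes refl | no _ = ⊥-elim (free _ eq′)
        inj′ eq refl | no _ | yes refl  = ⊥-elim (free _ eq)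
        ... | no _ | no _ = inj m eq eq′

      assign-≤ : ∀ h x y z → ⟦ nothing? (assign h x y z) ⟧ ≤ ⟦ nothing? (h z) ⟧
      assign-≤ h x y z with z ≟ x
      ... | yes _ = z≤n
      ... | no _  = ≤-refl

      unmatched-< : ∀ h x y → h x ≡ nothing → unmatched (assign h x y) < unmatched h
      unmatched-< h x y hx = ∑-strict (assign-≤ h x y) (∈-allFin x)
        (subst (λ m → ⟦ nothing? m ⟧ < ⟦ nothing? (h x) ⟧) (sym (assign-≡ h x y))
          (subst (λ m → 0 < ⟦ nothing? m ⟧) (sym hx) (s≤s z≤n)))

      truncate : ∀ {h x xs} → Alternating h xs → x ∈ xs → ∃[ ys ] (Alternating h (x ∷ ys) × length ys < length xs)
      truncate alt            (here refl) = _ , alt , ≤-refl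
      truncate (step alt _ _) (there x∈)  = let ys , alt′ , sh = truncate alt x∈ in ys , alt′ , m<n⇒m<1+n sh

      transfer : ∀ {h x y xs} → x ∉ xs → Alternating h xs → Alternating (assign h x y) xs
      transfer {h} x∉ (start eq)         = start (assign-≢ h (λ z≡x → x∉ (here (sym z≡x))) ⨾ eq)
      transfer {h} x∉ (step alt exy eq)  =
        step (transfer (λ x∈ → x∉ (there x∈)) alt) exy (assign-≢ h (λ z≡x → x∉ (here (sym z≡x))) ⨾ eq)

      Better : (Fin n → Maybe (Fin n)) → Set
      Better h = ∃[ h′ ] (IsMatching h′ × unmatched h′ < unmatched h)

      -- Works backwards along the walk: giving `y` to `x` frees the old partner of `x`, which the
      -- preceding vertex takes next. If `x` occurs once more on the walk, reassigning it would
      -- spoil the rest, so the walk is shortened to that occurrence.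
      augment : ∀ fuel {h x xs y} → IsMatching h → Alternating h (x ∷ xs) → length xs < fuel →
                e x y ≡ true → Free h y → Better h
      augment (suc fuel) {h} {x} {_} {y} m (start eq) _ exy free =
        assign h x y , assign-matching m exy free , unmatched-< h x y eq
      augment (suc fuel) {h} {x} {x₁ ∷ xs} {y} m (step {y = y₀} alt e₀ eq) (s≤s ≤fuel) exy free
        with Any.any? (x ≟_) (x₁ ∷ xs)
      ... | yes x∈ = let ys , alt′ , sh = truncate alt x∈ in augment fuel m alt′ (<-≤-trans sh ≤fuel) exy free
      ... | no x∉ with augment fuel (assign-matching m exy free) (transfer x∉ alt) ≤fuel e₀ free₀
        where
        free₀ : Free (assign h x y) y₀
        free₀ z eq′ with z ≟ x
        free₀ z refl | yes refl = free x eq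
        ... | no z≢x = z≢x (inj m eq′ eq)
      ...   | h′ , m′ , dec = h′ , m′ , <-≤-trans dec (∑-mono (allFin n) (assign-≤ h x y))

      Covered : (Fin n → Maybe (Fin n)) → List (Fin n) → Fin n → Set
      Covered h R y = Any (λ x′ → h x′ ≡ just y) R

      -- The form that the set of left vertices reachable from unmatched ones takes when no
      -- augmenting walk exists.
      Closed : (Fin n → Maybe (Fin n)) → List (Fin n) → Set
      Closed h R = Unique R × (∀ x → h x ≡ nothing → x ∈ R) × (∀ x → x ∈ R → ∀ y → e x y ≡ true → Covered h R y)

      covered? : ∀ h R y → Dec (Covered h R y)
      covered? h R y = Any.any? (λ x′ → ≟just-dec (h x′) y) R

      Escape : (Fin n → Maybe (Fin n)) → List (Fin n) → Fin n → Set
      Escape h R x = ∃[ y ] (e x y ≡ true × ¬ Covered h R y)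

      escape? : ∀ h R x → Dec (Escape h R x)
      escape? h R x = any? (λ y → (e x y ≟ᵇ true) ×-dec ¬? (covered? h R y))

      -- An escaping edge either ends at an unmatched right vertex and completes an augmenting walk,
      -- or its end is matched to a vertex outside `R`, which is added. The fuel suffices because a
      -- duplicate-free `R` has at most `n` entries.
      explore : ∀ fuel {h} R → IsMatching h → n < fuel + length R → Unique R → (∀ x → h x ≡ nothing → x ∈ R) →
                All (λ x → ∃[ xs ] Alternating h (x ∷ xs)) R → Better h ⊎ ∃[ R′ ] Closed h R′
      explore zero R m n< u free reach =
        ⊥-elim (<⇒≱ n< (≤-trans (length-⊆ R (allFin n) u (λ z _ → ∈-allFin z)) (≤-reflexive (length-allFin n))))
      explore (suc fuel) {h} R m n< u free reach with Any.any? (escape? h R) R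
      ... | no ¬esc = inj₂ (R , u , free , λ x x∈ y exy → covered x x∈ y exy (covered? h R y))
        where
        covered : ∀ x → x ∈ R → ∀ y → e x y ≡ true → Dec (Covered h R y) → Covered h R y
        covered x x∈ y exy (yes c) = c
        covered x x∈ y exy (no ¬c) = ⊥-elim (¬esc (lose x∈ (y , exy , ¬c)))
      ... | yes esc with find esc
      ...   | x , x∈ , y , exy , ¬c with All.lookup reach x∈ | any? (λ x′ → ≟just-dec (h x′) y)
      ...     | xs , alt | no ¬m = inj₁ (augment (suc (length xs)) m alt ≤-refl exy (λ x′ eq → ¬m (x′ , eq)))
      ...     | xs , alt | yes (x′ , eq) =
        explore fuel (x′ ∷ R) m (≤-trans n< (≤-reflexive (sym (+-suc fuel (length R)))))
          (All.tabulate (λ z∈ x′≡z → ¬c (lose (subst (_∈ R) (sym x′≡z) z∈) eq)) ∷ u)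
          (λ z hz → there (free z hz)) ((x ∷ xs , step alt exy eq) ∷ reach)

      improve : ∀ {h} → IsMatching h → Better h ⊎ ∃[ R ] Closed h R
      improve {h} m = explore (suc n) R m (s≤s (m≤m+n n _)) (filter-unique free? (allFin⁺ n))
          (λ x hx → ∈-filter⁺ free? (∈-allFin x) hx)
          (All.tabulate (λ x∈ → [] , start (proj₂ (∈-filter⁻ free? {xs = allFin n} x∈))))
        where
        free? = λ x → nothing? (h x)
        R = filter free? (allFin n)

      saturate : ∀ fuel {h} → IsMatching h → unmatched h < fuel → ∃[ h′ ] (IsMatching h′ × ∃[ R ] Closed h′ R)
      saturate (suc fuel) m (s≤s <fuel) with improve m
      ... | inj₂ c                = _ , m , c
      ... | inj₁ (h′ , m′ , dec) = saturate fuel m′ (<-≤-trans dec <fuel)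

    -- The deficiency version of Hall's theorem by double counting. All edges from a closed `R` end
    -- in right vertices matched to `R`; there are at most |R| minus the number of unmatched
    -- vertices of these, and each receives at most `D` edges.
    near-perfect : (D : ℕ) → (∀ y → ∑ (allFin n) (λ x → 𝟙 (e x y)) ≤ D) →
                   ∃[ h ] (IsMatching h × D * unmatched h ≤ ∑ (allFin n) (λ x → D ∸ degree e x))
    near-perfect D col≤ with saturate (suc (unmatched (λ _ → nothing))) {λ _ → nothing} (record { edge = λ () ; inj = λ () }) ≤-refl
    ... | h , m , R , u , free , closed = h , m , +-cancelˡ-≤ (∑ R (degree e)) _ _ (begin
        ∑ R (degree e) + D * unmatched h  ≤⟨ +-mono-≤ deg≤ (*-monoʳ-≤ D unmatched≤) ⟩
        ∑ R matchedBy * D + D * ∑ R isFree  ≡⟨ factor D (∑ R matchedBy) (∑ R isFree) ⟩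
        D * (∑ R matchedBy + ∑ R isFree)  ≡⟨ cong (D *_) (sym (∑-+ R matchedBy isFree)) ⟩
        D * ∑ R (λ x → matchedBy x + isFree x)  ≤⟨ *-monoʳ-≤ D (∑-bound R (λ x _ → either x)) ⟩
        D * (length R * 1)  ≡⟨ cong (D *_) (*-identityʳ (length R)) ⨾ *-comm D (length R) ⨾ sym (∑-const R D) ⟩
        ∑ R (λ _ → D)  ≤⟨ ∑-mono R (λ x → m≤n+m∸n D (degree e x)) ⟩
        ∑ R (λ x → degree e x + (D ∸ degree e x))  ≡⟨ ∑-+ R _ _ ⟩
        ∑ R (degree e) + ∑ R (λ x → D ∸ degree e x)  ≤⟨ +-monoʳ-≤ _ (∑-⊆ R V _ u (λ z _ → ∈-allFin z)) ⟩
        ∑ R (degree e) + ∑ V (λ x → D ∸ degree e x)  ∎)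
      where
      open ≤-Reasoning
      V = allFin n
      isFree matchedBy : Fin n → ℕ
      isFree x = ⟦ nothing? (h x) ⟧
      matchedBy x = ∑ V (λ y → ⟦ ≟just-dec (h x) y ⟧)
      factor : ∀ D a b → a * D + D * b ≡ D * (a + b)
      factor = solve-∀
      either : ∀ x → matchedBy x + isFree x ≤ 1
      either x with h x
      ... | nothing = ≤-reflexive (cong (_+ 1) (∑-cong V (λ y → ⟦⟧-no (≟just-dec nothing y) λ ()) ⨾ ∑-zero V))
      ... | just z  = ≤-trans (≤-reflexive (+-identityʳ _))
                              (∑-unique-≤1 V (≟just-dec (just z)) (allFin⁺ n) (λ _ _ p q → just-injective (sym p ⨾ q)))
      unmatched≤ : unmatched h ≤ ∑ R isFree
      unmatched≤ = ∑-⊆-supp V R (λ x → nothing? (h x)) (allFin⁺ n) (λ x _ → free x)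
      cover : ∀ x → x ∈ R → ∀ y → 𝟙 (e x y) ≤ ∑ R (λ x′ → ⟦ ≟just-dec (h x′) y ⟧ * 𝟙 (e x y))
      cover x x∈ y with e x y in eq
      ... | false = z≤n
      ... | true with find (closed x x∈ y eq)
      ...   | x′ , x′∈ , hx′ = ≤-trans (≤-reflexive (sym (cong (_* 1) (⟦⟧-yes (≟just-dec (h x′) y) hx′))))
                          (∈⇒≤∑ (λ x″ → ⟦ ≟just-dec (h x″) y ⟧ * 1) x′∈)
      deg≤ : ∑ R (degree e) ≤ ∑ R matchedBy * D
      deg≤ = begin
        ∑ R (λ x → ∑ V (λ y → 𝟙 (e x y)))  ≤⟨ ∑-mono-∈ R (λ x x∈ → ∑-mono V (cover x x∈)) ⟩
        ∑ R (λ x → ∑ V (λ y → ∑ R (λ x′ → ⟦ ≟just-dec (h x′) y ⟧ * 𝟙 (e x y))))  ≡⟨ ∑-cong R (λ x → ∑-swap V R _) ⟩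
        ∑ R (λ x → ∑ R (λ x′ → ∑ V (λ y → ⟦ ≟just-dec (h x′) y ⟧ * 𝟙 (e x y))))  ≡⟨ ∑-swap R R _ ⟩
        ∑ R (λ x′ → ∑ R (λ x → ∑ V (λ y → ⟦ ≟just-dec (h x′) y ⟧ * 𝟙 (e x y))))  ≡⟨ ∑-cong R (λ x′ → ∑-swap R V _) ⟩
        ∑ R (λ x′ → ∑ V (λ y → ∑ R (λ x → ⟦ ≟just-dec (h x′) y ⟧ * 𝟙 (e x y))))  ≡⟨ ∑-cong R (λ x′ → ∑-cong V (λ y → ∑-*ˡ R ⟦ ≟just-dec (h x′) y ⟧ (λ x → 𝟙 (e x y)))) ⟩
        ∑ R (λ x′ → ∑ V (λ y → ⟦ ≟just-dec (h x′) y ⟧ * ∑ R (λ x → 𝟙 (e x y))))        ≤⟨ ∑-mono R (λ x′ → ∑-mono V (λ y → *-monoʳ-≤ ⟦ ≟just-dec (h x′) y ⟧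
                          (≤-trans (∑-⊆ R V _ u (λ z _ → ∈-allFin z)) (col≤ y)))) ⟩
        ∑ R (λ x′ → ∑ V (λ y → ⟦ ≟just-dec (h x′) y ⟧ * D))  ≡⟨ ∑-cong R (λ x′ → ∑-*ʳ V D _) ⟩
        ∑ R (λ x′ → matchedBy x′ * D)  ≡⟨ ∑-*ʳ R D matchedBy ⟩
        ∑ R matchedBy * D  ∎

-- Regular graphs and their complete enumeration

module RegularGraphs where
  open Kuhn public

  record Regular {n : ℕ} (d : ℕ) (A : Adj n) : Set where
    field
      symm : ∀ x y → adj? A x y ≡ adj? A y x
      irr  : ∀ x → adj? A x x ≡ false
      deg  : ∀ x → degree (adj? A) x ≡ d

    adj-sym : ∀ {x y} → Adjacent A x y → Adjacent A y x
    adj-sym {x} {y} p = symm y x ⨾ p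

    ¬loop : ∀ {x} → ¬ Adjacent A x x
    ¬loop {x} p with () ← sym p ⨾ irr x

  and-∀⁻ : ∀ {a} {X : Set a} (f : X → Bool) (xs : List X) → T (and (map f xs)) → ∀ {x} → x ∈ xs → T (f x)
  and-∀⁻ f (y ∷ xs) t (here refl) = proj₁ (Equivalence.to T-∧ t)
  and-∀⁻ f (y ∷ xs) t (there x∈)  = and-∀⁻ f xs (proj₂ (Equivalence.to (T-∧ {f y}) t)) x∈

  and-∀⁺ : ∀ {a} {X : Set a} (f : X → Bool) (xs : List X) → (∀ x → T (f x)) → T (and (map f xs))
  and-∀⁺ f []       h = tt
  and-∀⁺ f (y ∷ xs) h = Equivalence.from T-∧ (h y , and-∀⁺ f xs h)

  boolEq⁻ : ∀ a b → T (boolEq a b) → a ≡ b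
  boolEq⁻ true  true  _ = refl
  boolEq⁻ false false _ = refl

  boolEq⁺ : ∀ a b → a ≡ b → T (boolEq a b)
  boolEq⁺ true  _ refl = tt
  boolEq⁺ false _ refl = tt

  countᵇ-∑ : ∀ {n} (v : Vec Bool n) → countᵇ (λ b → b) v ≡ ∑ (allFin n) (λ j → 𝟙 (lookup v j))
  countᵇ-∑ []ᵥ = refl
  countᵇ-∑ {suc n} (true ∷ᵥ v)  = cong suc (countᵇ-∑ v) ⨾ sym (∑-allFin-suc {n} (λ j → 𝟙 (lookup (true ∷ᵥ v) j)))
  countᵇ-∑ {suc n} (false ∷ᵥ v) = countᵇ-∑ v ⨾ sym (∑-allFin-suc {n} (λ j → 𝟙 (lookup (false ∷ᵥ v) j)))

  toRegular : ∀ {n d} {A : Adj n} → IsSimpleRegular d A → Regular d A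
  toRegular {n} {d} {A} t = record
    { symm = λ x y → boolEq⁻ _ _ (and-∀⁻ _ (allFin n) (and-∀⁻ _ (allFin n) t₁ (∈-allFin x)) (∈-allFin y))
    ; irr  = λ x → false-of (adj? A x x) (and-∀⁻ _ (allFin n) t₂ (∈-allFin x))
    ; deg  = λ x → sym (countᵇ-∑ (lookup A x)) ⨾ ≡ᵇ⇒≡ _ d (and-∀⁻ _ (allFin n) t₃ (∈-allFin x))
    }
    where
    t₁ = proj₁ (Equivalence.to T-∧ t)
    t₂₃ = proj₂ (Equivalence.to (T-∧ {and (map (λ i → and (map (λ j → boolEq (adj? A i j) (adj? A j i)) (allFin n))) (allFin n))}) t)
    t₂ = proj₁ (Equivalence.to T-∧ t₂₃)
    t₃ = proj₂ (Equivalence.to (T-∧ {and (map (λ i → notᵇ (adj? A i i)) (allFin n))}) t₂₃)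
    false-of : ∀ b → T (notᵇ b) → b ≡ false
    false-of false _ = refl

  fromRegular : ∀ {n d} {A : Adj n} → Regular d A → IsSimpleRegular d A
  fromRegular {n} {d} {A} r = Equivalence.from T-∧
    ( and-∀⁺ _ (allFin n) (λ x → and-∀⁺ _ (allFin n) (λ y → boolEq⁺ _ _ (symm x y)))
    , Equivalence.from T-∧
      ( and-∀⁺ _ (allFin n) (λ x → subst (λ b → T (notᵇ b)) (sym (irr x)) tt)
      , and-∀⁺ _ (allFin n) (λ x → ≡⇒≡ᵇ _ d (countᵇ-∑ (lookup A x) ⨾ deg x))))
    where open Regular r

  ∈-allVecs : ∀ {a} {X : Set a} {xs : List X} → (∀ x → x ∈ xs) → ∀ {n} (v : Vec X n) → v ∈ allVecs n xs
  ∈-allVecs all []ᵥ = here refl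
  ∈-allVecs {xs = xs} all {suc n} (x ∷ᵥ v) =
    ∈-concat⁺′ (∈-map⁺ (x ∷ᵥ_) (∈-allVecs all v)) (∈-map⁺ (λ x → map (x ∷ᵥ_) (allVecs n xs)) (all x))

  unique-allVecs : ∀ {a} {X : Set a} {xs : List X} → Unique xs → ∀ n → Unique (allVecs n xs)
  unique-allVecs u zero = [] ∷ []
  unique-allVecs {X = X} {xs = xs} u (suc n) = go xs u
    where
    vs = allVecs n xs
    cons-inj : ∀ {x y : X} {v w : Vec X n} → x ∷ᵥ v ≡ y ∷ᵥ w → x ≡ y × v ≡ w
    cons-inj refl = refl , refl
    go : ∀ ys → Unique ys → Unique (concatMap (λ x → map (x ∷ᵥ_) vs) ys)
    go []       _        = []
    go (y ∷ ys) (y∉ ∷ u′) = Unique.++⁺ (Unique.map⁺ (λ e → proj₂ (cons-inj e)) (unique-allVecs u n)) (go ys u′) disj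
      where
      disj : ∀ {v} → v ∈ map (y ∷ᵥ_) vs × v ∈ concatMap (λ x → map (x ∷ᵥ_) vs) ys → ⊥
      disj (v∈ , v∈′) with ∈-map⁻ (y ∷ᵥ_) v∈ | ∈-concat⁻′ (map (λ x → map (x ∷ᵥ_) vs) ys) v∈′
      ... | w , _ , refl | zs , v∈zs , zs∈ with ∈-map⁻ (λ x → map (x ∷ᵥ_) vs) zs∈
      ...   | x , x∈ , refl with ∈-map⁻ (x ∷ᵥ_) v∈zs
      ...     | w′ , _ , e = All.lookup y∉ x∈ (proj₁ (cons-inj e))

  bools-complete : ∀ b → b ∈ (true ∷ false ∷ [])
  bools-complete true  = here refl
  bools-complete false = there (here refl)

  regularGraphs : (d n : ℕ) → List (Adj n)
  regularGraphs d n = filterᵇ (isSimpleRegular d) (allAdj n)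

  ∈-regularGraphs⁺ : ∀ {d n} {A : Adj n} → Regular d A → A ∈ regularGraphs d n
  ∈-regularGraphs⁺ {d} {n} {A} r =
    ∈-filter⁺ (λ B → T? (isSimpleRegular d B)) (∈-allVecs (∈-allVecs bools-complete) A) (fromRegular r)

  ∈-regularGraphs⁻ : ∀ {d n} {A : Adj n} → A ∈ regularGraphs d n → IsSimpleRegular d A
  ∈-regularGraphs⁻ {d} {n} A∈ = proj₂ (∈-filter⁻ (λ B → T? (isSimpleRegular d B)) {xs = allAdj n} A∈)

  unique-regularGraphs : ∀ d n → Unique (regularGraphs d n)
  unique-regularGraphs d n = filter-unique (λ B → T? (isSimpleRegular d B))
    (unique-allVecs (unique-allVecs (((λ ()) ∷ []) ∷ [] ∷ []) n) n)

  unique-map-∈ : ∀ {a b} {X : Set a} {Y : Set b} (f : X → Y) {xs : List X} → Unique xs →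
                 (∀ {x y} → x ∈ xs → y ∈ xs → f x ≡ f y → x ≡ y) → Unique (map f xs)
  unique-map-∈ f []       inj = []
  unique-map-∈ f {x ∷ xs} (x∉ ∷ u) inj =
    AllP.map⁺ (All.tabulate (λ y∈ e → All.lookup x∉ y∈ (inj (here refl) (there y∈) e)))
    ∷ unique-map-∈ f u (λ p q → inj (there p) (there q))

-- Switching two edges of a regular graph

module Switching where
  open RegularGraphs public

  adjacent? : ∀ {n} (A : Adj n) x y → Dec (Adjacent A x y)
  adjacent? A x y = adj? A x y ≟ᵇ true

  member? : ∀ {n} (x : Fin n) (l : List (Fin n)) → Dec (x ∈ l)
  member? x l = Any.any? (x ≟_) l

  unique? : ∀ {n} (l : List (Fin n)) → Dec (Unique l)
  unique? = AllPairs.allPairs? (λ x y → ¬? (x ≟ y))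

  StartsWith : ∀ {n} → Fin n → List (Fin n) → Set
  StartsWith y []      = ⊥
  StartsWith y (x ∷ _) = y ≡ x

  startsWith? : ∀ {n} (y : Fin n) l → Dec (StartsWith y l)
  startsWith? y []      = no λ ()
  startsWith? y (x ∷ _) = y ≟ x

  -- A path h ∷ t, latest vertex first, whose end h sends a further edge back to a vertex y of the path.
  Lollipop : ∀ {n} → Adj n → Fin n → List (Fin n) → Fin n → Set
  Lollipop A h t y = Linked (Adjacent A) (h ∷ t) × Unique (h ∷ t) × Adjacent A h y × y ∈ t × ¬ StartsWith y t

  lollipop? : ∀ {n} (A : Adj n) h t y → Dec (Lollipop A h t y)
  lollipop? A h t y = linked? (adjacent? A) (h ∷ t) ×-dec unique? (h ∷ t) ×-dec adjacent? A h y
                      ×-dec member? y t ×-dec ¬? (startsWith? y t)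

  Pair : ∀ {n} → Fin n → Fin n → Fin n → Fin n → Set
  Pair p q i j = (i ≡ p × j ≡ q) ⊎ (i ≡ q × j ≡ p)

  pair? : ∀ {n} (p q i j : Fin n) → Dec (Pair p q i j)
  pair? p q i j = ((i ≟ p) ×-dec (j ≟ q)) ⊎-dec ((i ≟ q) ×-dec (j ≟ p))

  ∑-pair : ∀ {n} {p q : Fin n} → p ≢ q → ∀ i → ∑ (allFin n) (λ j → ⟦ pair? p q i j ⟧) ≡ ⟦ i ≟ p ⟧ + ⟦ i ≟ q ⟧
  ∑-pair {n} {p} {q} p≢q i = ∑-cong (allFin n) pointwise ⨾ ∑-+ (allFin n) _ _
      ⨾ cong₂ _+_ (∑-single′ q (λ _ → ⟦ i ≟ p ⟧)) (∑-single′ p (λ _ → ⟦ i ≟ q ⟧))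
    where
    pointwise : ∀ j → ⟦ pair? p q i j ⟧ ≡ ⟦ j ≟ q ⟧ * ⟦ i ≟ p ⟧ + ⟦ j ≟ p ⟧ * ⟦ i ≟ q ⟧
    pointwise j with i ≟ p | i ≟ q | j ≟ q | j ≟ p
    ... | yes refl | yes refl | _        | _        = ⊥-elim (p≢q refl)
    ... | _        | _        | yes refl | yes refl = ⊥-elim (p≢q refl)
    ... | yes _    | no _     | yes _    | no _     = refl
    ... | yes _    | no _     | no _     | yes _    = refl
    ... | yes _    | no _     | no _     | no _     = refl
    ... | no _     | yes _    | yes _    | no _     = refl
    ... | no _     | yes _    | no _     | yes _    = refl
    ... | no _     | yes _    | no _     | no _     = refl
    ... | no _     | no _     | yes _    | no _     = refl
    ... | no _     | no _     | no _     | yes _    = refl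
    ... | no _     | no _     | no _     | no _     = refl

  pair-sym : ∀ {n} {p q i j : Fin n} → Pair p q i j → Pair p q j i
  pair-sym (inj₁ (a , b)) = inj₂ (b , a)
  pair-sym (inj₂ (a , b)) = inj₁ (b , a)

  module _ {n : ℕ} (h y a b : Fin n) where
    -- The edges h-y and a-b are exchanged for h-a and y-b. For a lollipop, h-y is the edge that
    -- closes the cycle.
    Removed Added : Fin n → Fin n → Set
    Removed i j = Pair h y i j ⊎ Pair a b i j
    Added   i j = Pair h a i j ⊎ Pair y b i j

    removed? : ∀ i j → Dec (Removed i j)
    removed? i j = pair? h y i j ⊎-dec pair? a b i j

    added? : ∀ i j → Dec (Added i j)
    added? i j = pair? h a i j ⊎-dec pair? y b i j

    entry : ∀ {i j} → Dec (Removed i j) → Dec (Added i j) → Bool → Bool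
    entry (yes _) _       _ = false
    entry (no _)  (yes _) _ = true
    entry (no _)  (no _)  e = e

    switch : Adj n → Adj n
    switch A = tabulate (λ i → tabulate (λ j → entry (removed? i j) (added? i j) (adj? A i j)))

    adj?-switch : ∀ A i j → adj? (switch A) i j ≡ entry (removed? i j) (added? i j) (adj? A i j)
    adj?-switch A i j = cong (λ row → lookup row j) (lookup∘tabulate _ i) ⨾ lookup∘tabulate _ j

    entry-cong : ∀ {i j i′ j′} (r : Dec (Removed i j)) (s : Dec (Added i j)) (r′ : Dec (Removed i′ j′)) (s′ : Dec (Added i′ j′)) →
                 (Removed i j → Removed i′ j′) → (Removed i′ j′ → Removed i j) → (Added i j → Added i′ j′) → (Added i′ j′ → Added i j) →
                 ∀ e → entry r s e ≡ entry r′ s′ e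
    entry-cong (yes r) s (yes _) s′ f f′ g g′ e = refl
    entry-cong (yes r) s (no ¬r) s′ f f′ g g′ e = ⊥-elim (¬r (f r))
    entry-cong (no ¬r) s (yes r) s′ f f′ g g′ e = ⊥-elim (¬r (f′ r))
    entry-cong (no _) (yes _) (no _) (yes _) f f′ g g′ e = refl
    entry-cong (no _) (yes s) (no _) (no ¬s) f f′ g g′ e = ⊥-elim (¬s (g s))
    entry-cong (no _) (no ¬s) (no _) (yes s) f f′ g g′ e = ⊥-elim (¬s (g′ s))
    entry-cong (no _) (no _) (no _) (no _) f f′ g g′ e = refl

    record Switchable (A : Adj n) : Set where
      field
        h~y : Adjacent A h y
        a~b : Adjacent A a b
        h≁a : ¬ Adjacent A h a
        y≁b : ¬ Adjacent A y b
        h≢a : h ≢ a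
        b≢y : b ≢ y

    module _ {d : ℕ} {A : Adj n} (reg : Regular d A) (sw : Switchable A) where
      open Regular reg
      open Switchable sw

      private
        h≢y : h ≢ y
        h≢y refl = ¬loop h~y
        a≢b : a ≢ b
        a≢b refl = ¬loop a~b
        h≢b : h ≢ b
        h≢b refl = h≁a (adj-sym a~b)

        pair-adj : ∀ {p q i j} → Adjacent A p q → Pair p q i j → Adjacent A i j
        pair-adj pq (inj₁ (refl , refl)) = pq
        pair-adj pq (inj₂ (refl , refl)) = adj-sym pq

        pair-¬adj : ∀ {p q i j} → ¬ Adjacent A p q → Pair p q i j → ¬ Adjacent A i j
        pair-¬adj pq (inj₁ (refl , refl)) = pq
        pair-¬adj pq (inj₂ (refl , refl)) = λ e → pq (adj-sym e)

        removed-adj : ∀ {i j} → Removed i j → Adjacent A i j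
        removed-adj (inj₁ p) = pair-adj h~y p
        removed-adj (inj₂ p) = pair-adj a~b p

        added-¬adj : ∀ {i j} → Added i j → ¬ Adjacent A i j
        added-¬adj (inj₁ p) = pair-¬adj h≁a p
        added-¬adj (inj₂ p) = pair-¬adj y≁b p

        removed-sym : ∀ {i j} → Removed i j → Removed j i
        removed-sym (inj₁ p) = inj₁ (pair-sym p)
        removed-sym (inj₂ p) = inj₂ (pair-sym p)

        added-sym : ∀ {i j} → Added i j → Added j i
        added-sym (inj₁ p) = inj₁ (pair-sym p)
        added-sym (inj₂ p) = inj₂ (pair-sym p)

        ⟦⊎⟧ : ∀ {P Q : Set} (d : Dec P) (e : Dec Q) → ¬ (P × Q) → ⟦ d ⊎-dec e ⟧ ≡ ⟦ d ⟧ + ⟦ e ⟧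
        ⟦⊎⟧ (yes p) (yes q) h = ⊥-elim (h (p , q))
        ⟦⊎⟧ (yes p) (no _)  h = refl
        ⟦⊎⟧ (no _)  (yes _) h = refl
        ⟦⊎⟧ (no _)  (no _)  h = refl

        removed-excl : ∀ {i j} → ¬ (Pair h y i j × Pair a b i j)
        removed-excl (inj₁ (refl , _) , inj₁ (e , _)) = h≢a e
        removed-excl (inj₁ (refl , _) , inj₂ (e , _)) = h≢b e
        removed-excl (inj₂ (_ , refl) , inj₁ (_ , e)) = h≢b e
        removed-excl (inj₂ (_ , refl) , inj₂ (_ , e)) = h≢a e

        added-excl : ∀ {i j} → ¬ (Pair h a i j × Pair y b i j)
        added-excl (inj₁ (refl , _) , inj₁ (e , _)) = h≢y e
        added-excl (inj₁ (refl , _) , inj₂ (e , _)) = h≢b e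
        added-excl (inj₂ (_ , refl) , inj₁ (_ , e)) = h≢b e
        added-excl (inj₂ (_ , refl) , inj₂ (_ , e)) = h≢y e

        balance : ∀ {i j} (r : Dec (Removed i j)) (s : Dec (Added i j)) →
                  𝟙 (entry r s (adj? A i j)) + ⟦ r ⟧ ≡ 𝟙 (adj? A i j) + ⟦ s ⟧
        balance (yes r) (yes s) = ⊥-elim (added-¬adj s (removed-adj r))
        balance (yes r) (no _)  = sym (cong (λ e → 𝟙 e + 0) (removed-adj r))
        balance {i} {j} (no _)  (yes s) = sym (cong (λ e → 𝟙 e + 1) (¬-not (added-¬adj {i} {j} s)))
        balance (no _)  (no _)  = refl

      switch-regular : Regular d (switch A)
      switch-regular = record
        { symm = λ i j → adj?-switch A i j ⨾ entry-cong (removed? i j) (added? i j) (removed? j i) (added? j i)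
                         removed-sym removed-sym added-sym added-sym (adj? A i j)
                         ⨾ cong (entry (removed? j i) (added? j i)) (symm i j) ⨾ sym (adj?-switch A j i)
        ; irr  = λ i → adj?-switch A i i ⨾ diag i (removed? i i) (added? i i)
        ; deg  = λ i → +-cancelʳ-≡ (⟦ i ≟ h ⟧ + ⟦ i ≟ y ⟧ + (⟦ i ≟ a ⟧ + ⟦ i ≟ b ⟧)) _ d (rowsum i)
        }
        where
        V = allFin n
        no-diag : ∀ {p q i : Fin n} → p ≢ q → ¬ Pair p q i i
        no-diag p≢q (inj₁ (refl , e)) = p≢q e
        no-diag p≢q (inj₂ (refl , e)) = p≢q (sym e)
        diag : ∀ i (r : Dec (Removed i i)) (s : Dec (Added i i)) → entry r s (adj? A i i) ≡ false
        diag i (yes _) _ = refl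
        diag i (no _) (yes (inj₁ p)) = ⊥-elim (no-diag h≢a p)
        diag i (no _) (yes (inj₂ p)) = ⊥-elim (no-diag (λ e → b≢y (sym e)) p)
        diag i (no _) (no _) = irr i
        two : ∀ {P Q : Fin n → Set} (P? : ∀ j → Dec (P j)) (Q? : ∀ j → Dec (Q j)) → (∀ j → ¬ (P j × Q j)) →
              ∑ V (λ j → ⟦ P? j ⊎-dec Q? j ⟧) ≡ ∑ V (λ j → ⟦ P? j ⟧) + ∑ V (λ j → ⟦ Q? j ⟧)
        two P? Q? ex = ∑-cong V (λ j → ⟦⊎⟧ (P? j) (Q? j) (ex j)) ⨾ ∑-+ V _ _
        rearrange : ∀ d h y a b → d + ((h + a) + (y + b)) ≡ d + (h + y + (a + b))
        rearrange = solve-∀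
        -- The removed and the added pairs meet `i` equally often, once for each of `h`, `y`, `a`,
        -- `b` that equals `i`, so the two corrections cancel.
        rowsum : ∀ i → degree (adj? (switch A)) i + (⟦ i ≟ h ⟧ + ⟦ i ≟ y ⟧ + (⟦ i ≟ a ⟧ + ⟦ i ≟ b ⟧))
                       ≡ d + (⟦ i ≟ h ⟧ + ⟦ i ≟ y ⟧ + (⟦ i ≟ a ⟧ + ⟦ i ≟ b ⟧))
        rowsum i = cong₂ _+_ (∑-cong V (λ j → cong 𝟙 (adj?-switch A i j)))
                     (sym (cong₂ _+_ (∑-pair h≢y i) (∑-pair a≢b i)) ⨾ sym (two (pair? h y i) (pair? a b i) (λ j → removed-excl)))
          ⨾ sym (∑-+ V _ _) ⨾ ∑-cong V (λ j → balance (removed? i j) (added? i j)) ⨾ ∑-+ V _ _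
          ⨾ cong₂ _+_ (deg i) (two (pair? h a i) (pair? y b i) (λ j → added-excl) ⨾ cong₂ _+_ (∑-pair h≢a i) (∑-pair (λ e → b≢y (sym e)) i))
          ⨾ rearrange d ⟦ i ≟ h ⟧ ⟦ i ≟ y ⟧ ⟦ i ≟ a ⟧ ⟦ i ≟ b ⟧

      switch-keeps : ∀ {i j} → Adjacent A i j → ¬ Removed i j → Adjacent (switch A) i j
      switch-keeps {i} {j} e ¬r = adj?-switch A i j ⨾ of (removed? i j) (added? i j)
        where
        of : (r : Dec (Removed i j)) (s : Dec (Added i j)) → entry r s (adj? A i j) ≡ true
        of (yes r) _      = ⊥-elim (¬r r)
        of (no _) (yes _) = refl
        of (no _) (no _)  = e

      switch-adds : ∀ {i j} → Added i j → Adjacent (switch A) i j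
      switch-adds {i} {j} ad = adj?-switch A i j ⨾ of (removed? i j) (added? i j)
        where
        of : (r : Dec (Removed i j)) (s : Dec (Added i j)) → entry r s (adj? A i j) ≡ true
        of (yes r) _      = ⊥-elim (added-¬adj ad (removed-adj r))
        of (no _) (yes _) = refl
        of (no _) (no ¬a) = ⊥-elim (¬a ad)

      entry-recovers : ∀ i j (r : Dec (Removed i j)) (s : Dec (Added i j)) e → entry r s (adj? A i j) ≡ e →
                       adj? A i j ≡ (if does r then true else if does s then false else e)
      entry-recovers i j (yes r) s e _ = removed-adj r
      entry-recovers i j (no _) (yes s) e _ = ¬-not (added-¬adj s)
      entry-recovers i j (no _) (no _) e eq = eq

    -- With the four vertices fixed, the overwritten entries are known in advance: removed pairs
    -- were edges and added pairs were not. All other entries can be read off from the result.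
    switch-injective : ∀ {d} {A A′ : Adj n} → Regular d A → Regular d A′ → Switchable A → Switchable A′ →
                       switch A ≡ switch A′ → A ≡ A′
    switch-injective {A = A} {A′} r r′ s s′ eq = adj-ext (λ i j →
        entry-recovers r s i j (removed? i j) (added? i j) (adj? (switch A) i j) (sym (adj?-switch A i j))
        ⨾ sym (entry-recovers r′ s′ i j (removed? i j) (added? i j) (adj? (switch A) i j)
                 (sym (adj?-switch A′ i j) ⨾ cong (λ B → adj? B i j) (sym eq))))
      where
      vec-ext : ∀ {a} {X : Set a} {m} (v w : Vec X m) → (∀ i → lookup v i ≡ lookup w i) → v ≡ w
      vec-ext v w e = sym (tabulate∘lookup v) ⨾ tabulate-cong e ⨾ tabulate∘lookup w
      adj-ext : (∀ i j → adj? A i j ≡ adj? A′ i j) → A ≡ A′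
      adj-ext e = vec-ext A A′ (λ i → vec-ext (lookup A i) (lookup A′ i) (e i))

-- Short cycles are rare in random regular graphs

module Counting where
  open Switching public

  -- Keeping `a` off the path preserves the edges of the path, and the conditions on adjacency and
  -- on `b` keep the switched graph simple.
  Fresh : ∀ {n} → Adj n → Fin n → List (Fin n) → Fin n → Fin n → Fin n → Set
  Fresh A h t y a b = Adjacent A a b × a ∉ h ∷ t × ¬ Adjacent A h a × ¬ Adjacent A y b × b ≢ y

  fresh? : ∀ {n} (A : Adj n) h t y a b → Dec (Fresh A h t y a b)
  fresh? A h t y a b = adjacent? A a b ×-dec ¬? (member? a (h ∷ t)) ×-dec ¬? (adjacent? A h a)
                       ×-dec ¬? (adjacent? A y b) ×-dec ¬? (b ≟ y)

  -- The trace left by a lollipop: a walk with one extra edge at each of `h` and `y`. Unlike a cycle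
  -- it costs no coincidence to be counted, and each `h` admits at most d^k k d² of them when `t`
  -- has length `k`.
  Switched : ∀ {n} → Adj n → Fin n → List (Fin n) → Fin n → Fin n → Fin n → Set
  Switched A h t y a b = Linked (Adjacent A) (h ∷ t) × y ∈ t × Adjacent A h a × Adjacent A y b

  switched? : ∀ {n} (A : Adj n) h t y a b → Dec (Switched A h t y a b)
  switched? A h t y a b = linked? (adjacent? A) (h ∷ t) ×-dec member? y t ×-dec adjacent? A h a ×-dec adjacent? A y b

  ⟦×⟧ : ∀ {p q} {P : Set p} {Q : Set q} (d : Dec P) (e : Dec Q) → ⟦ d ×-dec e ⟧ ≡ ⟦ d ⟧ * ⟦ e ⟧
  ⟦×⟧ (yes _) (yes _) = refl
  ⟦×⟧ (yes _) (no _)  = refl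
  ⟦×⟧ (no _)  _       = refl

  ⟦adjacent⟧ : ∀ {n} (A : Adj n) x y → ⟦ adjacent? A x y ⟧ ≡ 𝟙 (adj? A x y)
  ⟦adjacent⟧ A x y with adj? A x y
  ... | true  = refl
  ... | false = refl

  module _ {n d : ℕ} {A : Adj n} (reg : Regular d A) where
    open Regular reg
    private
      V = allFin n
      E : Fin n → Fin n → ℕ
      E x y = 𝟙 (adj? A x y)

    column : ∀ y → ∑ V (λ x → E x y) ≡ d
    column y = ∑-cong V (λ x → cong 𝟙 (symm x y)) ⨾ deg y

    -- Of the d n arcs, at most (|t| + 1) d start on the path, d² start at a neighbour of `h`, d²
    -- end at a neighbour of `y`, and d end at `y`.
    fresh-cover : ∀ h t y → d * n ≤ ∑ V (λ a → ∑ V (λ b → ⟦ fresh? A h t y a b ⟧)) + (suc (length t) * d + (d * d + (d * d + d)))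
    fresh-cover h t y = begin
      d * n                                        ≡⟨ *-comm d n ⨾ cong (_* d) (sym (length-allFin n)) ⨾ sym (∑-const V d)
                          ⨾ sym (∑-cong V deg) ⟩
      ∑ V (λ a → ∑ V (λ b → E a b))  ≤⟨ ∑-mono V (λ a → ∑-mono V (λ b → split a b)) ⟩
      ∑ V (λ a → ∑ V (λ b → F a b + (M a * E a b + (E h a * E a b + (E y b * E a b + ⟦ b ≟ y ⟧ * E a b)))))
                          ≡⟨ expand ⟩
      ∑∑ F + (∑∑ (λ a b → M a * E a b) + (∑∑ (λ a b → E h a * E a b) + (∑∑ (λ a b → E y b * E a b) + ∑∑ (λ a b → ⟦ b ≟ y ⟧ * E a b))))
        ≤⟨ +-monoʳ-≤ (∑∑ F) (+-mono-≤ b₁ (+-mono-≤ b₂ (+-mono-≤ b₃ b₄))) ⟩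
      ∑∑ F + (suc (length t) * d + (d * d + (d * d + d))) ∎
      where
      open ≤-Reasoning
      F : Fin n → Fin n → ℕ
      F a b = ⟦ fresh? A h t y a b ⟧
      M : Fin n → ℕ
      M a = ⟦ member? a (h ∷ t) ⟧
      ∑∑ : (Fin n → Fin n → ℕ) → ℕ
      ∑∑ f = ∑ V (λ a → ∑ V (λ b → f a b))
      ∑∑-+ : ∀ f g → ∑∑ (λ a b → f a b + g a b) ≡ ∑∑ f + ∑∑ g
      ∑∑-+ f g = ∑-cong V (λ a → ∑-+ V (f a) (g a)) ⨾ ∑-+ V _ _
      expand : ∑∑ (λ a b → F a b + (M a * E a b + (E h a * E a b + (E y b * E a b + ⟦ b ≟ y ⟧ * E a b)))) ≡
               ∑∑ F + (∑∑ (λ a b → M a * E a b) + (∑∑ (λ a b → E h a * E a b) + (∑∑ (λ a b → E y b * E a b) + ∑∑ (λ a b → ⟦ b ≟ y ⟧ * E a b))))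
      expand = ∑∑-+ F _ ⨾ cong (∑∑ F +_) (∑∑-+ (λ a b → M a * E a b) _ ⨾ cong (∑∑ (λ a b → M a * E a b) +_)
               (∑∑-+ (λ a b → E h a * E a b) _ ⨾ cong (∑∑ (λ a b → E h a * E a b) +_) (∑∑-+ (λ a b → E y b * E a b) _)))
      split : ∀ a b → E a b ≤ F a b + (M a * E a b + (E h a * E a b + (E y b * E a b + ⟦ b ≟ y ⟧ * E a b)))
      split a b = subst₂′ (of (adjacent? A a b) (member? a (h ∷ t)) (adjacent? A h a) (adjacent? A y b) (b ≟ y))
        where
        of : ∀ {P Q R S T : Set} (p : Dec P) (q : Dec Q) (r : Dec R) (s : Dec S) (t : Dec T) →
             ⟦ p ⟧ ≤ ⟦ p ×-dec ¬? q ×-dec ¬? r ×-dec ¬? s ×-dec ¬? t ⟧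
                     + (⟦ q ⟧ * ⟦ p ⟧ + (⟦ r ⟧ * ⟦ p ⟧ + (⟦ s ⟧ * ⟦ p ⟧ + ⟦ t ⟧ * ⟦ p ⟧)))
        of (no _)  _       _       _       _       = z≤n
        of (yes _) (yes _) _       _       _       = s≤s z≤n
        of (yes _) (no _)  (yes _) _       _       = s≤s z≤n
        of (yes _) (no _)  (no _)  (yes _) _       = s≤s z≤n
        of (yes _) (no _)  (no _)  (no _)  (yes _) = s≤s z≤n
        of (yes _) (no _)  (no _)  (no _)  (no _)  = s≤s z≤n
        subst₂′ : ⟦ adjacent? A a b ⟧ ≤ F a b + (M a * ⟦ adjacent? A a b ⟧ + (⟦ adjacent? A h a ⟧ * ⟦ adjacent? A a b ⟧
                  + (⟦ adjacent? A y b ⟧ * ⟦ adjacent? A a b ⟧ + ⟦ b ≟ y ⟧ * ⟦ adjacent? A a b ⟧))) →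
                  E a b ≤ F a b + (M a * E a b + (E h a * E a b + (E y b * E a b + ⟦ b ≟ y ⟧ * E a b)))
        subst₂′ rewrite ⟦adjacent⟧ A a b | ⟦adjacent⟧ A h a | ⟦adjacent⟧ A y b = id
      row-weighted : ∀ (w : Fin n → ℕ) → ∑∑ (λ a b → w a * E a b) ≡ ∑ V w * d
      row-weighted w = ∑-cong V (λ a → ∑-*ˡ V (w a) (E a) ⨾ cong (w a *_) (deg a)) ⨾ ∑-*ʳ V d w
      column-weighted : ∀ (w : Fin n → ℕ) → ∑∑ (λ a b → w b * E a b) ≡ ∑ V w * d
      column-weighted w = ∑-swap V V _ ⨾ ∑-cong V (λ b → ∑-*ˡ V (w b) (λ a → E a b) ⨾ cong (w b *_) (column b)) ⨾ ∑-*ʳ V d w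
      b₁ : ∑∑ (λ a b → M a * E a b) ≤ suc (length t) * d
      b₁ = ≤-trans (≤-reflexive (row-weighted M)) (*-monoˡ-≤ d (∑-member (h ∷ t)))
      b₂ : ∑∑ (λ a b → E h a * E a b) ≤ d * d
      b₂ = ≤-reflexive (row-weighted (E h) ⨾ cong (_* d) (deg h))
      b₃ : ∑∑ (λ a b → E y b * E a b) ≤ d * d
      b₃ = ≤-reflexive (column-weighted (E y) ⨾ cong (_* d) (deg y))
      b₄ : ∑∑ (λ a b → ⟦ b ≟ y ⟧ * E a b) ≤ d
      b₄ = ≤-reflexive (column-weighted (λ b → ⟦ b ≟ y ⟧) ⨾ cong (_* d) (∑-single y) ⨾ *-identityˡ d)

    count-paths : ∀ k h → ∑ (tuples n k) (λ t → ⟦ linked? (adjacent? A) (h ∷ t) ⟧) ≤ d ^ k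
    count-paths zero    h = ≤-refl
    count-paths (suc k) h = begin
      ∑ (tuples n (suc k)) (λ t → ⟦ linked? (adjacent? A) (h ∷ t) ⟧)  ≡⟨ ∑-tuples-suc n k _ ⟩
      ∑ V (λ x → ∑ (tuples n k) (λ t → ⟦ linked? (adjacent? A) (h ∷ x ∷ t) ⟧))  ≤⟨ ∑-mono V (λ x → ∑-mono (tuples n k) (λ t → step x t)) ⟩
      ∑ V (λ x → ∑ (tuples n k) (λ t → E h x * ⟦ linked? (adjacent? A) (x ∷ t) ⟧))  ≡⟨ ∑-cong V (λ x → ∑-*ˡ (tuples n k) (E h x) _) ⟩
      ∑ V (λ x → E h x * ∑ (tuples n k) (λ t → ⟦ linked? (adjacent? A) (x ∷ t) ⟧))  ≤⟨ ∑-mono V (λ x → *-monoʳ-≤ (E h x) (count-paths k x)) ⟩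
      ∑ V (λ x → E h x * d ^ k)  ≡⟨ ∑-*ʳ V (d ^ k) (E h) ⨾ cong (_* d ^ k) (deg h) ⟩
      d * d ^ k  ∎
      where
      open ≤-Reasoning
      step : ∀ x t → ⟦ linked? (adjacent? A) (h ∷ x ∷ t) ⟧ ≤ E h x * ⟦ linked? (adjacent? A) (x ∷ t) ⟧
      step x t rewrite sym (⟦adjacent⟧ A h x) | sym (⟦×⟧ (adjacent? A h x) (linked? (adjacent? A) (x ∷ t))) =
        ⟦⟧-mono (linked? (adjacent? A) (h ∷ x ∷ t)) (adjacent? A h x ×-dec linked? (adjacent? A) (x ∷ t)) (λ { (e ∷ l) → e , l })

    count-switched : ∀ k → ∑ V (λ h → ∑ (tuples n k) (λ t → ∑ V (λ y → ∑ V (λ a → ∑ V (λ b → ⟦ switched? A h t y a b ⟧)))))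
                     ≤ n * (d ^ k * (k * (d * d)))
    count-switched k = begin
      ∑ V (λ h → ∑ (tuples n k) (λ t → ∑ V (λ y → ∑ V (λ a → ∑ V (λ b → ⟦ switched? A h t y a b ⟧)))))
        ≤⟨ ∑-mono V (λ h → ∑-mono-∈ (tuples n k) (λ t t∈ → inner h t (length-tuples k t∈))) ⟩
      ∑ V (λ h → ∑ (tuples n k) (λ t → ⟦ linked? (adjacent? A) (h ∷ t) ⟧ * (k * (d * d))))
        ≡⟨ ∑-cong V (λ h → ∑-*ʳ (tuples n k) _ _) ⟩
      ∑ V (λ h → ∑ (tuples n k) (λ t → ⟦ linked? (adjacent? A) (h ∷ t) ⟧) * (k * (d * d)))
        ≤⟨ ∑-bound V (λ h _ → *-monoˡ-≤ (k * (d * d)) (count-paths k h)) ⟩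
      length V * (d ^ k * (k * (d * d))) ≡⟨ cong (_* (d ^ k * (k * (d * d)))) (length-allFin n) ⟩
      n * (d ^ k * (k * (d * d))) ∎
      where
      open ≤-Reasoning
      inner : ∀ h t → length t ≡ k → ∑ V (λ y → ∑ V (λ a → ∑ V (λ b → ⟦ switched? A h t y a b ⟧)))
              ≤ ⟦ linked? (adjacent? A) (h ∷ t) ⟧ * (k * (d * d))
      inner h t refl = begin
        ∑ V (λ y → ∑ V (λ a → ∑ V (λ b → ⟦ switched? A h t y a b ⟧)))  ≡⟨ ∑-cong V (λ y → ∑-cong V (λ a → ∑-cong V (λ b → prod y a b))) ⟩
        ∑ V (λ y → ∑ V (λ a → ∑ V (λ b → L * M y * E h a * E y b)))  ≡⟨ ∑-cong V (λ y → ∑-cong V (λ a → ∑-*ˡ V (L * M y * E h a) (E y) ⨾ cong (L * M y * E h a *_) (deg y))) ⟩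
        ∑ V (λ y → ∑ V (λ a → L * M y * E h a * d))  ≡⟨ ∑-cong V (λ y → ∑-*ʳ V d _ ⨾ cong (_* d) (∑-*ˡ V (L * M y) (E h) ⨾ cong (L * M y *_) (deg h))) ⟩
        ∑ V (λ y → L * M y * d * d)  ≡⟨ ∑-cong V (λ y → *-assoc (L * M y) d d) ⨾ ∑-*ʳ V (d * d) _ ⨾ cong (_* (d * d)) (∑-*ˡ V L M) ⟩
        L * ∑ V M * (d * d)  ≤⟨ *-monoˡ-≤ (d * d) (*-monoʳ-≤ L (∑-member t)) ⟩
        L * k * (d * d)  ≡⟨ *-assoc L k (d * d) ⟩
        L * (k * (d * d))  ∎
        where
        L = ⟦ linked? (adjacent? A) (h ∷ t) ⟧
        M : Fin n → ℕ
        M y = ⟦ member? y t ⟧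
        prod : ∀ y a b → ⟦ switched? A h t y a b ⟧ ≡ L * M y * E h a * E y b
        prod y a b rewrite ⟦×⟧ (linked? (adjacent? A) (h ∷ t)) (member? y t ×-dec adjacent? A h a ×-dec adjacent? A y b)
          | ⟦×⟧ (member? y t) (adjacent? A h a ×-dec adjacent? A y b) | ⟦×⟧ (adjacent? A h a) (adjacent? A y b)
          | ⟦adjacent⟧ A h a | ⟦adjacent⟧ A y b = reassoc L (M y) (E h a) (E y b)
          where
          reassoc : ∀ a b c d → a * (b * (c * d)) ≡ a * b * c * d
          reassoc = solve-∀

  lollipops : ∀ {n} → ℕ → Adj n → ℕ
  lollipops {n} k A = ∑ (allFin n) (λ h → ∑ (tuples n k) (λ t → ∑ (allFin n) (λ y → ⟦ lollipop? A h t y ⟧)))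

  linked-∈ : ∀ {a r s} {X : Set a} {R : X → X → Set r} {S : X → X → Set s} {xs : List X} →
             (∀ {x y} → x ∈ xs → y ∈ xs → R x y → S x y) → Linked R xs → Linked S xs
  linked-∈ f []      = []
  linked-∈ f [-]     = [-]
  linked-∈ f (r ∷ l) = f (here refl) (there (here refl)) r ∷ linked-∈ (λ p q → f (there p) (there q)) l

  module _ {n : ℕ} {h : Fin n} {t : List (Fin n)} {y a b : Fin n} where

    switchable : ∀ {A : Adj n} → Lollipop A h t y → Fresh A h t y a b → Switchable h y a b A
    switchable (_ , _ , h~y , y∈ , _) (a~b , a∉ , h≁a , y≁b , b≢y) = record
      { h~y = h~y ; a~b = a~b ; h≁a = h≁a ; y≁b = y≁b
      ; h≢a = λ { refl → a∉ (here refl) } ; b≢y = b≢y }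

    -- The path loses no edge: its only edge at `h` is not h-y because `t` does not start with `y`,
    -- and a-b misses the path because `a` does.
    switch-switched : ∀ {d} {A : Adj n} → Regular d A → Lollipop A h t y → Fresh A h t y a b → Switched (switch h y a b A) h t y a b
    switch-switched {d} {A} reg lp@(link , (h∉ ∷ _) , h~y , y∈ , ¬st) fr@(a~b , a∉ , _) =
      path t link ¬st (λ w∈ → All.lookup h∉ w∈) (λ w∈ e → a∉ (there (subst (_∈ t) (sym e) w∈))) , y∈
      , switch-adds h y a b reg sw (inj₁ (inj₁ (refl , refl))) , switch-adds h y a b reg sw (inj₂ (inj₁ (refl , refl)))
      where
      sw = switchable lp fr
      open Switchable sw using (h≢a; h≁a)
      h≢b : h ≢ b
      h≢b refl = h≁a (Regular.symm reg h a ⨾ a~b)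
      not-removed : ∀ {u v} → h ≢ u → h ≢ v → a ≢ u → a ≢ v → ¬ Removed h y a b u v
      not-removed hu hv au av (inj₁ (inj₁ (e , _))) = hu (sym e)
      not-removed hu hv au av (inj₁ (inj₂ (_ , e))) = hv (sym e)
      not-removed hu hv au av (inj₂ (inj₁ (e , _))) = au (sym e)
      not-removed hu hv au av (inj₂ (inj₂ (_ , e))) = av (sym e)
      path : ∀ s → Linked (Adjacent A) (h ∷ s) → ¬ StartsWith y s → (∀ {w} → w ∈ s → h ≢ w) → (∀ {w} → w ∈ s → a ≢ w) →
             Linked (Adjacent (switch h y a b A)) (h ∷ s)
      path []       _            _   _  _  = [-]
      path (x ∷ s) (h~x ∷ l) ¬st h≢ a≢ = switch-keeps h y a b reg sw h~x first
          ∷ linked-∈ (λ p q e → switch-keeps h y a b reg sw e (not-removed (h≢ p) (h≢ q) (a≢ p) (a≢ q))) l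
        where
        first : ¬ Removed h y a b h x
        first (inj₁ (inj₁ (_ , e))) = ¬st (sym e)
        first (inj₁ (inj₂ (e , e′))) = h≢ (here refl) (sym e′)
        first (inj₂ (inj₁ (e , _))) = h≢a e
        first (inj₂ (inj₂ (e , _))) = h≢b e

  module _ (n d : ℕ) where
    private
      V  = allFin n
      RL = regularGraphs d n
      regular-∈ : ∀ {A} → A ∈ RL → Regular d A
      regular-∈ {A} A∈ = toRegular {n} {d} {A} (∈-regularGraphs⁻ {d} {n} A∈)

    switch-count : ∀ h t y a b → ∑ RL (λ A → ⟦ lollipop? A h t y ×-dec fresh? A h t y a b ⟧) ≤ ∑ RL (λ A → ⟦ switched? A h t y a b ⟧)
    switch-count h t y a b = begin
      ∑ RL (λ A → ⟦ P? A ⟧)  ≡⟨ ∑-filter RL P? ⟩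
      ∑ QL (λ A → ⟦ P? A ⟧)  ≤⟨ ∑-mono-∈ QL moved ⟩
      ∑ QL (λ A → ⟦ switched? (switch h y a b A) h t y a b ⟧) ≡⟨ sym (∑-map (switch h y a b) QL _) ⟩
      ∑ (map (switch h y a b) QL) (λ A → ⟦ switched? A h t y a b ⟧)
        ≤⟨ ∑-⊆ (map (switch h y a b) QL) RL _ (unique-map-∈ (switch h y a b) (filter-unique P? (unique-regularGraphs d n)) injective) image ⟩
      ∑ RL (λ A → ⟦ switched? A h t y a b ⟧)  ∎
      where
      open ≤-Reasoning
      P? : ∀ A → Dec (Lollipop A h t y × Fresh A h t y a b)
      P? A = lollipop? A h t y ×-dec fresh? A h t y a b
      QL = filter P? RL
      props : ∀ {A} → A ∈ QL → Regular d A × Lollipop A h t y × Fresh A h t y a b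
      props A∈ = let A∈RL , p = ∈-filter⁻ P? {xs = RL} A∈ in regular-∈ A∈RL , p
      moved : ∀ A → A ∈ QL → ⟦ P? A ⟧ ≤ ⟦ switched? (switch h y a b A) h t y a b ⟧
      moved A A∈ = let r , l , f = props A∈ in
        ⟦⟧-mono (P? A) (switched? (switch h y a b A) h t y a b) (λ _ → switch-switched r l f)
      injective : ∀ {A A′} → A ∈ QL → A′ ∈ QL → switch h y a b A ≡ switch h y a b A′ → A ≡ A′
      injective A∈ A′∈ = let r , l , f = props A∈ ; r′ , l′ , f′ = props A′∈ in
        switch-injective h y a b r r′ (switchable l f) (switchable l′ f′)
      image : ∀ B → B ∈ map (switch h y a b) QL → B ∈ RL
      image B B∈ with ∈-map⁻ (switch h y a b) B∈
      ... | A , A∈ , refl = let r , l , f = props A∈ in ∈-regularGraphs⁺ (switch-regular h y a b r (switchable l f))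

    -- The number of arcs that may fail to be fresh for a lollipop with |t| = k.
    slack : ℕ → ℕ
    slack k = suc k * d + (d * d + (d * d + d))

    -- Double counting of triples consisting of a graph, a lollipop and a fresh arc: for each
    -- lollipop nearly d n arcs, but after the switching only boundedly many triples for each graph
    -- and each `h`.
    lollipops-times-arcs : ∀ k → ∑ RL (lollipops k) * (d * n) ≤ length RL * (n * (d ^ k * (k * (d * d)))) + ∑ RL (lollipops k) * slack k
    lollipops-times-arcs k = begin
      ∑ RL (lollipops k) * (d * n)  ≡⟨ push (d * n) ⟩
      ∑H (λ h t y A → ⟦ lollipop? A h t y ⟧ * (d * n))            ≤⟨ ∑-mono-∈ RL (λ A A∈ → ∑-mono V (λ h → ∑-mono-∈ Tk (λ t t∈ → ∑-mono V (λ y →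
                          each A A∈ h t t∈ y)))) ⟩
      ∑H (λ h t y A → ∑ V (λ a → ∑ V (λ b → W h t y a b A)) + ⟦ lollipop? A h t y ⟧ * slack k)
          ≡⟨ ∑-cong RL (λ A → ∑-cong V (λ h → ∑-cong Tk (λ t → ∑-+ V _ _) ⨾ ∑-+ Tk _ _) ⨾ ∑-+ V _ _) ⨾ ∑-+ RL _ _ ⟩
      ∑H (λ h t y A → ∑ V (λ a → ∑ V (λ b → W h t y a b A))) + ∑H (λ h t y A → ⟦ lollipop? A h t y ⟧ * slack k)
          ≡⟨ cong₂ _+_ (reorder W) (sym (push (slack k))) ⟩
      ∑ V (λ h → ∑ Tk (λ t → ∑ V (λ y → ∑ V (λ a → ∑ V (λ b → ∑ RL (λ A → W h t y a b A)))))) + ∑ RL (lollipops k) * slack k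
          ≤⟨ +-monoˡ-≤ _ (∑-mono V (λ h → ∑-mono Tk (λ t → ∑-mono V (λ y → ∑-mono V (λ a → ∑-mono V (λ b → switch-count h t y a b)))))) ⟩
      ∑ V (λ h → ∑ Tk (λ t → ∑ V (λ y → ∑ V (λ a → ∑ V (λ b → ∑ RL (λ A → ⟦ switched? A h t y a b ⟧)))))) + ∑ RL (lollipops k) * slack k
          ≡⟨ cong (_+ ∑ RL (lollipops k) * slack k) (sym (reorder (λ h t y a b A → ⟦ switched? A h t y a b ⟧))) ⟩
      ∑ RL (λ A → ∑ V (λ h → ∑ Tk (λ t → ∑ V (λ y → ∑ V (λ a → ∑ V (λ b → ⟦ switched? A h t y a b ⟧)))))) + ∑ RL (lollipops k) * slack k
          ≤⟨ +-monoˡ-≤ _ (∑-bound RL (λ A A∈ → count-switched (regular-∈ A∈) k)) ⟩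
      length RL * (n * (d ^ k * (k * (d * d)))) + ∑ RL (lollipops k) * slack k ∎
      where
      open ≤-Reasoning
      Tk = tuples n k
      W : Fin n → List (Fin n) → Fin n → Fin n → Fin n → Adj n → ℕ
      W h t y a b A = ⟦ lollipop? A h t y ×-dec fresh? A h t y a b ⟧
      ∑H : (Fin n → List (Fin n) → Fin n → Adj n → ℕ) → ℕ
      ∑H f = ∑ RL (λ A → ∑ V (λ h → ∑ Tk (λ t → ∑ V (λ y → f h t y A))))
      push : ∀ c → ∑ RL (lollipops k) * c ≡ ∑H (λ h t y A → ⟦ lollipop? A h t y ⟧ * c)
      push c = sym (∑-*ʳ RL c (lollipops k)) ⨾ ∑-cong RL (λ A → sym (∑-*ʳ V c _) ⨾ ∑-cong V (λ h → sym (∑-*ʳ Tk c _)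
               ⨾ ∑-cong Tk (λ t → sym (∑-*ʳ V c _))))
      reorder : ∀ (f : Fin n → List (Fin n) → Fin n → Fin n → Fin n → Adj n → ℕ) →
                ∑ RL (λ A → ∑ V (λ h → ∑ Tk (λ t → ∑ V (λ y → ∑ V (λ a → ∑ V (λ b → f h t y a b A)))))) ≡
                ∑ V (λ h → ∑ Tk (λ t → ∑ V (λ y → ∑ V (λ a → ∑ V (λ b → ∑ RL (λ A → f h t y a b A))))))
      reorder f = ∑-swap RL V _ ⨾ ∑-cong V (λ h → ∑-swap RL Tk _ ⨾ ∑-cong Tk (λ t → ∑-swap RL V _ ⨾ ∑-cong V (λ y →
                  ∑-swap RL V _ ⨾ ∑-cong V (λ a → ∑-swap RL V _))))
      each : ∀ A → A ∈ RL → ∀ h t → t ∈ Tk → ∀ y →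
             ⟦ lollipop? A h t y ⟧ * (d * n) ≤ ∑ V (λ a → ∑ V (λ b → W h t y a b A)) + ⟦ lollipop? A h t y ⟧ * slack k
      each A A∈ h t t∈ y = begin
        ⟦ lp ⟧ * (d * n)  ≤⟨ *-monoʳ-≤ ⟦ lp ⟧ (fresh-cover (regular-∈ A∈) h t y) ⟩
        ⟦ lp ⟧ * (∑ V (λ a → ∑ V (λ b → F a b)) + (suc (length t) * d + (d * d + (d * d + d)))) ≡⟨ cong (λ l → ⟦ lp ⟧ * (∑ V (λ a → ∑ V (λ b → F a b)) + (suc l * d + (d * d + (d * d + d))))) (length-tuples k t∈) ⟩
        ⟦ lp ⟧ * (∑ V (λ a → ∑ V (λ b → F a b)) + slack k)  ≡⟨ *-distribˡ-+ ⟦ lp ⟧ _ (slack k) ⟩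
        ⟦ lp ⟧ * ∑ V (λ a → ∑ V (λ b → F a b)) + ⟦ lp ⟧ * slack k               ≡⟨ cong (_+ ⟦ lp ⟧ * slack k) (sym (∑-*ˡ V ⟦ lp ⟧ _)
             ⨾ ∑-cong V (λ a → sym (∑-*ˡ V ⟦ lp ⟧ _) ⨾ ∑-cong V (λ b → sym (⟦×⟧ lp (fresh? A h t y a b))))) ⟩
        ∑ V (λ a → ∑ V (λ b → W h t y a b A)) + ⟦ lp ⟧ * slack k  ∎
        where
        lp = lollipop? A h t y
        F : Fin n → Fin n → ℕ
        F a b = ⟦ fresh? A h t y a b ⟧

    -- Since d n is at least 2 n and the slack at most n, every lollipop has at least n fresh arcs.
    -- The factor n cancels, which leaves a mean that does not grow with n.
    lollipops-bounded : ∀ k → 2 ≤ d → 0 < n → slack k ≤ n → ∑ RL (lollipops k) ≤ length RL * (d ^ k * (k * (d * d)))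
    lollipops-bounded k 2≤d 0<n C≤n = *-cancelʳ-≤ X _ n {{>-nonZero 0<n}} (+-cancelʳ-≤ (X * slack k) _ _ (begin
      X * n + X * slack k  ≤⟨ +-monoʳ-≤ (X * n) (*-monoʳ-≤ X C≤n) ⟩
      X * n + X * n  ≡⟨ double X n ⟩
      X * (2 * n)  ≤⟨ *-monoʳ-≤ X (*-monoˡ-≤ n 2≤d) ⟩
      X * (d * n)  ≤⟨ lollipops-times-arcs k ⟩
      length RL * (n * D) + X * slack k  ≡⟨ cong (_+ X * slack k) (swap-mul (length RL) n D) ⟩
      length RL * D * n + X * slack k  ∎))
      where
      open ≤-Reasoning
      X = ∑ RL (lollipops k)
      D = d ^ k * (k * (d * d))
      double : ∀ x n → x * n + x * n ≡ x * (2 * n)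
      double = solve-∀
      swap-mul : ∀ l n D → l * (n * D) ≡ l * D * n
      swap-mul = solve-∀

  lollipops≤ : ∀ {n} → ℕ → Adj n → ℕ
  lollipops≤ R A = ∑< R (λ k → lollipops k A)

  totalWeight : ℕ → ℕ → ℕ
  totalWeight d R = ∑< R (λ k → d ^ k * (k * (d * d)))

  -- Markov's inequality.
  few-lollipops : ∀ d R q r → 2 ≤ d → ∃[ N ] (∀ n → N ≤ n → let RL = regularGraphs d n in
    r * length RL ≤ r * length (filter (λ A → q * lollipops≤ R A ≤? n) RL) + length RL)
  few-lollipops d R q r 2≤d = N , λ n N≤n → bound n N≤n
    where
    open ≤-Reasoning
    -- The successor makes `w` cancellable. In `N` the first summand dominates the slack of all
    -- lengths below `R`, which is the same for every number of vertices, and the second makes n at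
    -- least r times the mean of q times the number of lollipops.
    w = suc (q * totalWeight d R)
    N = suc (slack 0 d R + r * w)
    ∑<-∑ : ∀ {n} R (xs : List (Adj n)) → ∑ xs (lollipops≤ R) ≡ ∑< R (λ k → ∑ xs (lollipops k))
    ∑<-∑ zero    xs = ∑-zero xs
    ∑<-∑ (suc R) xs = ∑-+ xs _ _ ⨾ cong (_+ ∑ xs (lollipops R)) (∑<-∑ R xs)
    bound : ∀ n → N ≤ n → let RL = regularGraphs d n in
            r * length RL ≤ r * length (filter (λ A → q * lollipops≤ R A ≤? n) RL) + length RL
    bound n N≤n = begin
      r * length RL  ≡⟨ cong (r *_) (sym (∑-1 RL)) ⟩
      r * ∑ RL (λ _ → 1)  ≤⟨ *-monoʳ-≤ r (∑-mono RL (λ A → either (P? A))) ⟩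
      r * ∑ RL (λ A → ⟦ P? A ⟧ + ⟦ ¬? (P? A) ⟧) ≡⟨ cong (r *_) (∑-+ RL _ _ ⨾ cong (_+ F) count-good) ⟩
      r * (G + F)  ≡⟨ *-distribˡ-+ r G F ⟩
      r * G + r * F  ≤⟨ +-monoʳ-≤ (r * G) (*-cancelʳ-≤ (r * F) (length RL) w {{>-nonZero (s≤s z≤n)}} fail) ⟩
      r * G + length RL  ∎
      where
      RL = regularGraphs d n
      P? : ∀ A → Dec (q * lollipops≤ R A ≤ n)
      P? A = q * lollipops≤ R A ≤? n
      G = length (filter P? RL)
      F = ∑ RL (λ A → ⟦ ¬? (P? A) ⟧)
      either : ∀ {P : Set} (p : Dec P) → 1 ≤ ⟦ p ⟧ + ⟦ ¬? p ⟧
      either (yes _) = s≤s z≤n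
      either (no _)  = s≤s z≤n
      count-good : ∑ RL (λ A → ⟦ P? A ⟧) ≡ G
      count-good = ∑-filter RL P? ⨾ ∑-cong-∈ (filter P? RL) (λ A A∈ → ⟦⟧-yes (P? A) (proj₂ (∈-filter⁻ P? {xs = RL} A∈))) ⨾ ∑-1 (filter P? RL)
      0<n : 0 < n
      0<n = ≤-trans (s≤s z≤n) N≤n
      slack≤ : ∀ k → k < R → slack n d k ≤ n
      slack≤ k k<R = ≤-trans (+-monoˡ-≤ _ (*-monoˡ-≤ d (s≤s (<⇒≤ k<R)))) (≤-trans (m≤m+n _ (r * w)) (≤-trans (n≤1+n _) N≤n))
      markov : ∀ A → ⟦ ¬? (P? A) ⟧ * n ≤ q * lollipops≤ R A
      markov A with P? A
      ... | yes _  = z≤n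
      ... | no ¬p = ≤-trans (≤-reflexive (*-identityˡ n)) (<⇒≤ (≰⇒> ¬p))
      total : ∑ RL (lollipops≤ R) ≤ length RL * totalWeight d R
      total = begin
        ∑ RL (lollipops≤ R)  ≡⟨ ∑<-∑ R RL ⟩
        ∑< R (λ k → ∑ RL (lollipops k))  ≤⟨ ∑<-mono R (λ k k<R → lollipops-bounded n d k 2≤d 0<n (slack≤ k k<R)) ⟩
        ∑< R (λ k → length RL * (d ^ k * (k * (d * d))))  ≡⟨ ∑<-*ˡ R (length RL) _ ⟩
        length RL * totalWeight d R  ∎
      fail : r * F * w ≤ length RL * w
      fail = begin
        r * F * w  ≡⟨ regroup r F w ⟩
        F * (r * w)  ≤⟨ *-monoʳ-≤ F (≤-trans (m≤n+m (r * w) _) (≤-trans (n≤1+n _) N≤n)) ⟩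
        F * n  ≡⟨ sym (∑-*ʳ RL n _) ⟩
        ∑ RL (λ A → ⟦ ¬? (P? A) ⟧ * n)  ≤⟨ ∑-mono RL markov ⟩
        ∑ RL (λ A → q * lollipops≤ R A)  ≡⟨ ∑-*ˡ RL q _ ⟩
        q * ∑ RL (lollipops≤ R)  ≤⟨ *-monoʳ-≤ q total ⟩
        q * (length RL * totalWeight d R)  ≡⟨ regroup′ q (length RL) (totalWeight d R) ⟩
        length RL * (q * totalWeight d R)  ≤⟨ *-monoʳ-≤ (length RL) (n≤1+n _) ⟩
        length RL * w  ∎
        where
        regroup : ∀ r F w → r * F * w ≡ F * (r * w)
        regroup = solve-∀
        regroup′ : ∀ q l t → q * (l * t) ≡ l * (q * t)
        regroup′ = solve-∀

-- Greedy partition into paths in graphs of maximum degree two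

module Partition where
  open Counting public

  private variable
    ℓ : Level
    X : Set ℓ

  unique-++⁻ : (xs {ys} : List X) → Unique (xs ++ ys) → Unique xs × Unique ys × (∀ {x} → x ∈ xs → x ∉ ys)
  unique-++⁻ []       u = [] , u , λ ()
  unique-++⁻ (x ∷ xs) (x∉ ∷ u) with unique-++⁻ xs u
  ... | u₁ , u₂ , disj = All.tabulate (λ z∈ → All.lookup x∉ (∈-++⁺ˡ z∈)) ∷ u₁ , u₂ ,
    λ { (here refl) z∈ → All.lookup x∉ (∈-++⁺ʳ xs z∈) refl ; (there w∈) → disj w∈ }

  unique-↭ : {xs ys : List X} → xs ↭ ys → Unique xs → Unique ys
  unique-↭ refl         u = u
  unique-↭ (prep x r)   (x∉ ∷ u) = All-resp-↭ r x∉ ∷ unique-↭ r u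
  unique-↭ (swap x y r) ((x≢y ∷ x∉) ∷ y∉ ∷ u) =
    ((λ e → x≢y (sym e)) ∷ All-resp-↭ r y∉) ∷ All-resp-↭ r x∉ ∷ unique-↭ r u
  unique-↭ (trans r s)  u = unique-↭ s (unique-↭ r u)

  unique-concat-part : {xss : List (List X)} {xs : List X} → Unique (concat xss) → xs ∈ xss → Unique xs
  unique-concat-part {xss = ys ∷ _} u (here refl) = proj₁ (unique-++⁻ ys u)
  unique-concat-part {xss = ys ∷ _} u (there xs∈) = unique-concat-part (proj₁ (proj₂ (unique-++⁻ ys u))) xs∈

  unique-concat-same : {xss : List (List X)} {xs ys : List X} {x : X} → Unique (concat xss) →
                       xs ∈ xss → ys ∈ xss → x ∈ xs → x ∈ ys → xs ≡ ys
  unique-concat-same u (here refl) (here refl) _ _ = refl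
  unique-concat-same {xss = zs ∷ _} u (here refl) (there q) x∈ y∈ = ⊥-elim (proj₂ (proj₂ (unique-++⁻ zs u)) x∈ (∈-concat⁺′ y∈ q))
  unique-concat-same {xss = zs ∷ _} u (there p) (here refl) x∈ y∈ = ⊥-elim (proj₂ (proj₂ (unique-++⁻ zs u)) y∈ (∈-concat⁺′ x∈ p))
  unique-concat-same {xss = zs ∷ _} u (there p) (there q) x∈ y∈ = unique-concat-same (proj₁ (proj₂ (unique-++⁻ zs u))) p q x∈ y∈

  unique-head-pos : {x : X} {r : List X} → Unique (x ∷ r) → ∀ p {s} → x ∷ r ≡ p ++ x ∷ s → p ≡ []
  unique-head-pos u        []      _    = refl
  unique-head-pos (x∉ ∷ _) (z ∷ p) refl = ⊥-elim (All.lookup x∉ (∈-++⁺ʳ p (here refl)) refl)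

  linked-drop : ∀ {R : X → X → Set ℓ} p {s} → Linked R (p ++ s) → Linked R s
  linked-drop []          l       = l
  linked-drop (x ∷ [])    [-]     = []
  linked-drop (x ∷ [])    (_ ∷ l) = l
  linked-drop (x ∷ y ∷ p) (_ ∷ l) = linked-drop (y ∷ p) l

  linked-take : ∀ {R : X → X → Set ℓ} p {s} → Linked R (p ++ s) → Linked R p
  linked-take []          l       = []
  linked-take (x ∷ [])    l       = [-]
  linked-take (x ∷ y ∷ p) (r ∷ l) = r ∷ linked-take (y ∷ p) l

  linked-ʳ++ : ∀ {R : X → X → Set ℓ} → (∀ {x y} → R x y → R y x) → ∀ {x} m {acc} →
               Linked R (x ∷ m) → Linked R (x ∷ acc) → Linked R (m ʳ++ (x ∷ acc))
  linked-ʳ++ s []      _       la = la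
  linked-ʳ++ s (y ∷ m) (r ∷ l) la = linked-ʳ++ s m l (s r ∷ la)

  concat-↭ : {xss yss : List (List X)} → xss ↭ yss → concat xss ↭ concat yss
  concat-↭ refl           = refl
  concat-↭ (prep xs r)    = ↭-++⁺ˡ xs (concat-↭ r)
  concat-↭ (swap xs ys r) = trans (shifts xs ys) (↭-++⁺ˡ ys (↭-++⁺ˡ xs (concat-↭ r)))
  concat-↭ (trans r s)    = trans (concat-↭ r) (concat-↭ s)

  -- An inner occurrence exposes both neighbours on the path, which use up a degree of at most 2.
  data Position {X : Set ℓ} (y : X) : List X → Set ℓ where
    at-first : ∀ s → Position y (y ∷ s)
    at-final : ∀ p → Position y (p ∷ʳ y)
    at-inner : ∀ p a c s → Position y (p ++ a ∷ y ∷ c ∷ s)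

  position : {y : X} {l : List X} → y ∈ l → Position y l
  position (here refl) = at-first _
  position {l = x ∷ _} (there y∈) with position y∈
  ... | at-first []        = at-final (x ∷ [])
  ... | at-first (c ∷ s)   = at-inner [] x c s
  ... | at-final p         = at-final (x ∷ p)
  ... | at-inner p a c s   = at-inner (x ∷ p) a c s

  module Joining {n : ℕ} (E : Fin n → Fin n → Set) (E? : ∀ x y → Dec (E x y))
                 (E-sym : ∀ {x y} → E x y → E y x) where

    HeadLink : List (Fin n) → List (Fin n) → Set
    HeadLink (x ∷ _) (y ∷ _) = E x y
    HeadLink _       _       = ⊥

    headLink? : ∀ l m → Dec (HeadLink l m)
    headLink? []      _       = no λ ()
    headLink? (_ ∷ _) []      = no λ ()
    headLink? (x ∷ _) (y ∷ _) = E? x y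

    -- Paths have no direction, so any end of one may be glued to any end of the other.
    Joinable : List (Fin n) → List (Fin n) → Set
    Joinable l m = (HeadLink l m ⊎ HeadLink l (reverse m)) ⊎ (HeadLink (reverse l) m ⊎ HeadLink (reverse l) (reverse m))

    joinable? : ∀ l m → Dec (Joinable l m)
    joinable? l m = (headLink? l m ⊎-dec headLink? l (reverse m)) ⊎-dec (headLink? (reverse l) m ⊎-dec headLink? (reverse l) (reverse m))

    record PathPartition : Set where
      field
        paths    : List (List (Fin n))
        linked   : All (Linked E) paths
        nonempty : All (λ l → l ≢ []) paths
        covers   : concat paths ↭ allFin n

    open PathPartition

    Stuck : List (List (Fin n)) → Set
    Stuck = AllPairs (λ l m → ¬ Joinable l m)

    private
      find-pair : ∀ ls → Stuck ls ⊎ ∃[ l ] ∃[ m ] ∃[ rest ] (ls ↭ l ∷ m ∷ rest × Joinable l m)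
      find-pair [] = inj₁ []
      find-pair (l ∷ ls) with Any.any? (joinable? l) ls
      ... | yes j with find j
      ...   | m , m∈ , jm with ∈-∃++ m∈
      ...     | us , vs , refl = inj₂ (l , m , us ++ vs , prep l (shift m us vs) , jm)
      find-pair (l ∷ ls) | no ¬j with find-pair ls
      ...   | inj₁ st = inj₁ (All.tabulate (λ m∈ jm → ¬j (lose m∈ jm)) ∷ st)
      ...   | inj₂ (l′ , m , rest , r , jm) =
        inj₂ (l′ , m , l ∷ rest , trans (prep l r) (trans (swap l l′ refl) (prep l′ (swap l m refl))) , jm)

      linked-reverse : ∀ {l} → Linked E l → Linked E (reverse l)
      linked-reverse {[]}    l = []
      linked-reverse {x ∷ m} l = linked-ʳ++ E-sym m l [-]

      merge : ∀ {l m} → Linked E l → Linked E m → HeadLink l m → Linked E (l ʳ++ m)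
      merge {x ∷ l} {y ∷ m} ll lm e = linked-ʳ++ E-sym l ll (e ∷ lm)

      ʳ++-nonempty : ∀ l {m : List (Fin n)} → HeadLink l m → l ʳ++ m ≢ []
      ʳ++-nonempty (x ∷ l) {m} _ e with () ← sym (length-ʳ++ (x ∷ l)) ⨾ cong length e

      Join : List (Fin n) → List (Fin n) → Set
      Join l m = ∃[ k ] (Linked E k × k ≢ [] × l ++ m ↭ k)

      join : ∀ {l m} → Linked E l → Linked E m → Joinable l m → Join l m
      join {l} {m} ll lm (inj₁ (inj₁ e)) = l ʳ++ m , merge ll lm e , ʳ++-nonempty l e , ++↭ʳ++ l m
      join {l} {m} ll lm (inj₁ (inj₂ e)) = l ʳ++ reverse m , merge ll (linked-reverse lm) e , ʳ++-nonempty l e ,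
        trans (↭-++⁺ˡ l (↭-sym (↭-reverse m))) (++↭ʳ++ l (reverse m))
      join {l} {m} ll lm (inj₂ (inj₁ e)) = reverse l ʳ++ m , merge (linked-reverse ll) lm e , ʳ++-nonempty (reverse l) e ,
        trans (↭-++⁺ʳ m (↭-sym (↭-reverse l))) (++↭ʳ++ (reverse l) m)
      join {l} {m} ll lm (inj₂ (inj₂ e)) = reverse l ʳ++ reverse m , merge (linked-reverse ll) (linked-reverse lm) e , ʳ++-nonempty (reverse l) e ,
        trans (↭-++⁺ (↭-sym (↭-reverse l)) (↭-sym (↭-reverse m))) (++↭ʳ++ (reverse l) (reverse m))

      -- Every join lowers the number of paths by one, which bounds the fuel.
      saturate : ∀ fuel (P : PathPartition) → length (paths P) < fuel → ∃[ Q ] Stuck (paths Q)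
      saturate (suc fuel) P (s≤s <fuel) with find-pair (paths P)
      ... | inj₁ st = P , st
      ... | inj₂ (l , m , rest , r , jm) with All-resp-↭ r (linked P) | All-resp-↭ r (nonempty P)
      ...   | ll ∷ lm ∷ lr | _ ∷ _ ∷ nr with join ll lm jm
      ...     | k , lk , k≢ , rk = saturate fuel
          (record { paths = k ∷ rest ; linked = lk ∷ lr ; nonempty = k≢ ∷ nr
                  ; covers = trans (↭-++⁺ʳ (concat rest) (↭-sym rk))
                      (trans (↭-reflexive (++-assoc l m (concat rest))) (trans (concat-↭ (↭-sym r)) (covers P))) })
          (≤-trans (≤-reflexive (sym (↭-length r))) <fuel)

      singletons : PathPartition
      singletons = record { paths = map (_∷ []) (allFin n) ; linked = all-map (allFin n) (λ _ → [-]) ; nonempty = all-map (allFin n) (λ _ ())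
                          ; covers = ↭-reflexive (concat-singletons (allFin n)) }
        where
        all-map : ∀ {Q : List (Fin n) → Set} xs → (∀ x → Q (x ∷ [])) → All Q (map (_∷ []) xs)
        all-map []       q = []
        all-map (x ∷ xs) q = q x ∷ all-map xs q
        concat-singletons : ∀ (xs : List (Fin n)) → concat (map (_∷ []) xs) ≡ xs
        concat-singletons []       = refl
        concat-singletons (x ∷ xs) = cong (x ∷_) (concat-singletons xs)

    abstract
      stuck-partition : ∃[ Q ] Stuck (paths Q)
      stuck-partition = saturate (suc (length (paths singletons))) singletons ≤-refl

    module _ (E-irr : ∀ {x} → ¬ E x x) (E-deg : ∀ {x a b c} → E x a → E x b → E x c → a ≡ b ⊎ b ≡ c ⊎ a ≡ c)
             (P : PathPartition) (stuck : Stuck (paths P)) where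

      unique-paths : Unique (concat (paths P))
      unique-paths = unique-↭ (↭-sym (covers P)) (allFin⁺ n)

      private
        reversal : ∀ {l m} → HeadLink l m → HeadLink m l
        reversal {_ ∷ _} {_ ∷ _} e = E-sym e

        joinable-sym : ∀ {l m} → Joinable l m → Joinable m l
        joinable-sym {l} {m} (inj₁ (inj₁ e)) = inj₁ (inj₁ (reversal {l} {m} e))
        joinable-sym {l} {m} (inj₁ (inj₂ e)) = inj₂ (inj₁ (reversal {l} {reverse m} e))
        joinable-sym {l} {m} (inj₂ (inj₁ e)) = inj₁ (inj₂ (reversal {reverse l} {m} e))
        joinable-sym {l} {m} (inj₂ (inj₂ e)) = inj₂ (inj₂ (reversal {reverse l} {reverse m} e))

        pairwise : ∀ {ls} → Stuck ls → ∀ {l m} → l ∈ ls → m ∈ ls → Joinable l m → l ≡ m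
        pairwise (_ ∷ _)  (here refl) (here refl) j = refl
        pairwise (h ∷ _)  (here refl) (there m∈)  j = ⊥-elim (All.lookup h m∈ j)
        pairwise (h ∷ _)  {l} {m} (there l∈) (here refl) j = ⊥-elim (All.lookup h l∈ (joinable-sym {l} {m} j))
        pairwise (_ ∷ st) (there l∈)  (there m∈)  j = pairwise st l∈ m∈ j

      -- An interior vertex has both of its edges on its own path, and the ends of two different paths are not adjacent.
      unused-edge-closes : ∀ {x r y} → x ∷ r ∈ paths P → E x y → ¬ StartsWith y r → ∃[ z ] ∃[ r′ ] r ≡ z ∷ (r′ ∷ʳ y)
      unused-edge-closes {x} {r} {y} l∈ xy ¬st
        with ∈-concat⁻′ (paths P) (∈-resp-↭ (↭-sym (covers P)) (∈-allFin y))
      ... | l′ , y∈ , l′∈ = by-position (position y∈) y∈ l′∈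
        where
        u : Unique (x ∷ r)
        u = unique-concat-part unique-paths l∈
        same : ∀ {m} → x ∈ m → m ∈ paths P → x ∷ r ≡ m
        same x∈ m∈ = unique-concat-same unique-paths l∈ m∈ (here refl) x∈
        by-position : ∀ {l′} → Position y l′ → y ∈ l′ → l′ ∈ paths P → ∃[ z ] ∃[ r′ ] r ≡ z ∷ (r′ ∷ʳ y)
        by-position (at-first s) _ m∈ with pairwise stuck l∈ m∈ (inj₁ (inj₁ xy))
        ... | refl = ⊥-elim (E-irr xy)
        by-position (at-final p) _ m∈ with pairwise stuck l∈ m∈ (inj₁ (inj₂ (subst (HeadLink (x ∷ r)) (sym (reverse-++ p (y ∷ []))) xy)))
        ... | e = closing p e
          where
          closing : ∀ p → x ∷ r ≡ p ∷ʳ y → ∃[ z ] ∃[ r′ ] r ≡ z ∷ (r′ ∷ʳ y)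
          closing []          refl = ⊥-elim (E-irr xy)
          closing (_ ∷ [])    refl = ⊥-elim (¬st refl)
          closing (_ ∷ z ∷ p) refl = z , p , refl
        -- The edge to `x` is a third one at `y` besides those to `a` and `c`, and `a` differs from
        -- `c`. So `x` is `a` or `c`; as `x` heads its path, `a` would make `y` the vertex after
        -- `x`, and `c` would place `x` behind other vertices.
        by-position (at-inner p a c s) _ m∈ with linked-drop p (All.lookup (linked P) m∈)
        ... | ay ∷ yc ∷ _ with E-deg (E-sym xy) (E-sym ay) yc
        ...   | inj₁ refl = ⊥-elim (at-a p (same (∈-++⁺ʳ p (here refl)) m∈))
          where
          at-a : ∀ p → x ∷ r ≢ p ++ x ∷ y ∷ c ∷ s
          at-a p e with unique-head-pos u p e
          at-a [] refl | refl = ¬st refl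
        ...   | inj₂ (inj₁ refl) with proj₁ (proj₂ (unique-++⁻ p (unique-concat-part unique-paths m∈)))
        ...     | (_ ∷ a≢ ∷ _) ∷ _ = ⊥-elim (a≢ refl)
        by-position (at-inner p a c s) _ m∈ | ay ∷ yc ∷ _ | inj₂ (inj₂ refl)
          with unique-head-pos u (p ++ a ∷ y ∷ []) (same (∈-++⁺ʳ p (there (there (here refl)))) m∈ ⨾ sym (++-assoc p (a ∷ y ∷ []) (c ∷ s)))
        ... | e with () ← ++-conicalʳ p (a ∷ y ∷ []) e

-- Uniqueness of short walks at vertices far from short cycles

module Local where
  open Partition public

  lastOf : ∀ {a} {X : Set a} → X → List X → X
  lastOf x []      = x
  lastOf x (y ∷ t) = lastOf y t

  lastOf-∈ : ∀ {a} {X : Set a} (x y : X) t → lastOf x (y ∷ t) ∈ y ∷ t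
  lastOf-∈ x y []      = here refl
  lastOf-∈ x y (z ∷ t) = there (lastOf-∈ y z t)

  ʳ++-shape : ∀ {a} {X : Set a} (x : X) s acc → ∃[ r ] (s ʳ++ (x ∷ acc) ≡ lastOf x s ∷ r
              × lastOf (lastOf x s) r ≡ lastOf x acc × length r ≡ length s + length acc)
  ʳ++-shape x []      acc = acc , refl , refl , refl
  ʳ++-shape x (y ∷ s) acc with ʳ++-shape y s (x ∷ acc)
  ... | r , e , l , len = r , e , l , (len ⨾ +-suc (length s) (length acc))

  NonBacktracking : ∀ {n} → List (Fin n) → Set
  NonBacktracking (x ∷ y ∷ z ∷ l) = x ≢ z × NonBacktracking (y ∷ z ∷ l)
  NonBacktracking _               = T true

  nonbacktracking-tail : ∀ {n} {x : Fin n} l → NonBacktracking (x ∷ l) → NonBacktracking l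
  nonbacktracking-tail []          _  = _
  nonbacktracking-tail (y ∷ [])    _  = _
  nonbacktracking-tail (y ∷ z ∷ l) nb = proj₂ nb

  Walk : ∀ {n} → Adj n → List (Fin n) → Set
  Walk A l = Linked (Adjacent A) l × NonBacktracking l

  ∑<-member : ∀ {R k} (f : ℕ → ℕ) → k < R → f k ≤ ∑< R f
  ∑<-member {suc R} f (s≤s k≤R) with m≤n⇒m<n∨m≡n k≤R
  ... | inj₁ k<R  = ≤-trans (∑<-member f k<R) (m≤m+n _ _)
  ... | inj₂ refl = m≤n+m _ _

  module _ {n : ℕ} (R : ℕ) (A : Adj n) where
    private V = allFin n

    -- A lollipop is charged to the last vertex of its path: seen from `v`, a path of fewer than `R`
    -- edges runs out and then meets itself.
    lollipopsAt : Fin n → ℕ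
    lollipopsAt v = ∑< R (λ k → ∑ V (λ h → ∑ (tuples n k) (λ t → ∑ V (λ y → ⟦ lollipop? A h t y ⟧ * ⟦ v ≟ lastOf h t ⟧))))

    Bad : Fin n → Set
    Bad v = lollipopsAt v ≢ 0

    bad? : ∀ v → Dec (Bad v)
    bad? v = ¬? (lollipopsAt v ≟ℕ 0)

    lollipop-bad : ∀ {h t y} → Lollipop A h t y → length t < R → Bad (lastOf h t)
    lollipop-bad {h} {t} {y} lp t<R e = <⇒≱ (s≤s z≤n) (begin
      1 ≡⟨ sym (cong₂ _*_ (⟦⟧-yes (lollipop? A h t y) lp) (⟦⟧-yes (v ≟ v) refl)) ⟩
      ⟦ lollipop? A h t y ⟧ * ⟦ v ≟ v ⟧  ≤⟨ ∈⇒≤∑ (λ y → ⟦ lollipop? A h t y ⟧ * ⟦ v ≟ v ⟧) (∈-allFin y) ⟩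
      ∑ V (λ y → ⟦ lollipop? A h t y ⟧ * ⟦ v ≟ lastOf h t ⟧)
        ≤⟨ ∈⇒≤∑ (λ t → ∑ V (λ y → ⟦ lollipop? A h t y ⟧ * ⟦ v ≟ lastOf h t ⟧)) (∈-tuples t) ⟩
      ∑ (tuples n (length t)) (λ t → ∑ V (λ y → ⟦ lollipop? A h t y ⟧ * ⟦ v ≟ lastOf h t ⟧))
        ≤⟨ ∈⇒≤∑ (λ h → ∑ (tuples n (length t)) (λ t → ∑ V (λ y → ⟦ lollipop? A h t y ⟧ * ⟦ v ≟ lastOf h t ⟧))) (∈-allFin h) ⟩
      ∑ V (λ h → ∑ (tuples n (length t)) (λ t → ∑ V (λ y → ⟦ lollipop? A h t y ⟧ * ⟦ v ≟ lastOf h t ⟧)))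
        ≤⟨ ∑<-member (λ k → ∑ V (λ h → ∑ (tuples n k) (λ t → ∑ V (λ y → ⟦ lollipop? A h t y ⟧ * ⟦ v ≟ lastOf h t ⟧)))) t<R ⟩
      lollipopsAt v ≡⟨ e ⟩
      0 ∎)
      where
      open ≤-Reasoning
      v = lastOf h t

    -- Every lollipop is charged to exactly one vertex.
    bad-count : ∑ V (λ v → ⟦ bad? v ⟧) ≤ lollipops≤ R A
    bad-count = ≤-trans (∑-mono V (λ v → indicator (lollipopsAt v) (bad? v))) (≤-reflexive (swap-in R))
      where
      indicator : ∀ c (d : Dec (c ≢ 0)) → ⟦ d ⟧ ≤ c
      indicator zero    (yes ¬0) = ⊥-elim (¬0 refl)
      indicator (suc c) (yes _)  = s≤s z≤n
      indicator c       (no _)   = z≤n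
      term : ℕ → Fin n → ℕ
      term k v = ∑ V (λ h → ∑ (tuples n k) (λ t → ∑ V (λ y → ⟦ lollipop? A h t y ⟧ * ⟦ v ≟ lastOf h t ⟧)))
      level : ∀ k → ∑ V (term k) ≡ lollipops k A
      level k = ∑-swap V V _ ⨾ ∑-cong V (λ h → ∑-swap V (tuples n k) _ ⨾ ∑-cong (tuples n k) (λ t → ∑-swap V V _
        ⨾ ∑-cong V (λ y → ∑-*ˡ V ⟦ lollipop? A h t y ⟧ (λ v → ⟦ v ≟ lastOf h t ⟧)
            ⨾ cong (⟦ lollipop? A h t y ⟧ *_) (∑-single (lastOf h t)) ⨾ *-identityʳ _)))
      swap-in : ∀ R → ∑ V (λ v → ∑< R (λ k → term k v)) ≡ ∑< R (λ k → lollipops k A)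
      swap-in zero    = ∑-zero V
      swap-in (suc R) = ∑-+ V _ _ ⨾ cong₂ _+_ (swap-in R) (level R)

  module _ {n : ℕ} {d R : ℕ} {A : Adj n} (reg : Regular d A) {v : Fin n} (good : ¬ Bad R A v) where
    open Regular reg

    -- Induction from the end `v`. The tail is already a path, so a repetition of `h` makes it a
    -- lollipop with head `x` and closing edge to `h`; the walk does not backtrack, hence `h` is not
    -- the vertex following `x`.
    walk-unique : ∀ h t → Walk A (h ∷ t) → lastOf h t ≡ v → length t ≤ R → Unique (h ∷ t)
    walk-unique h []      _ _ _ = [] ∷ []
    walk-unique h (x ∷ t) (hx ∷ l , nb) last len with walk-unique x t (l , nonbacktracking-tail (x ∷ t) nb) last (<⇒≤ len)
    ... | u with member? h (x ∷ t)
    ...   | no h∉ = All.tabulate (λ z∈ e → h∉ (subst (_∈ x ∷ t) (sym e) z∈)) ∷ u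
    ...   | yes (here refl) = ⊥-elim (¬loop hx)
    ...   | yes (there h∈)  = ⊥-elim (good (subst (Bad R A) last
              (lollipop-bad R A {x} {t} {h} (l , u , adj-sym hx , h∈ , starts t nb) len)))
      where
      starts : ∀ t → NonBacktracking (h ∷ x ∷ t) → ¬ StartsWith h t
      starts (_ ∷ _) nb e = proj₁ nb e

    private
      fold : ∀ p x s acc → NonBacktracking (p ∷ x ∷ s) → Linked (Adjacent A) (x ∷ s) → Walk A (x ∷ p ∷ acc) → Walk A (s ʳ++ (x ∷ p ∷ acc))
      fold p x []      acc nb l       w          = w
      fold p x (y ∷ s) acc nb (e ∷ l) (l′ , nb′) =
        fold x y s (p ∷ acc) (proj₂ nb) l (adj-sym e ∷ l′ , (λ y≡p → proj₁ nb (sym y≡p)) , nb′)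

    -- Once a common beginning is stripped, the first steps from `h` differ. One walk reversed and
    -- followed by the other is then a closed walk at `v` without backtracking, which `walk-unique`
    -- rules out up to length `R`.
    walk-determined : ∀ h t t′ → Walk A (h ∷ t) → Walk A (h ∷ t′) → lastOf h t ≡ v → lastOf h t′ ≡ v →
                      length t + length t′ ≤ R → t ≡ t′
    walk-determined h [] [] _ _ _ _ _ = refl
    walk-determined h [] (z ∷ t′) _ w′ refl e len with walk-unique h (z ∷ t′) w′ e len
    ... | h∉ ∷ _ = ⊥-elim (All.lookup h∉ (lastOf-∈ h z t′) (sym e))
    walk-determined h (z ∷ t) [] w _ e refl len with walk-unique h (z ∷ t) w e (≤-trans (≤-reflexive (sym (+-identityʳ _))) len)
    ... | h∉ ∷ _ = ⊥-elim (All.lookup h∉ (lastOf-∈ h z t) (sym e))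
    walk-determined h (a ∷ s) (b ∷ s′) (ha ∷ l , nb) (hb ∷ l′ , nb′) e e′ len with a ≟ b
    ... | yes refl = cong (a ∷_) (walk-determined a s s′ (l , nonbacktracking-tail (a ∷ s) nb) (l′ , nonbacktracking-tail (a ∷ s′) nb′)
                       e e′ (≤-trans (+-mono-≤ (n≤1+n _) (n≤1+n _)) len))
    ... | no a≢b with ʳ++-shape a s (h ∷ b ∷ s′) | fold h a s (b ∷ s′) nb l (adj-sym ha ∷ hb ∷ l′ , a≢b , nb′)
    ...   | r , eq , last , lenr | w with walk-unique (lastOf a s) r (subst (Walk A) eq w) (last ⨾ e′)
              (≤-trans (≤-reflexive (lenr ⨾ +-suc (length s) _)) len)
    ...     | v∉ ∷ _ with r
    ...       | []    with () ← lenr ⨾ +-suc (length s) _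
    ...       | z ∷ r′ = ⊥-elim (All.lookup v∉ (lastOf-∈ (lastOf a s) z r′) (e ⨾ sym (last ⨾ e′)))

-- Near-perfect matchings from the double cover

module Factor where
  open Local public

  pairUp : ∀ {a} {X : Set a} → List X → List (X × X)
  pairUp (x ∷ y ∷ l) = (x , y) ∷ pairUp l
  pairUp _           = []

  leftover : ∀ {a} {X : Set a} → List X → List X
  leftover (x ∷ y ∷ l) = leftover l
  leftover l           = l

  flatten : ∀ {a} {X : Set a} → List (X × X) → List X
  flatten []             = []
  flatten ((x , y) ∷ ps) = x ∷ y ∷ flatten ps

  flatten-++ : ∀ {a} {X : Set a} (ps : List (X × X)) {qs} → flatten (ps ++ qs) ≡ flatten ps ++ flatten qs
  flatten-++ []             = refl
  flatten-++ ((x , y) ∷ ps) = cong (λ l → x ∷ y ∷ l) (flatten-++ ps)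

  pairUp-leftover : ∀ {a} {X : Set a} (l : List X) → flatten (pairUp l) ++ leftover l ≡ l
  pairUp-leftover []          = refl
  pairUp-leftover (x ∷ [])    = refl
  pairUp-leftover (x ∷ y ∷ l) = cong (λ l → x ∷ y ∷ l) (pairUp-leftover l)

  pairUp-concat : ∀ {a} {X : Set a} (ls : List (List X)) →
                  flatten (concat (map pairUp ls)) ++ concat (map leftover ls) ↭ concat ls
  pairUp-concat []       = refl
  pairUp-concat (l ∷ ls) = trans (↭-reflexive (cong (_++ L ++ Ls) (flatten-++ (pairUp l)) ⨾ ++-assoc P Ps (L ++ Ls)))
      (trans (↭-++⁺ˡ P (shifts Ps L))
      (trans (↭-reflexive (sym (++-assoc P L (Ps ++ Ls)) ⨾ cong (_++ Ps ++ Ls) (pairUp-leftover l)))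
      (↭-++⁺ˡ l (pairUp-concat ls))))
    where
    P = flatten (pairUp l)
    Ps = flatten (concat (map pairUp ls))
    L = leftover l
    Ls = concat (map leftover ls)

  pairUp-linked : ∀ {a r} {X : Set a} {R : X → X → Set r} {l : List X} → Linked R l → ∀ {x y} → (x , y) ∈ pairUp l → R x y
  pairUp-linked (r ∷ l)     (here refl) = r
  pairUp-linked (_ ∷ _ ∷ l) (there p∈)  = pairUp-linked l p∈

  leftover-≤1 : ∀ {a} {X : Set a} (l : List X) → length (leftover l) ≤ 1
  leftover-≤1 []          = z≤n
  leftover-≤1 (x ∷ [])    = s≤s z≤n
  leftover-≤1 (x ∷ y ∷ l) = leftover-≤1 l

  module _ {n : ℕ} where
    mate : List (Fin n × Fin n) → Fin n → Fin n
    mate []             z = z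
    mate ((x , y) ∷ ps) z with z ≟ x | z ≟ y
    ... | yes _ | _     = y
    ... | no _  | yes _ = x
    ... | no _  | no _  = mate ps z

    mate-edge : ∀ ps z → mate ps z ≡ z ⊎ (z , mate ps z) ∈ ps ⊎ (mate ps z , z) ∈ ps
    mate-edge []             z = inj₁ refl
    mate-edge ((x , y) ∷ ps) z with z ≟ x | z ≟ y
    ... | yes refl | _        = inj₂ (inj₁ (here refl))
    ... | no _     | yes refl = inj₂ (inj₂ (here refl))
    ... | no _     | no _     with mate-edge ps z
    ...   | inj₁ e        = inj₁ e
    ...   | inj₂ (inj₁ i) = inj₂ (inj₁ (there i))
    ...   | inj₂ (inj₂ i) = inj₂ (inj₂ (there i))

    ∈-flatten : ∀ {ps : List (Fin n × Fin n)} {x y} → (x , y) ∈ ps → x ∈ flatten ps × y ∈ flatten ps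
    ∈-flatten (here refl) = here refl , there (here refl)
    ∈-flatten (there i)   = let a , b = ∈-flatten i in there (there a) , there (there b)

    mate-involutive : ∀ ps → Unique (flatten ps) → ∀ z → mate ps (mate ps z) ≡ z
    mate-involutive []             _ z = refl
    mate-involutive ((x , y) ∷ ps) ((x≢y ∷ x∉) ∷ y∉ ∷ u) z with z ≟ x | z ≟ y
    ... | yes refl | _ with y ≟ z | y ≟ y
    ...   | yes refl | _      = ⊥-elim (x≢y refl)
    ...   | no _     | yes _  = refl
    ...   | no _     | no y≢y = ⊥-elim (y≢y refl)
    mate-involutive ((x , y) ∷ ps) ((x≢y ∷ x∉) ∷ y∉ ∷ u) z | no _ | yes refl with x ≟ x
    ...   | yes _  = refl
    ...   | no x≢x = ⊥-elim (x≢x refl)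
    mate-involutive ((x , y) ∷ ps) ((x≢y ∷ x∉) ∷ y∉ ∷ u) z | no z≢x | no z≢y with mate ps z ≟ x | mate ps z ≟ y
    ...   | no _  | no _ = mate-involutive ps u z
    ...   | yes e | _ = ⊥-elim (absurd (mate-edge ps z))
      where
      absurd : _ → ⊥
      absurd (inj₁ e′)       = z≢x (sym e′ ⨾ e)
      absurd (inj₂ (inj₁ i)) = All.lookup x∉ (proj₂ (∈-flatten i)) (sym e)
      absurd (inj₂ (inj₂ i)) = All.lookup x∉ (proj₁ (∈-flatten i)) (sym e)
    ...   | no _ | yes e = ⊥-elim (absurd (mate-edge ps z))
      where
      absurd : _ → ⊥
      absurd (inj₁ e′)       = z≢y (sym e′ ⨾ e)
      absurd (inj₂ (inj₁ i)) = All.lookup y∉ (proj₂ (∈-flatten i)) (sym e)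
      absurd (inj₂ (inj₂ i)) = All.lookup y∉ (proj₁ (∈-flatten i)) (sym e)

    mate-moves : ∀ ps → Unique (flatten ps) → ∀ {z} → z ∈ flatten ps → mate ps z ≢ z
    mate-moves ((x , y) ∷ ps) ((x≢y ∷ x∉) ∷ y∉ ∷ u) {z} z∈ with z ≟ x | z ≟ y
    ... | yes refl | _        = λ e → x≢y (sym e)
    ... | no _     | yes refl = x≢y
    ... | no z≢x   | no z≢y with z∈
    ...   | here e            = ⊥-elim (z≢x e)
    ...   | there (here e)    = ⊥-elim (z≢y e)
    ...   | there (there z∈′) = mate-moves ps u z∈′

  fixedPoints : ∀ {n} → (Fin n → Fin n) → ℕ
  fixedPoints {n} m = ∑ (allFin n) (λ x → ⟦ m x ≟ x ⟧)

  module Factorization {n d R g : ℕ} {A : Adj n} (reg : Regular d A) (g≤R : g ≤ R) where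
    open Regular reg
    private
      V = allFin n
      bad : Fin n → ℕ
      bad x = ⟦ bad? R A x ⟧

    -- Divided by `g` this is n / g, a bound for the number of disjoint cycles with at least `g`
    -- vertices, plus one for every bad vertex.
    cost : ℕ
    cost = n + g * ∑ V bad

    module Charging (E : Fin n → Fin n → Set) (E? : ∀ x y → Dec (E x y)) (E-sym : ∀ {x y} → E x y → E y x)
                    (E-adj : ∀ {x y} → E x y → Adjacent A x y)
                    (E-deg : ∀ {x a b c} → E x a → E x b → E x c → a ≡ b ⊎ b ≡ c ⊎ a ≡ c) where
      open Joining E E? E-sym

      E-irr : ∀ {x} → ¬ E x x
      E-irr {x} e with () ← sym (E-adj e) ⨾ irr x

      partition : PathPartition
      partition = proj₁ stuck-partition

      open PathPartition partition public

      unique-all : Unique (concat paths)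
      unique-all = unique-paths E-irr E-deg partition (proj₂ stuck-partition)

      module _ (W : Fin n → ℕ) (W≥ : ∀ x → 1 + g * bad x ≤ W x) where
        -- A path closed up by an edge is a cycle: it is either long or one of its vertices is bad.
        charge-closed : ∀ {x r y} → x ∷ r ∈ paths → E x y → ¬ StartsWith y r → g ≤ ∑ (x ∷ r) W
        charge-closed {x} {r} {y} l∈ xy ¬st with unused-edge-closes E-irr E-deg partition (proj₂ stuck-partition) l∈ xy ¬st
        ... | z , r′ , refl = ≤-trans long-or-bad (≤-trans (≤-reflexive expand) (∑-mono (x ∷ t) W≥))
          where
          t = z ∷ (r′ ∷ʳ y)
          expand : length (x ∷ t) + g * ∑ (x ∷ t) bad ≡ ∑ (x ∷ t) (λ x → 1 + g * bad x)
          expand = cong₂ _+_ (sym (∑-1 (x ∷ t))) (sym (∑-*ˡ (x ∷ t) g bad)) ⨾ sym (∑-+ (x ∷ t) (λ _ → 1) (λ x → g * bad x))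
          u : Unique (x ∷ t)
          u = unique-concat-part unique-all l∈
          last : ∀ w r → lastOf w (r ∷ʳ y) ≡ y
          last w []      = refl
          last w (v ∷ r) = last v r
          y∈ : y ∈ r′ ∷ʳ y
          y∈ = ∈-++⁺ʳ r′ (here refl)
          y≢z : y ≢ z
          y≢z refl with u
          ... | _ ∷ z∉ ∷ _ = All.lookup z∉ y∈ refl
          -- The closing edge returns to the last vertex of the path, so the cycle itself is a
          -- lollipop and its last vertex `y` is the bad one.
          lp : Lollipop A x t y
          lp = linked-∈ (λ _ _ → E-adj) (All.lookup linked l∈) , u , E-adj xy , there y∈ , y≢z
          long-or-bad : g ≤ length (x ∷ t) + g * ∑ (x ∷ t) bad
          long-or-bad with g ≤? length (x ∷ t)
          ... | yes g≤ = ≤-trans g≤ (m≤m+n _ _)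
          ... | no g≰ = ≤-trans (≤-trans (≤-reflexive (sym (*-identityʳ g))) (*-monoʳ-≤ g one)) (m≤n+m _ _)
            where
            one : 1 ≤ ∑ (x ∷ t) bad
            one = ≤-trans (≤-reflexive (sym (⟦⟧-yes (bad? R A y)
                    (subst (Bad R A) (last z r′) (lollipop-bad R A lp (≤-trans (n≤1+n _) (≤-trans (≰⇒> g≰) g≤R)))))))
                    (∈⇒≤∑ bad (there (there y∈)))

        -- The paths are disjoint, so no vertex pays twice.
        charge-total : (c : List (Fin n) → ℕ) → (∀ l → l ∈ paths → g * c l ≤ ∑ l W) → g * ∑ paths c ≤ ∑ V W
        charge-total c h = begin
          g * ∑ paths c  ≡⟨ sym (∑-*ˡ paths g c) ⟩
          ∑ paths (λ l → g * c l)  ≤⟨ ∑-mono-∈ paths h ⟩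
          ∑ paths (λ l → ∑ l W)  ≡⟨ sym (∑-concat paths W) ⟩
          ∑ (concat paths) W  ≡⟨ ∑-↭ W covers ⟩
          ∑ V W  ∎
          where open ≤-Reasoning

    -- A matching as an involution that fixes the unmatched vertices. `U` counts the unmatched left
    -- vertices of the double cover; it enters twice in `fixed≤` because a missing image and a
    -- missing preimage can each spoil a path.
    record NearMatching (e : Fin n → Fin n → Bool) (s : ℕ) : Set where
      field
        partner    : Fin n → Fin n
        involutive : ∀ x → partner (partner x) ≡ x
        edge       : ∀ {x} → partner x ≢ x → e x (partner x) ≡ true
        U          : ℕ
        U≤         : U ≤ s
        fixed≤     : g * fixedPoints partner ≤ g * U + g * U + cost

    module FromMatching (e : Fin n → Fin n → Bool) (e-sym : ∀ x y → e x y ≡ e y x) (e-adj : ∀ {x y} → e x y ≡ true → Adjacent A x y)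
                        (h : Fin n → Maybe (Fin n)) (match : Matching.IsMatching e h) where
      open ≤-Reasoning
      open Matching.IsMatching match
      U = Matching.unmatched e h
      E : Fin n → Fin n → Set
      E x y = h x ≡ just y ⊎ h y ≡ just x
      E-adj : ∀ {x y} → E x y → Adjacent A x y
      E-adj (inj₁ p) = e-adj (edge p)
      E-adj {x} {y} (inj₂ p) = e-adj (e-sym x y ⨾ edge p)
      E-deg : ∀ {x a b c} → E x a → E x b → E x c → a ≡ b ⊎ b ≡ c ⊎ a ≡ c
      E-deg (inj₁ p) (inj₁ q) _        = inj₁ (just-injective (sym p ⨾ q))
      E-deg (inj₂ p) (inj₂ q) _        = inj₁ (inj p q)
      E-deg (inj₁ p) (inj₂ _) (inj₁ q) = inj₂ (inj₂ (just-injective (sym p ⨾ q)))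
      E-deg (inj₁ _) (inj₂ p) (inj₂ q) = inj₂ (inj₁ (inj p q))
      E-deg (inj₂ _) (inj₁ p) (inj₁ q) = inj₂ (inj₁ (just-injective (sym p ⨾ q)))
      E-deg (inj₂ p) (inj₁ _) (inj₂ q) = inj₂ (inj₂ (inj p q))
      E? : ∀ x y → Dec (E x y)
      E? x y = ≟just-dec (h x) y ⊎-dec ≟just-dec (h y) x
      E-sym : ∀ {x y} → E x y → E y x
      E-sym (inj₁ p) = inj₂ p
      E-sym (inj₂ p) = inj₁ p
      open Charging E E? E-sym E-adj E-deg
      hit? : ∀ x → Dec (∃[ y ] h y ≡ just x)
      hit? x = any? (λ y → ≟just-dec (h y) x)
      noOut noIn W : Fin n → ℕ
      noOut x = ⟦ nothing? (h x) ⟧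
      noIn x = ⟦ ¬? (hit? x) ⟧
      W x = (1 + g * noOut x + g * noIn x) + g * bad x
      total : ∑ V W ≡ (n + g * U + g * ∑ V noIn) + g * ∑ V bad
      total = ∑-+ V _ _ ⨾ cong₂ _+_ (∑-+ V _ _ ⨾ cong₂ _+_ (∑-+ V _ _ ⨾ cong₂ _+_ (∑-1 V ⨾ length-allFin n) (∑-*ˡ V g noOut)) (∑-*ˡ V g noIn)) (∑-*ˡ V g bad)
      rearrange : ∀ n a b → (n + a + a) + b ≡ a + a + (n + b)
      rearrange = solve-∀
      hits = ∑ V (λ x → ⟦ hit? x ⟧)
      -- A partial injection of a finite set into itself misses no more values than arguments.
      noIn≤ : ∑ V noIn ≤ U
      noIn≤ = +-cancelʳ-≤ hits _ _ (begin
        ∑ V noIn + hits  ≡⟨ sym (∑-+ V _ _) ⟩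
        ∑ V (λ x → noIn x + ⟦ hit? x ⟧)  ≤⟨ ∑-mono V (λ x → complementary (hit? x)) ⟩
        ∑ V (λ _ → 1)  ≤⟨ ∑-mono V one ⟩
        ∑ V (λ x → noOut x + ∑ V (λ y → ⟦ ≟just-dec (h x) y ⟧)) ≡⟨ ∑-+ V _ _ ⨾ cong (U +_) (∑-swap V V _) ⟩
        U + ∑ V (λ y → ∑ V (λ x → ⟦ ≟just-dec (h x) y ⟧))  ≤⟨ +-monoʳ-≤ U (∑-mono V at-most) ⟩
        U + hits  ∎)
        where
        complementary : ∀ {P : Set} (p : Dec P) → ⟦ ¬? p ⟧ + ⟦ p ⟧ ≤ 1
        complementary (yes _) = ≤-refl
        complementary (no _)  = ≤-refl
        one : ∀ x → 1 ≤ noOut x + ∑ V (λ y → ⟦ ≟just-dec (h x) y ⟧)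
        one x with h x
        ... | nothing = s≤s z≤n
        ... | just w  = ≤-trans (≤-reflexive (sym (⟦⟧-yes (≟just-dec (just w) w) refl)))
                          (∈⇒≤∑ (λ u → ⟦ ≟just-dec (just w) u ⟧) (∈-allFin w))
        at-most : ∀ y → ∑ V (λ x → ⟦ ≟just-dec (h x) y ⟧) ≤ ⟦ hit? y ⟧
        at-most y with hit? y
        ... | yes _ = ∑-unique-≤1 V (λ x → ≟just-dec (h x) y) (allFin⁺ n) (λ _ _ → inj)
        ... | no ¬p = ≤-reflexive (∑-cong V (λ x → ⟦⟧-no (≟just-dec (h x) y) (λ p → ¬p (x , p))) ⨾ ∑-zero V)
      ps = concat (map pairUp paths)
      rest = concat (map leftover paths)
      unique-split : Unique (flatten ps ++ rest)
      unique-split = unique-↭ (↭-sym (pairUp-concat paths)) unique-all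
      unique-ps : Unique (flatten ps)
      unique-ps = proj₁ (unique-++⁻ (flatten ps) unique-split)
      pair-E : ∀ {x y} → (x , y) ∈ ps → E x y
      pair-E p∈ with ∈-concat⁻′ (map pairUp paths) p∈
      ... | qs , p∈qs , qs∈ with ∈-map⁻ pairUp qs∈
      ...   | l , l∈ , refl = pairUp-linked (All.lookup linked l∈) p∈qs
      partner-edge : ∀ x → mate ps x ≢ x → mate ps x ≡ x ⊎ (x , mate ps x) ∈ ps ⊎ (mate ps x , x) ∈ ps → e x (mate ps x) ≡ true
      partner-edge x mv (inj₁ q) = ⊥-elim (mv q)
      partner-edge x mv (inj₂ (inj₁ i)) with pair-E i
      ... | inj₁ p = edge p
      ... | inj₂ p = e-sym x _ ⨾ edge p
      partner-edge x mv (inj₂ (inj₂ i)) with pair-E i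
      ... | inj₁ p = e-sym x _ ⨾ edge p
      ... | inj₂ p = edge p
      fixed-leftover : fixedPoints (mate ps) ≤ ∑ paths (λ l → length (leftover l))
      fixed-leftover = begin
        ∑ V (λ x → ⟦ mate ps x ≟ x ⟧)  ≤⟨ ∑-⊆-supp V rest (λ x → mate ps x ≟ x) (allFin⁺ n) in-rest ⟩
        ∑ rest (λ x → ⟦ mate ps x ≟ x ⟧)  ≤⟨ ∑-bound rest (λ x _ → ⟦⟧-≤1 (mate ps x ≟ x)) ⟩
        length rest * 1                        ≡⟨ *-identityʳ (length rest) ⨾ sym (∑-1 rest) ⨾ ∑-concat (map leftover paths) (λ _ → 1)
                          ⨾ ∑-map leftover paths _ ⨾ ∑-cong paths (λ l → ∑-1 (leftover l)) ⟩
        ∑ paths (λ l → length (leftover l))  ∎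
        where
        in-rest : ∀ x → x ∈ V → mate ps x ≡ x → x ∈ rest
        in-rest x _ fx with ∈-++⁻ (flatten ps) (∈-resp-↭ (↭-sym (trans (pairUp-concat paths) covers)) (∈-allFin x))
        ... | inj₁ x∈ = ⊥-elim (mate-moves ps unique-ps x∈ fx)
        ... | inj₂ x∈ = x∈
      g·≤ : ∀ (l : List (Fin n)) → g * length (leftover l) ≤ g
      g·≤ l = ≤-trans (*-monoʳ-≤ g (leftover-≤1 l)) (≤-reflexive (*-identityʳ g))
      W≥ : ∀ x → 1 + g * bad x ≤ W x
      W≥ x = +-monoˡ-≤ _ (s≤s z≤n)
      noOut≤W : ∀ x → g * noOut x ≤ W x
      noOut≤W x = ≤-trans (n≤1+n _) (≤-trans (m≤m+n _ (g * noIn x)) (m≤m+n _ (g * bad x)))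
      noIn≤W : ∀ x → g * noIn x ≤ W x
      noIn≤W x = ≤-trans (m≤n+m _ (1 + g * noOut x)) (m≤m+n _ (g * bad x))
      -- When `x` and `z` are matched to each other in both directions, `z` has no further neighbour
      -- in `E`. The path is then this single edge, and pairing leaves nothing over.
      closed-pair : ∀ {x z} r → h x ≡ just z → h z ≡ just x → Linked E (x ∷ z ∷ r) → Unique (x ∷ z ∷ r) →
                    g * length (leftover (x ∷ z ∷ r)) ≤ ∑ (x ∷ z ∷ r) W
      closed-pair [] _ _ _ _ = ≤-trans (≤-reflexive (*-zeroʳ g)) z≤n
      closed-pair (w ∷ _) hx hz (_ ∷ inj₁ hz′ ∷ _) ((_ ∷ x≢w ∷ _) ∷ _) = ⊥-elim (x≢w (just-injective (sym hz ⨾ hz′)))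
      closed-pair (w ∷ _) hx hz (_ ∷ inj₂ hw ∷ _) ((_ ∷ x≢w ∷ _) ∷ _) = ⊥-elim (x≢w (inj hx hw))
      charge-matched : ∀ {x y y′} r → h x ≡ just y → h y′ ≡ just x → x ∷ r ∈ paths → Linked E (x ∷ r) →
                       g * length (leftover (x ∷ r)) ≤ ∑ (x ∷ r) W
      charge-matched {x} [] hx _ l∈ _ = ≤-trans (g·≤ (x ∷ [])) (charge-closed W W≥ l∈ (inj₁ hx) λ ())
      charge-matched {x} {y} {y′} (z ∷ r) hx hy′ l∈ lk = cases (y ≟ z) (y′ ≟ z)
        where
        cases : Dec (y ≡ z) → Dec (y′ ≡ z) → g * length (leftover (x ∷ z ∷ r)) ≤ ∑ (x ∷ z ∷ r) W
        cases (no y≢z)   _           = ≤-trans (g·≤ (x ∷ z ∷ r)) (charge-closed W W≥ l∈ (inj₁ hx) y≢z)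
        cases (yes _)    (no y′≢z)   = ≤-trans (g·≤ (x ∷ z ∷ r)) (charge-closed W W≥ l∈ (inj₂ hy′) y′≢z)
        cases (yes refl) (yes refl)  = closed-pair r hx hy′ lk (unique-concat-part unique-all l∈)
      charge : ∀ l → l ∈ paths → Linked E l → g * length (leftover l) ≤ ∑ l W
      charge []      _  _  = ≤-reflexive (*-zeroʳ g)
      charge (x ∷ r) l∈ lk = cases (h x) refl (hit? x)
        where
        whole : {m : ℕ} → m ≡ 1 → g * m ≤ W x → g * length (leftover (x ∷ r)) ≤ ∑ (x ∷ r) W
        whole refl ≤W = ≤-trans (g·≤ (x ∷ r)) (≤-trans (≤-reflexive (sym (*-identityʳ g))) (≤-trans ≤W (m≤m+n (W x) (∑ r W))))
        cases : ∀ m → h x ≡ m → Dec (∃[ y ] h y ≡ just x) → g * length (leftover (x ∷ r)) ≤ ∑ (x ∷ r) W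
        cases nothing  hx _              = whole (⟦⟧-yes (nothing? (h x)) hx) (noOut≤W x)
        cases (just y) hx (no ¬p)        = whole (⟦⟧-yes (¬? (hit? x)) ¬p) (noIn≤W x)
        cases (just y) hx (yes (_ , hy)) = charge-matched r hx hy l∈ lk
      fixed-bound : g * fixedPoints (mate ps) ≤ g * U + g * U + cost
      fixed-bound = begin
        g * fixedPoints (mate ps)  ≤⟨ *-monoʳ-≤ g fixed-leftover ⟩
        g * ∑ paths (λ l → length (leftover l))  ≤⟨ charge-total W W≥ (λ l → length (leftover l)) (λ l l∈ → charge l l∈ (All.lookup linked l∈)) ⟩
        ∑ V W  ≡⟨ total ⟩
        (n + g * U + g * ∑ V noIn) + g * ∑ V bad  ≤⟨ +-monoˡ-≤ _ (+-monoʳ-≤ (n + g * U) (*-monoʳ-≤ g noIn≤)) ⟩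
        (n + g * U + g * U) + g * ∑ V bad  ≡⟨ rearrange n (g * U) (g * ∑ V bad) ⟩
        g * U + g * U + cost  ∎

    -- A perfect matching of the bipartite double cover splits into cycles; pairing up consecutive vertices
    -- of a cycle loses one vertex per odd cycle, and short odd cycles only occur at bad vertices.
    near-matching : ∀ e D s .{{_ : NonZero D}} → (∀ x y → e x y ≡ e y x) → (∀ {x y} → e x y ≡ true → Adjacent A x y) →
                    (∀ x → degree e x ≤ D) → ∑ V (λ x → D ∸ degree e x) ≤ D * s → NearMatching e s
    near-matching e D s e-sym e-adj deg≤ deficit = build (Matching.near-perfect e D columns)
      where
      columns : ∀ y → ∑ V (λ x → 𝟙 (e x y)) ≤ D
      columns y = ≤-trans (≤-reflexive (∑-cong V (λ x → cong 𝟙 (e-sym x y)))) (deg≤ y)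
      build : ∃[ h ] (Matching.IsMatching e h × D * Matching.unmatched e h ≤ ∑ V (λ x → D ∸ degree e x)) → NearMatching e s
      build (h , match , un≤) = record
        { partner = mate M.ps ; involutive = mate-involutive M.ps M.unique-ps
        ; edge = λ {x} mv → M.partner-edge x mv (mate-edge M.ps x)
        ; U = M.U ; U≤ = *-cancelˡ-≤ D (≤-trans un≤ deficit)
        ; fixed≤ = M.fixed-bound }
        where module M = FromMatching e e-sym e-adj h match

-- Two disjoint matchings and a cover by few short paths

module TwoFactor where
  open Factor public

  true⇒ : ∀ {p} {P : Set p} (p? : Dec P) → does p? ≡ true → P
  true⇒ (yes p) _ = p

  does-⇔ : ∀ {p q} {P : Set p} {Q : Set q} (p? : Dec P) (q? : Dec Q) → (P → Q) → (Q → P) → does p? ≡ does q?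
  does-⇔ (yes p) q? f g = sym (dec-true q? (f p))
  does-⇔ (no ¬p) q? f g = sym (dec-false q? (λ q → ¬p (g q)))

  𝟙-does : ∀ {p} {P : Set p} (p? : Dec P) → 𝟙 (does p?) ≡ ⟦ p? ⟧
  𝟙-does (yes _) = refl
  𝟙-does (no _)  = refl

  module Chunks {ℓ} {X : Set ℓ} (g : ℕ) (0<g : 0 < g) where
    chunks : ℕ → List X → List (List X)
    chunks zero       l = l ∷ []
    chunks (suc fuel) l with length l ≤? g
    ... | yes _ = l ∷ []
    ... | no _  = take g l ∷ chunks fuel (drop g l)

    concat-chunks : ∀ fuel l → concat (chunks fuel l) ≡ l
    concat-chunks zero       l = ++-identityʳ l
    concat-chunks (suc fuel) l with length l ≤? g
    ... | yes _ = ++-identityʳ l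
    ... | no _  = cong (take g l ++_) (concat-chunks fuel (drop g l)) ⨾ take++drop≡id g l

    private
      dropped : ∀ {fuel} (l : List X) → ¬ length l ≤ g → length l ≤ suc fuel → length (drop g l) ≤ fuel
      dropped {fuel} l ≰g ≤fuel = ≤-trans (≤-reflexive (length-drop g l))
        (≤-trans (∸-monoʳ-≤ (length l) 0<g) (∸-monoˡ-≤ 1 ≤fuel))

    chunks-linked : ∀ {r} {R : X → X → Set r} fuel l → Linked R l → All (Linked R) (chunks fuel l)
    chunks-linked zero       l lk = lk ∷ []
    chunks-linked {R = R} (suc fuel) l lk with length l ≤? g
    ... | yes _ = lk ∷ []
    ... | no _  = linked-take (take g l) lk′ ∷ chunks-linked fuel (drop g l) (linked-drop (take g l) lk′)
      where
      lk′ : Linked R (take g l ++ drop g l)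
      lk′ = subst (Linked R) (sym (take++drop≡id g l)) lk

    chunks-short : ∀ fuel l → length l ≤ fuel → All (λ c → length c ≤ g) (chunks fuel l)
    chunks-short zero       l ≤0 = ≤-trans ≤0 z≤n ∷ []
    chunks-short (suc fuel) l ≤fuel with length l ≤? g
    ... | yes ≤g = ≤g ∷ []
    ... | no ≰g  = ≤-trans (≤-reflexive (length-take g l)) (m⊓n≤m g (length l)) ∷ chunks-short fuel (drop g l) (dropped l ≰g ≤fuel)

    -- Every piece but the last uses up `g` entries.
    chunks-count : ∀ fuel l → length l ≤ fuel → g * length (chunks fuel l) ≤ g + length l
    chunks-count zero       l _ = ≤-trans (≤-reflexive (*-identityʳ g)) (m≤m+n g _)
    chunks-count (suc fuel) l ≤fuel with length l ≤? g
    ... | yes _ = ≤-trans (≤-reflexive (*-identityʳ g)) (m≤m+n g _)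
    ... | no ≰g = ≤-trans (≤-reflexive (*-suc g _)) (+-monoʳ-≤ g (≤-trans (chunks-count fuel (drop g l) (dropped l ≰g ≤fuel))
         (≤-reflexive (cong (g +_) (length-drop g l) ⨾ m+[n∸m]≡n (<⇒≤ (≰⇒> ≰g))))))

  record PathCover {n : ℕ} (A : Adj n) (g c : ℕ) : Set where
    field
      paths  : List (List (Fin n))
      linked : All (Linked (Adjacent A)) paths
      short  : All (λ l → length l ≤ g) paths
      covers : concat paths ↭ allFin n
      few    : g * length paths ≤ c

  module _ {n D R g : ℕ} {A : Adj n} (0<D : 0 < D) (0<g : 0 < g) (reg : Regular (suc D) A) (g≤R : g ≤ R) where
    open Regular reg
    open Factorization {n} {suc D} {R} {g} {A} reg g≤R
    private
      V = allFin n
      d = suc D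

      -- In a regular graph the degree deficit is zero, so nothing stays unmatched in the double
      -- cover and vertices are lost only on odd cycles.
      M₁ : NearMatching (adj? A) 0
      M₁ = near-matching (adj? A) d 0 {{>-nonZero (s≤s z≤n)}} symm id (λ x → ≤-reflexive (deg x))
        (≤-trans (≤-reflexive (∑-cong V (λ x → cong (d ∸_) (deg x) ⨾ n∸n≡0 d) ⨾ ∑-zero V)) z≤n)
      module M₁ = NearMatching M₁
      m₁ : Fin n → Fin n
      m₁ = M₁.partner

      m₁-adj : ∀ {x} → m₁ x ≢ x → Adjacent A x (m₁ x)
      m₁-adj = M₁.edge

      -- Vertices without a first partner are isolated: they would keep degree `d`, above the bound
      -- `D` = d - 1 needed for the second matching.
      Residual : Fin n → Fin n → Set
      Residual x y = Adjacent A x y × m₁ x ≢ y × m₁ x ≢ x × m₁ y ≢ y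

      residual? : ∀ x y → Dec (Residual x y)
      residual? x y = adjacent? A x y ×-dec ¬? (m₁ x ≟ y) ×-dec ¬? (m₁ x ≟ x) ×-dec ¬? (m₁ y ≟ y)

      residual-sym : ∀ {x y} → Residual x y → Residual y x
      residual-sym {x} {y} (a , b , c , d) = adj-sym a , (λ e → b (cong m₁ (sym e) ⨾ M₁.involutive y)) , d , c

      e₂ : Fin n → Fin n → Bool
      e₂ x y = does (residual? x y)

      fix₁ : Fin n → ℕ
      fix₁ x = ⟦ m₁ x ≟ x ⟧

      degree-e₂ : ∀ x → degree e₂ x ≡ ∑ V (λ y → ⟦ residual? x y ⟧)
      degree-e₂ x = ∑-cong V (λ y → 𝟙-does (residual? x y))

      adjacency-sum : ∀ x → ∑ V (λ y → ⟦ adjacent? A x y ⟧) ≡ d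
      adjacency-sum x = ∑-cong V (λ y → ⟦adjacent⟧ A x y) ⨾ deg x

      degree-e₂≤ : ∀ x → degree e₂ x ≤ D
      degree-e₂≤ x = of (m₁ x ≟ x)
        where
        open ≤-Reasoning
        of : Dec (m₁ x ≡ x) → degree e₂ x ≤ D
        of (yes fx) = ≤-trans (≤-reflexive (degree-e₂ x ⨾ ∑-cong V (λ y → ⟦⟧-no (residual? x y) (λ r → proj₁ (proj₂ (proj₂ r)) fx)) ⨾ ∑-zero V)) z≤n
        of (no mv)  = +-cancelˡ-≤ 1 _ _ (begin
          1 + degree e₂ x  ≡⟨ +-comm 1 _ ⨾ cong₂ _+_ (degree-e₂ x) (sym (∑-single (m₁ x))) ⟩
          ∑ V (λ y → ⟦ residual? x y ⟧) + ∑ V (λ y → ⟦ y ≟ m₁ x ⟧) ≡⟨ sym (∑-+ V _ _) ⟩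
          ∑ V (λ y → ⟦ residual? x y ⟧ + ⟦ y ≟ m₁ x ⟧)  ≤⟨ ∑-mono V (λ y → disjoint y (residual? x y) (y ≟ m₁ x)) ⟩
          ∑ V (λ y → ⟦ adjacent? A x y ⟧)  ≡⟨ adjacency-sum x ⟩
          d  ∎)
          where
          disjoint : ∀ y (r : Dec (Residual x y)) (q : Dec (y ≡ m₁ x)) → ⟦ r ⟧ + ⟦ q ⟧ ≤ ⟦ adjacent? A x y ⟧
          disjoint y (yes r) (yes refl) = ⊥-elim (proj₁ (proj₂ r) refl)
          disjoint y (yes r) (no _)     = ≤-reflexive (sym (⟦⟧-yes (adjacent? A x y) (proj₁ r)))
          disjoint y (no _)  (yes refl) = ≤-reflexive (sym (⟦⟧-yes (adjacent? A x y) (m₁-adj mv)))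
          disjoint y (no _)  (no _)     = z≤n

      -- An edge at `x` disappears because it is the matching edge, which the passage from `d` to
      -- `D` allows for, because its other end is fixed by `m₁`, or because `x` is.
      deficit-at : ∀ x → D ∸ degree e₂ x ≤ ∑ V (λ y → ⟦ adjacent? A x y ⟧ * fix₁ y) + fix₁ x * d
      deficit-at x = m≤n+o⇒m∸n≤o D (degree e₂ x) (+-cancelˡ-≤ 1 _ _ (begin
        d  ≡⟨ sym (adjacency-sum x) ⟩
        ∑ V (λ y → ⟦ adjacent? A x y ⟧)  ≤⟨ ∑-mono V (λ y → split (adjacent? A x y) (m₁ x ≟ y) (m₁ x ≟ x) (m₁ y ≟ y)) ⟩
        ∑ V (λ y → ⟦ m₁ x ≟ y ⟧ + (⟦ residual? x y ⟧ + (⟦ adjacent? A x y ⟧ * fix₁ y + fix₁ x * ⟦ adjacent? A x y ⟧)))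
          ≡⟨ ∑-+ V _ _ ⨾ cong₂ _+_ one (∑-+ V _ _ ⨾ cong₂ _+_ (sym (degree-e₂ x)) (∑-+ V _ _
               ⨾ cong (∑ V (λ y → ⟦ adjacent? A x y ⟧ * fix₁ y) +_) (∑-*ˡ V (fix₁ x) _ ⨾ cong (fix₁ x *_) (adjacency-sum x)))) ⟩
        1 + (degree e₂ x + (∑ V (λ y → ⟦ adjacent? A x y ⟧ * fix₁ y) + fix₁ x * d)) ∎))
        where
        open ≤-Reasoning
        one : ∑ V (λ y → ⟦ m₁ x ≟ y ⟧) ≡ 1
        one = ∑-cong V (λ y → flip-eq y (m₁ x ≟ y) (y ≟ m₁ x)) ⨾ ∑-single (m₁ x)
          where
          flip-eq : ∀ y (p : Dec (m₁ x ≡ y)) (q : Dec (y ≡ m₁ x)) → ⟦ p ⟧ ≡ ⟦ q ⟧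
          flip-eq y p q = ≤-antisym (⟦⟧-mono p q sym) (⟦⟧-mono q p sym)
        split : ∀ {P Q S T : Set} (p : Dec P) (q : Dec Q) (s : Dec S) (t : Dec T) →
                ⟦ p ⟧ ≤ ⟦ q ⟧ + (⟦ p ×-dec ¬? q ×-dec ¬? s ×-dec ¬? t ⟧ + (⟦ p ⟧ * ⟦ t ⟧ + ⟦ s ⟧ * ⟦ p ⟧))
        split (no _)  _       _       _       = z≤n
        split (yes _) (yes _) _       _       = s≤s z≤n
        split (yes _) (no _)  (yes _) (yes _) = s≤s z≤n
        split (yes _) (no _)  (yes _) (no _)  = s≤s z≤n
        split (yes _) (no _)  (no _)  (yes _) = s≤s z≤n
        split (yes _) (no _)  (no _)  (no _)  = s≤s z≤n

      f₁ = fixedPoints m₁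

      -- Each fixed point of `m₁` accounts for a loss of `d` at its neighbours and of `d` at itself,
      -- and 2 d is at most 4 D.
      deficit-total : ∑ V (λ x → D ∸ degree e₂ x) ≤ D * (4 * f₁)
      deficit-total = begin
        ∑ V (λ x → D ∸ degree e₂ x)  ≤⟨ ∑-mono V deficit-at ⟩
        ∑ V (λ x → ∑ V (λ y → ⟦ adjacent? A x y ⟧ * fix₁ y) + fix₁ x * d)  ≡⟨ ∑-+ V _ _ ⨾ cong₂ _+_ (∑-swap V V _) (∑-*ʳ V d fix₁) ⟩
        ∑ V (λ y → ∑ V (λ x → ⟦ adjacent? A x y ⟧ * fix₁ y)) + f₁ * d  ≡⟨ cong (_+ f₁ * d) (∑-cong V (λ y → ∑-*ʳ V (fix₁ y) _ ⨾ cong (_* fix₁ y) (in-sum y) ⨾ *-comm d (fix₁ y)) ⨾ ∑-*ʳ V d fix₁) ⟩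
        f₁ * suc D + f₁ * suc D  ≤⟨ +-mono-≤ (*-monoʳ-≤ f₁ d≤) (*-monoʳ-≤ f₁ d≤) ⟩
        f₁ * (D + D) + f₁ * (D + D)  ≡⟨ four f₁ D ⟩
        D * (4 * f₁)  ∎
        where
        open ≤-Reasoning
        d≤ : suc D ≤ D + D
        d≤ = +-monoˡ-≤ D 0<D
        in-sum : ∀ y → ∑ V (λ x → ⟦ adjacent? A x y ⟧) ≡ d
        in-sum y = ∑-cong V (λ x → ⟦adjacent⟧ A x y ⨾ cong 𝟙 (symm x y)) ⨾ deg y
        four : ∀ f D → f * (D + D) + f * (D + D) ≡ D * (4 * f)
        four = solve-∀

      M₂ : NearMatching e₂ (4 * f₁)
      M₂ = near-matching e₂ D (4 * f₁) {{>-nonZero 0<D}}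
        (λ x y → does-⇔ (residual? x y) (residual? y x) residual-sym residual-sym)
        (λ {x} {y} p → proj₁ (true⇒ (residual? x y) p)) degree-e₂≤ deficit-total
      module M₂ = NearMatching M₂
      m₂ : Fin n → Fin n
      m₂ = M₂.partner

      m₂-residual : ∀ {x} → m₂ x ≢ x → Residual x (m₂ x)
      m₂-residual {x} mv = true⇒ (residual? x (m₂ x)) (M₂.edge mv)

      E : Fin n → Fin n → Set
      E x y = x ≢ y × (m₁ x ≡ y ⊎ m₂ x ≡ y)

      E? : ∀ x y → Dec (E x y)
      E? x y = ¬? (x ≟ y) ×-dec ((m₁ x ≟ y) ⊎-dec (m₂ x ≟ y))

      E-sym : ∀ {x y} → E x y → E y x
      E-sym {x} (x≢y , inj₁ refl) = (λ e → x≢y (sym e)) , inj₁ (M₁.involutive x)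
      E-sym {x} (x≢y , inj₂ refl) = (λ e → x≢y (sym e)) , inj₂ (M₂.involutive x)

      E-adj : ∀ {x y} → E x y → Adjacent A x y
      E-adj (x≢y , inj₁ refl) = m₁-adj (λ e → x≢y (sym e))
      E-adj (x≢y , inj₂ refl) = proj₁ (m₂-residual (λ e → x≢y (sym e)))

      E-deg : ∀ {x a b c} → E x a → E x b → E x c → a ≡ b ⊎ b ≡ c ⊎ a ≡ c
      E-deg (_ , inj₁ p) (_ , inj₁ q) _            = inj₁ (sym p ⨾ q)
      E-deg (_ , inj₂ p) (_ , inj₂ q) _            = inj₁ (sym p ⨾ q)
      E-deg (_ , inj₁ p) (_ , inj₂ _) (_ , inj₁ q) = inj₂ (inj₂ (sym p ⨾ q))
      E-deg (_ , inj₁ _) (_ , inj₂ p) (_ , inj₂ q) = inj₂ (inj₁ (sym p ⨾ q))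
      E-deg (_ , inj₂ _) (_ , inj₁ p) (_ , inj₁ q) = inj₂ (inj₁ (sym p ⨾ q))
      E-deg (_ , inj₂ p) (_ , inj₁ _) (_ , inj₂ q) = inj₂ (inj₂ (sym p ⨾ q))

      module C = Charging E E? E-sym E-adj E-deg
      f₂ = fixedPoints m₂
      bad fix₂ W : Fin n → ℕ
      bad x = ⟦ bad? R A x ⟧
      fix₂ x = ⟦ m₂ x ≟ x ⟧
      W x = (1 + g * fix₁ x + g * fix₂ x) + g * bad x

      W≥ : ∀ x → 1 + g * bad x ≤ W x
      W≥ x = +-monoˡ-≤ _ (s≤s z≤n)

      charge : ∀ l → l ∈ C.paths → g * 1 ≤ ∑ l W
      charge []      l∈ = ⊥-elim (All.lookup C.nonempty l∈ refl)
      charge (x ∷ r) l∈ = ≤-trans (≤-reflexive (*-identityʳ g)) (cases (m₁ x ≟ x) (m₂ x ≟ x))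
        where
        whole : ∀ {m} → m ≡ 1 → g * m ≤ W x → g ≤ ∑ (x ∷ r) W
        whole refl ≤W = ≤-trans (≤-reflexive (sym (*-identityʳ g))) (≤-trans ≤W (m≤m+n (W x) (∑ r W)))
        open-end : ∀ r → x ∷ r ∈ C.paths → m₁ x ≢ x → m₂ x ≢ x → g ≤ ∑ (x ∷ r) W
        open-end [] l∈ mv₁ mv₂ = C.charge-closed W W≥ l∈ ((λ e → mv₁ (sym e)) , inj₁ refl) λ ()
        open-end (z ∷ r) l∈ mv₁ mv₂ = by (m₁ x ≟ z) (m₂ x ≟ z)
          where
          by : Dec (m₁ x ≡ z) → Dec (m₂ x ≡ z) → g ≤ ∑ (x ∷ z ∷ r) W
          by (no ≢z) _ = C.charge-closed W W≥ l∈ ((λ e → mv₁ (sym e)) , inj₁ refl) ≢z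
          by (yes _) (no ≢z) = C.charge-closed W W≥ l∈ ((λ e → mv₂ (sym e)) , inj₂ refl) ≢z
          -- Both partners of `x` would be `z`, but the second matching avoids the edges of the
          -- first.
          by (yes p) (yes q) = ⊥-elim (proj₁ (proj₂ (m₂-residual mv₂)) (p ⨾ sym q))
        cases : Dec (m₁ x ≡ x) → Dec (m₂ x ≡ x) → g ≤ ∑ (x ∷ r) W
        cases (yes p)  _        = whole (⟦⟧-yes (m₁ x ≟ x) p) (≤-trans (n≤1+n _) (≤-trans (m≤m+n _ (g * fix₂ x)) (m≤m+n _ (g * bad x))))
        cases (no _)   (yes p)  = whole (⟦⟧-yes (m₂ x ≟ x) p) (≤-trans (m≤n+m _ (1 + g * fix₁ x)) (m≤m+n _ (g * bad x)))
        cases (no mv₁) (no mv₂) = open-end r l∈ mv₁ mv₂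

      open ≤-Reasoning

      f₁≤ : g * f₁ ≤ cost
      f₁≤ = ≤-trans M₁.fixed≤ (≤-reflexive (cong (λ u → g * u + g * u + cost) (n≤0⇒n≡0 M₁.U≤) ⨾ cong (λ u → u + u + cost) (*-zeroʳ g)))

      -- Up to 4 f₁ unmatched vertices, each entering twice, give 8 times `cost`; the odd cycles
      -- give one more.
      f₂≤ : g * f₂ ≤ 9 * cost
      f₂≤ = begin
        g * f₂  ≤⟨ M₂.fixed≤ ⟩
        g * M₂.U + g * M₂.U + cost  ≤⟨ +-monoˡ-≤ cost (+-mono-≤ (*-monoʳ-≤ g M₂.U≤) (*-monoʳ-≤ g M₂.U≤)) ⟩
        g * (4 * f₁) + g * (4 * f₁) + cost  ≡⟨ regroup g f₁ cost ⟩
        8 * (g * f₁) + cost  ≤⟨ +-monoˡ-≤ cost (*-monoʳ-≤ 8 f₁≤) ⟩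
        8 * cost + cost  ≡⟨ nine cost ⟩
        9 * cost  ∎
        where
        regroup : ∀ g f c → g * (4 * f) + g * (4 * f) + c ≡ 8 * (g * f) + c
        regroup = solve-∀
        nine : ∀ c → 8 * c + c ≡ 9 * c
        nine = solve-∀

      -- Heads fixed by `m₁` pay one `cost` and those fixed by `m₂` nine; the vertices of long
      -- cycles and the bad vertices together pay the eleventh.
      paths≤ : g * length C.paths ≤ 11 * cost
      paths≤ = begin
        g * length C.paths  ≡⟨ cong (g *_) (sym (∑-1 C.paths)) ⟩
        g * ∑ C.paths (λ _ → 1)  ≤⟨ C.charge-total W W≥ (λ _ → 1) charge ⟩
        ∑ V W  ≡⟨ ∑-+ V _ _ ⨾ cong₂ _+_ (∑-+ V _ _ ⨾ cong₂ _+_ (∑-+ V _ _ ⨾ cong₂ _+_ (∑-1 V ⨾ length-allFin n) (∑-*ˡ V g fix₁)) (∑-*ˡ V g fix₂)) (∑-*ˡ V g bad) ⟩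
        (n + g * f₁ + g * f₂) + g * ∑ V bad  ≤⟨ +-monoˡ-≤ _ (+-mono-≤ (+-monoʳ-≤ n f₁≤) f₂≤) ⟩
        (n + cost + 9 * cost) + g * ∑ V bad  ≡⟨ collect n (g * ∑ V bad) ⟩
        11 * cost  ∎
        where
        collect : ∀ n b → (n + (n + b) + 9 * (n + b)) + b ≡ 11 * (n + b)
        collect = solve-∀

      open Chunks {X = Fin n} g 0<g
      cut : List (Fin n) → List (List (Fin n))
      cut l = chunks (length l) l

      concat-cut : ∀ ls → concat (concat (map cut ls)) ≡ concat ls
      concat-cut []       = refl
      concat-cut (l ∷ ls) = sym (concat-++ (cut l) _) ⨾ cong₂ _++_ (concat-chunks (length l) l) (concat-cut ls)

      all-cut : ∀ {P Q : List (Fin n) → Set} (ls : List (List (Fin n))) → (∀ l → P l → All Q (cut l)) → All P ls → All Q (concat (map cut ls))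
      all-cut []       f []       = []
      all-cut (l ∷ ls) f (p ∷ ps) = AllP.++⁺ (f l p) (all-cut ls f ps)

    -- Cutting creates at most n / g additional pieces, which the twelfth `cost` covers.
    path-cover : PathCover A g (12 * cost)
    path-cover = record
      { paths = concat (map cut C.paths)
      ; linked = all-cut C.paths (λ l lk → chunks-linked (length l) l lk) (All.map (Linked.map E-adj) C.linked)
      ; short = all-cut C.paths (λ l _ → chunks-short (length l) l ≤-refl) C.nonempty
      ; covers = trans (↭-reflexive (concat-cut C.paths)) C.covers
      ; few = begin
          g * length (concat (map cut C.paths))           ≡⟨ cong (g *_) (sym (∑-1 (concat (map cut C.paths))) ⨾ ∑-concat (map cut C.paths) (λ _ → 1)
                          ⨾ ∑-map cut C.paths _ ⨾ ∑-cong C.paths (λ l → ∑-1 (cut l))) ⟩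
          g * ∑ C.paths (λ l → length (cut l))  ≡⟨ sym (∑-*ˡ C.paths g _) ⟩
          ∑ C.paths (λ l → g * length (cut l))  ≤⟨ ∑-mono C.paths (λ l → chunks-count (length l) l ≤-refl) ⟩
          ∑ C.paths (λ l → g + length l)  ≡⟨ ∑-+ C.paths _ _ ⨾ cong₂ _+_ (∑-const C.paths g ⨾ *-comm _ g) total-length ⟩
          g * length C.paths + n  ≤⟨ +-mono-≤ paths≤ (m≤m+n n _) ⟩
          11 * cost + cost  ≡⟨ twelve cost ⟩
          12 * cost  ∎
      }
      where
      twelve : ∀ c → 11 * c + c ≡ 12 * c
      twelve = solve-∀
      total-length : ∑ C.paths length ≡ n
      total-length = ∑-cong C.paths (λ l → sym (∑-1 l)) ⨾ sym (∑-concat C.paths (λ _ → 1)) ⨾ ∑-↭ (λ _ → 1) C.covers ⨾ ∑-1 V ⨾ length-allFin n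

-- Predecessors, successors and roots along the paths

module Ancestry where
  open TwoFactor public

  lastMaybe headMaybe : ∀ {a} {X : Set a} → List X → Maybe X
  lastMaybe []      = nothing
  lastMaybe (x ∷ l) = just (lastOf x l)
  headMaybe []      = nothing
  headMaybe (x ∷ _) = just x

  headOr : ∀ {a} {X : Set a} → X → List X → X
  headOr x []      = x
  headOr x (y ∷ _) = y

  nil? : ∀ {a} {X : Set a} (l : List X) → Dec (l ≡ [])
  nil? []      = yes refl
  nil? (_ ∷ _) = no λ ()

  split-unique : ∀ {a} {X : Set a} {x : X} p {s} p′ {s′} → Unique (p ++ x ∷ s) → p ++ x ∷ s ≡ p′ ++ x ∷ s′ → p ≡ p′ × s ≡ s′
  split-unique []      p′       u e with unique-head-pos u p′ e
  split-unique []      .[]      u refl | refl = refl , refl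
  split-unique (y ∷ p) []       (y∉ ∷ _) refl = ⊥-elim (All.lookup y∉ (∈-++⁺ʳ p (here refl)) refl)
  split-unique (y ∷ p) (z ∷ p′) (_ ∷ u) e with split-unique p p′ u (∷-injectiveʳ e)
  ... | refl , refl = cong (_∷ p) (∷-injectiveˡ e) , refl

  lastMaybe-∷ʳ : ∀ {a} {X : Set a} (l : List X) {b} → lastMaybe l ≡ just b → ∃[ p ] l ≡ p ∷ʳ b
  lastMaybe-∷ʳ (x ∷ [])    refl = [] , refl
  lastMaybe-∷ʳ (x ∷ y ∷ l) e with lastMaybe-∷ʳ (y ∷ l) e
  ... | p , q = x ∷ p , cong (x ∷_) q

  lastMaybe-of-∷ʳ : ∀ {a} {X : Set a} (p : List X) {b} → lastMaybe (p ∷ʳ b) ≡ just b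
  lastMaybe-of-∷ʳ []          = refl
  lastMaybe-of-∷ʳ (x ∷ [])    = refl
  lastMaybe-of-∷ʳ (x ∷ y ∷ p) = lastMaybe-of-∷ʳ (y ∷ p)

  headMaybe-∷ : ∀ {a} {X : Set a} (l : List X) {c} → headMaybe l ≡ just c → ∃[ s ] l ≡ c ∷ s
  headMaybe-∷ (x ∷ l) refl = l , refl

  -- Numbers with last digit `i` in base `g`: the leading part decides the comparison. This encodes
  -- lexicographic orders in a single rank.
  digits-< : ∀ {a b i j g} → a < b → i < g → a * g + i < b * g + j
  digits-< {a} {b} {i} {j} {g} a<b i<g = begin-strict
    a * g + i  <⟨ +-monoʳ-< (a * g) i<g ⟩
    a * g + g  ≡⟨ +-comm (a * g) g ⟩
    suc a * g  ≤⟨ *-monoˡ-≤ g a<b ⟩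
    b * g  ≤⟨ m≤m+n (b * g) j ⟩
    b * g + j  ∎
    where open ≤-Reasoning

  digits-injective : ∀ {a b i j g} → i < g → j < g → a * g + i ≡ b * g + j → i ≡ j
  digits-injective {a} {b} {i} {j} {g} i< j< e with <-cmp a b
  ... | tri< a<b _ _ = ⊥-elim (<⇒≢ (digits-< a<b i<) e)
  ... | tri> _ _ b<a = ⊥-elim (<⇒≢ (digits-< b<a j<) (sym e))
  ... | tri≈ _ refl _ = +-cancelˡ-≡ (a * g) i j e

  nonbacktracking-unique : ∀ {n} {l : List (Fin n)} → Unique l → NonBacktracking l
  nonbacktracking-unique {l = []}            _ = _
  nonbacktracking-unique {l = _ ∷ []}        _ = _
  nonbacktracking-unique {l = _ ∷ _ ∷ []}    _ = _
  nonbacktracking-unique {l = x ∷ y ∷ z ∷ l} ((_ ∷ x≢z ∷ _) ∷ u) = x≢z , nonbacktracking-unique u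

  module Ancestors {n g c : ℕ} {A : Adj n} (P : PathCover A g c) where
    open PathCover P

    private
      V = allFin n

      unique-all : Unique (concat paths)
      unique-all = unique-↭ (↭-sym covers) (allFin⁺ n)

      record Place (x : Fin n) : Set where
        constructor place
        field
          path   : List (Fin n)
          path∈  : path ∈ paths
          before : List (Fin n)
          after  : List (Fin n)
          split  : path ≡ before ++ x ∷ after

      abstract
        place-of : ∀ x → Place x
        place-of x with ∈-concat⁻′ paths (∈-resp-↭ (↭-sym covers) (∈-allFin x))
        ... | l , x∈ , l∈ with ∈-∃++ x∈
        ...   | p , s , e = place l l∈ p s e

    anc desc : Fin n → List (Fin n)
    anc x  = Place.before (place-of x)
    desc x = Place.after (place-of x)

    root : Fin n → Fin n
    root x = headOr x (anc x)

    index : Fin n → ℕ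
    index x = length (anc x)

    prev next : Fin n → Maybe (Fin n)
    prev x = lastMaybe (anc x)
    next x = headMaybe (desc x)

    path∈ : ∀ x → anc x ++ x ∷ desc x ∈ paths
    path∈ x = subst (_∈ paths) (Place.split (place-of x)) (Place.path∈ (place-of x))

    path-unique : ∀ x → Unique (anc x ++ x ∷ desc x)
    path-unique x = unique-concat-part unique-all (path∈ x)

    path-linked : ∀ x → Linked (Adjacent A) (anc x ++ x ∷ desc x)
    path-linked x = All.lookup linked (path∈ x)

    -- Paths are disjoint and free of repetitions, so every splitting of a path at `x` is the chosen
    -- one.
    located : ∀ {x} p s → p ++ x ∷ s ∈ paths → anc x ≡ p × desc x ≡ s
    located {x} p s l∈ = split-unique (anc x) p (path-unique x)
      (unique-concat-same unique-all (path∈ x) l∈ (∈-++⁺ʳ (anc x) (here refl)) (∈-++⁺ʳ p (here refl)))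

    index< : ∀ x → index x < g
    index< x = begin-strict
      length (anc x)  <⟨ m<m+n (length (anc x)) (s≤s z≤n) ⟩
      length (anc x) + length (x ∷ desc x)  ≡⟨ sym (length-++ (anc x)) ⟩
      length (anc x ++ x ∷ desc x)  ≤⟨ All.lookup short (path∈ x) ⟩
      g  ∎
      where open ≤-Reasoning

    prev-step : ∀ {x b} → prev x ≡ just b → anc x ≡ anc b ∷ʳ b × desc b ≡ x ∷ desc x
    prev-step {x} {b} e with lastMaybe-∷ʳ (anc x) e
    ... | p , q with located p (x ∷ desc x) (subst (_∈ paths) (cong (_++ x ∷ desc x) q ⨾ ++-assoc p (b ∷ []) (x ∷ desc x)) (path∈ x))
    ...   | a , d = (q ⨾ cong (_∷ʳ b) (sym a)) , d

    next-step : ∀ {x c} → next x ≡ just c → prev c ≡ just x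
    next-step {x} {c} e with headMaybe-∷ (desc x) e
    ... | s , q = cong lastMaybe (proj₁ (located (anc x ∷ʳ x) s
        (subst (_∈ paths) (cong (λ d → anc x ++ x ∷ d) q ⨾ sym (++-assoc (anc x) (x ∷ []) (c ∷ s))) (path∈ x)))) ⨾ lastMaybe-of-∷ʳ (anc x)

    prev⇒next : ∀ {x b} → prev x ≡ just b → next b ≡ just x
    prev⇒next e = cong headMaybe (proj₂ (prev-step e))

    prev-injective : ∀ {x y b} → prev x ≡ just b → prev y ≡ just b → x ≡ y
    prev-injective e f = just-injective (sym (prev⇒next e) ⨾ prev⇒next f)

    prev-root : ∀ {x b} → prev x ≡ just b → root x ≡ root b
    prev-root {x} {b} e = cong (headOr x) (proj₁ (prev-step e)) ⨾ lem (anc b)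
      where
      lem : ∀ p → headOr x (p ∷ʳ b) ≡ headOr b p
      lem []      = refl
      lem (_ ∷ _) = refl

    prev-index : ∀ {x b} → prev x ≡ just b → index x ≡ suc (index b)
    prev-index {x} {b} e = cong length (proj₁ (prev-step e)) ⨾ length-++ (anc b) ⨾ +-comm _ 1

    prev-adjacent : ∀ {x b} → prev x ≡ just b → Adjacent A b x
    prev-adjacent {x} {b} e with linked-drop (anc b) (path-linked b)
    ... | l rewrite proj₂ (prev-step e) with l
    ...   | r ∷ _ = r

    prev≢next : ∀ {x b} → prev x ≡ just b → next x ≢ just b
    prev≢next {x} {b} e f with headMaybe-∷ (desc x) f | proj₁ (proj₂ (unique-++⁻ (anc b) (path-unique b)))
    ... | s , q | u rewrite proj₂ (prev-step e) | q with u
    ...   | (_ ∷ b≢b ∷ _) ∷ _ = b≢b refl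

    up : ∀ x → Linked (Adjacent A) (anc x ++ x ∷ []) × Unique (anc x ++ x ∷ [])
    up x = linked-take (anc x ++ x ∷ []) (subst (Linked (Adjacent A)) e (path-linked x))
         , proj₁ (unique-++⁻ (anc x ++ x ∷ []) (subst Unique e (path-unique x)))
      where
      e : anc x ++ x ∷ desc x ≡ (anc x ++ x ∷ []) ++ desc x
      e = sym (++-assoc (anc x) (x ∷ []) (desc x))

    rootless childless : Fin n → ℕ
    rootless x  = ⟦ nil? (anc x) ⟧
    childless x = ⟦ nil? (desc x) ⟧

    private
      per-path : (f : Fin n → List (Fin n)) → (∀ {l x y} → l ∈ paths → x ∈ l → y ∈ l → f x ≡ [] → f y ≡ [] → x ≡ y) →
                 ∑ V (λ x → ⟦ nil? (f x) ⟧) ≤ length paths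
      per-path f h = begin
        ∑ V (λ x → ⟦ nil? (f x) ⟧)  ≡⟨ sym (∑-↭ (λ x → ⟦ nil? (f x) ⟧) covers) ⟩
        ∑ (concat paths) (λ x → ⟦ nil? (f x) ⟧)  ≡⟨ ∑-concat paths (λ x → ⟦ nil? (f x) ⟧) ⟩
        ∑ paths (λ l → ∑ l (λ x → ⟦ nil? (f x) ⟧))  ≤⟨ ∑-bound paths (λ l l∈ → at-most l (unique-concat-part unique-all l∈) (λ x∈ y∈ → h l∈ x∈ y∈)) ⟩
        length paths * 1  ≡⟨ *-identityʳ (length paths) ⟩
        length paths  ∎
        where
        open ≤-Reasoning
        at-most : ∀ l → Unique l → (∀ {x y} → x ∈ l → y ∈ l → f x ≡ [] → f y ≡ [] → x ≡ y) → ∑ l (λ x → ⟦ nil? (f x) ⟧) ≤ 1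
        at-most []      _        _ = z≤n
        at-most (x ∷ l) (x∉ ∷ u) h = cases (nil? (f x))
          where
          cases : (d : Dec (f x ≡ [])) → ⟦ d ⟧ + ∑ l (λ y → ⟦ nil? (f y) ⟧) ≤ 1
          cases (no _)  = at-most l u (λ p q → h (there p) (there q))
          cases (yes e) = ≤-reflexive (cong suc (∑-cong-∈ l (λ y y∈ → ⟦⟧-no (nil? (f y))
                            (λ e′ → All.lookup x∉ y∈ (h (here refl) (there y∈) e e′))) ⨾ ∑-zero l))

      same-path : ∀ {l x} → l ∈ paths → x ∈ l → l ≡ anc x ++ x ∷ desc x
      same-path {x = x} l∈ x∈ = unique-concat-same unique-all l∈ (path∈ x) x∈ (∈-++⁺ʳ (anc x) (here refl))

    rootless-count : ∑ V rootless ≤ length paths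
    rootless-count = per-path anc same
      where
      same : ∀ {l x y} → l ∈ paths → x ∈ l → y ∈ l → anc x ≡ [] → anc y ≡ [] → x ≡ y
      same {x = x} {y} l∈ x∈ y∈ ex ey = ∷-injectiveˡ (cong (_++ x ∷ desc x) (sym ex) ⨾ sym (same-path l∈ x∈) ⨾ same-path l∈ y∈ ⨾ cong (_++ y ∷ desc y) ey)

    childless-count : ∑ V childless ≤ length paths
    childless-count = per-path desc same
      where
      same : ∀ {l x y} → l ∈ paths → x ∈ l → y ∈ l → desc x ≡ [] → desc y ≡ [] → x ≡ y
      same {x = x} {y} l∈ x∈ y∈ ex ey = proj₂ (∷ʳ-injective (anc x) (anc y)
        (cong (λ d → anc x ++ x ∷ d) (sym ex) ⨾ sym (same-path l∈ x∈) ⨾ same-path l∈ y∈ ⨾ cong (λ d → anc y ++ y ∷ d) ey))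

-- Averaging over independent uniform labels

module Averaging where
  open Ancestry public

  labelings : (n K : ℕ) → List (Vec (Fin K) n)
  labelings n K = allVecs n (allFin K)

  ∑-labelings-suc : ∀ n K (F : Vec (Fin K) (suc n) → ℕ) →
                    ∑ (labelings (suc n) K) F ≡ ∑ (allFin K) (λ x → ∑ (labelings n K) (λ w → F (x ∷ᵥ w)))
  ∑-labelings-suc n K F = ∑-concat (map (λ x → map (x ∷ᵥ_) (labelings n K)) (allFin K)) F ⨾ ∑-map _ (allFin K) _
    ⨾ ∑-cong (allFin K) (λ x → ∑-map (x ∷ᵥ_) (labelings n K) F)

  -- Every labelling arises `K` times, once for each old value at the overwritten position.
  resample-one : ∀ {n} K (c : Fin n) (F : Vec (Fin K) n → ℕ) →
                 ∑ (labelings n K) (λ w → ∑ (allFin K) (λ x → F (w [ c ]≔ x))) ≡ K * ∑ (labelings n K) F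
  resample-one {suc n} K zero F = ∑-labelings-suc n K _ ⨾ ∑-const (allFin K) _
    ⨾ cong₂ _*_ (length-allFin K) (∑-swap (labelings n K) (allFin K) _ ⨾ sym (∑-labelings-suc n K F))
  resample-one {suc n} K (suc c) F = ∑-labelings-suc n K _ ⨾ ∑-cong (allFin K) (λ y → resample-one K c (λ w → F (y ∷ᵥ w)))
    ⨾ ∑-*ˡ (allFin K) K _ ⨾ cong (K *_) (sym (∑-labelings-suc n K F))

  module _ {n K : ℕ} where
    private
      Labeling = Vec (Fin K) n
      Ω = labelings n K
      X = allFin K

    label : Labeling → Fin n → ℕ
    label w c = toℕ (lookup w c)

    -- An unnormalised conditional expectation: the labels at `cs` are drawn anew while the others
    -- stay as in `w`.
    resample : List (Fin n) → (Labeling → ℕ) → Labeling → ℕ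
    resample []       F w = F w
    resample (c ∷ cs) F w = ∑ X (λ x → resample cs F (w [ c ]≔ x))

    ∑-resample : ∀ cs F → ∑ Ω (resample cs F) ≡ K ^ length cs * ∑ Ω F
    ∑-resample []       F = sym (*-identityˡ _)
    ∑-resample (c ∷ cs) F = resample-one K c (resample cs F) ⨾ cong (K *_) (∑-resample cs F) ⨾ sym (*-assoc K _ _)

    resample-mono : ∀ cs {F G : Labeling → ℕ} → (∀ w → F w ≤ G w) → ∀ w → resample cs F w ≤ resample cs G w
    resample-mono []       h w = h w
    resample-mono (c ∷ cs) h w = ∑-mono X (λ x → resample-mono cs h (w [ c ]≔ x))

    resample-mono-at : ∀ cs {F G : Labeling → ℕ} c₀ k → c₀ ∉ cs → (∀ w → label w c₀ ≡ k → F w ≤ G w) →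
                       ∀ w → label w c₀ ≡ k → resample cs F w ≤ resample cs G w
    resample-mono-at []       c₀ k c₀∉ h w e = h w e
    resample-mono-at (c ∷ cs) c₀ k c₀∉ h w e = ∑-mono X (λ x → resample-mono-at cs c₀ k (λ i → c₀∉ (there i)) h (w [ c ]≔ x)
      (cong toℕ (lookup∘update′ (λ e → c₀∉ (here e)) w x) ⨾ e))

    resample-++ : ∀ cs ds F w → resample (cs ++ ds) F w ≡ resample cs (resample ds F) w
    resample-++ []       ds F w = refl
    resample-++ (c ∷ cs) ds F w = ∑-cong X (λ x → resample-++ cs ds F (w [ c ]≔ x))

    Invariant : List (Fin n) → (Labeling → ℕ) → Set
    Invariant cs F = ∀ c → c ∈ cs → ∀ w x → F (w [ c ]≔ x) ≡ F w

    -- A factor that does not read the redrawn labels is a constant for the conditional expectation.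
    resample-factor : ∀ cs {F H : Labeling → ℕ} → Invariant cs F → ∀ w → resample cs (λ w → F w * H w) w ≡ F w * resample cs H w
    resample-factor []       inv w = refl
    resample-factor (c ∷ cs) {F} {H} inv w = ∑-cong X (λ x → resample-factor cs (λ c c∈ → inv c (there c∈)) (w [ c ]≔ x)
      ⨾ cong (_* resample cs H (w [ c ]≔ x)) (inv c (here refl) w x)) ⨾ ∑-*ˡ X (F w) _

    resample-const : ∀ cs a w → resample cs (λ _ → a) w ≡ K ^ length cs * a
    resample-const []       a w = sym (*-identityˡ a)
    resample-const (c ∷ cs) a w = ∑-cong X (λ x → resample-const cs a _) ⨾ ∑-const X _
      ⨾ cong (_* (K ^ length cs * a)) (length-allFin K) ⨾ sym (*-assoc K _ a)

    resample-+ : ∀ cs F G w → resample cs (λ w → F w + G w) w ≡ resample cs F w + resample cs G w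
    resample-+ []       F G w = refl
    resample-+ (c ∷ cs) F G w = ∑-cong X (λ x → resample-+ cs F G (w [ c ]≔ x)) ⨾ ∑-+ X _ _

    below : ℕ → List (Fin n) → Labeling → ℕ
    below k []      w = 1
    below k (c ∷ C) w = ⟦ label w c <? k ⟧ * below k C w

    below-≤1 : ∀ k C w → below k C w ≤ 1
    below-≤1 k []      w = ≤-refl
    below-≤1 k (c ∷ C) w = *-mono-≤ (⟦⟧-≤1 (label w c <? k)) (below-≤1 k C w)

    below-all : ∀ k C w → below k C w ≢ 0 → All (λ c → label w c < k) C
    below-all k []      w h = []
    below-all k (c ∷ C) w h = ⟦⟧-≢0 (label w c <? k) (λ e → h (cong (_* below k C w) e))
      ∷ below-all k C w (λ e → h (cong (⟦ label w c <? k ⟧ *_) e ⨾ *-zeroʳ ⟦ label w c <? k ⟧))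

    label-invariant : ∀ {c cs} k → c ∉ cs → Invariant cs (λ w → ⟦ label w c <? k ⟧)
    label-invariant {c} k c∉ c′ c′∈ w x = cong (λ y → ⟦ toℕ y <? k ⟧) (lookup∘update′ (λ e → c∉ (subst (_∈ _) (sym e) c′∈)) w x)

    below-invariant : ∀ k C {cs} → (∀ {c} → c ∈ C → c ∉ cs) → Invariant cs (below k C)
    below-invariant k []      h c c∈ w x = refl
    below-invariant k (c₀ ∷ C) h c c∈ w x = cong₂ _*_ (label-invariant k (h (here refl)) c c∈ w x)
      (below-invariant k C (λ i → h (there i)) c c∈ w x)

    small-labels : ∀ {k} → k ≤ K → k ≤ ∑ X (λ x → ⟦ toℕ x <? k ⟧)
    small-labels {k} k≤K = ≤-trans (≤-trans (≤-reflexive (sym (all-below k ≤-refl))) (extend k≤K)) (≤-reflexive (sym (∑-toℕ K (λ j → ⟦ j <? k ⟧))))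
      where
      all-below : ∀ j → j ≤ k → ∑< j (λ i → ⟦ i <? k ⟧) ≡ j
      all-below zero    _   = refl
      all-below (suc j) j<k = cong₂ _+_ (all-below j (<⇒≤ j<k)) (⟦⟧-yes (j <? k) j<k) ⨾ +-comm j 1
      extend : ∀ {j} → k ≤ j → ∑< k (λ i → ⟦ i <? k ⟧) ≤ ∑< j (λ i → ⟦ i <? k ⟧)
      extend {zero}  z≤n = z≤n
      extend {suc j} k≤ with m≤n⇒m<n∨m≡n k≤
      ... | inj₁ (s≤s k≤j) = ≤-trans (extend k≤j) (m≤m+n _ _)
      ... | inj₂ refl      = ≤-refl

    resample-below : ∀ {k} C → k ≤ K → Unique C → ∀ w → k ^ length C ≤ resample C (below k C) w
    resample-below []      _   _        w = ≤-refl
    resample-below {k} (c ∷ C) k≤K (c∉ ∷ u) w = begin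
      k * k ^ length C  ≤⟨ *-monoˡ-≤ (k ^ length C) (small-labels k≤K) ⟩
      ∑ X (λ x → ⟦ toℕ x <? k ⟧) * k ^ length C  ≡⟨ sym (∑-*ʳ X (k ^ length C) _) ⟩
      ∑ X (λ x → ⟦ toℕ x <? k ⟧ * k ^ length C)  ≤⟨ ∑-mono X (λ x → *-monoʳ-≤ ⟦ toℕ x <? k ⟧ (resample-below C k≤K u (w [ c ]≔ x))) ⟩
      ∑ X (λ x → ⟦ toℕ x <? k ⟧ * resample C (below k C) (w [ c ]≔ x))      ≡⟨ ∑-cong X (λ x → cong (λ y → ⟦ toℕ y <? k ⟧ * resample C (below k C) (w [ c ]≔ x)) (sym (lookup∘update c w x))
                          ⨾ sym (resample-factor C (label-invariant k (λ c∈ → All.lookup c∉ c∈ refl)) (w [ c ]≔ x))) ⟩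
      ∑ X (λ x → resample C (below k (c ∷ C)) (w [ c ]≔ x))  ∎
      where open ≤-Reasoning

    missed : ℕ → List (Fin n) → Labeling → ℕ
    missed k C w = 1 ∸ below k C w

    resample-missed : ∀ {k} C → k ≤ K → Unique C → ∀ w → resample C (missed k C) w ≤ K ^ length C ∸ k ^ length C
    resample-missed {k} C k≤K u w = m+n≤o⇒m≤o∸n (resample C (missed k C) w) (begin
      resample C (missed k C) w + k ^ length C  ≤⟨ +-monoʳ-≤ _ (resample-below C k≤K u w) ⟩
      resample C (missed k C) w + resample C (below k C) w  ≡⟨ sym (resample-+ C _ _ w) ⟩
      resample C (λ w → missed k C w + below k C w) w  ≤⟨ resample-mono C (λ w → ≤-reflexive (m∸n+n≡m (below-≤1 k C w))) w ⟩
      resample C (λ _ → 1) w  ≡⟨ resample-const C 1 w ⨾ *-identityʳ _ ⟩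
      K ^ length C  ∎)
      where open ≤-Reasoning

    allMissed : ℕ → List (List (Fin n)) → Labeling → ℕ
    allMissed k []       w = 1
    allMissed k (C ∷ Cs) w = missed k C w * allMissed k Cs w

    -- Disjoint groups are independent: the factor of one group is invariant while the others are
    -- redrawn.
    resample-allMissed : ∀ {k m} Cs → k ≤ K → Unique (concat Cs) → All (λ C → length C ≡ m) Cs → ∀ w →
                         resample (concat Cs) (allMissed k Cs) w ≤ (K ^ m ∸ k ^ m) ^ length Cs
    resample-allMissed []       _   _ _          w = ≤-refl
    resample-allMissed {k} {m} (C ∷ Cs) k≤K u (refl ∷ ls) w with unique-++⁻ C u
    ... | uC , us , disj = begin
      resample (C ++ concat Cs) (allMissed k (C ∷ Cs)) w  ≡⟨ resample-++ C (concat Cs) _ w ⟩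
      resample C (resample (concat Cs) (allMissed k (C ∷ Cs))) w                 ≤⟨ resample-mono C (λ w → ≤-trans (≤-reflexive (resample-factor (concat Cs) missed-inv w))
                          (*-monoʳ-≤ (missed k C w) (resample-allMissed Cs k≤K us ls w))) w ⟩
      resample C (λ w → missed k C w * M ^ length Cs) w  ≤⟨ resample-mono C (λ w → ≤-reflexive (*-comm (missed k C w) _)) w ⟩
      resample C (λ w → M ^ length Cs * missed k C w) w  ≡⟨ resample-factor C {λ _ → M ^ length Cs} {missed k C} (λ _ _ _ _ → refl) w ⟩
      M ^ length Cs * resample C (missed k C) w  ≤⟨ *-monoʳ-≤ (M ^ length Cs) (resample-missed C k≤K uC w) ⟩
      M ^ length Cs * M  ≡⟨ *-comm (M ^ length Cs) M ⟩
      M ^ suc (length Cs)  ∎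
      where
      open ≤-Reasoning
      M = K ^ length C ∸ k ^ length C
      missed-inv : Invariant (concat Cs) (missed k C)
      missed-inv c c∈ w x = cong (1 ∸_) (below-invariant k C (λ i j → disj i j) c c∈ w x)

    -- Conditions on the label x of `c₀`: each group fails to lie entirely below x with probability
    -- 1 - (x / K)^m, independently of the others. Summing over x produces the Riemann sum. Ties
    -- count as failures.
    average : ∀ {m} c₀ Cs (F : Labeling → ℕ) → Unique (c₀ ∷ concat Cs) → All (λ C → length C ≡ m) Cs → (∀ w → F w ≤ 1) →
              (∀ w → F w ≢ 0 → ∀ C → C ∈ Cs → ¬ All (λ c → label w c < label w c₀) C) →
              K ^ suc (length (concat Cs)) * ∑ Ω F ≤ length Ω * riemannSum m K (length Cs)
    average {m} c₀ Cs F (c₀∉ ∷ u) ls F≤1 F≢0 = begin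
      K ^ suc (length (concat Cs)) * ∑ Ω F  ≡⟨ sym (∑-resample (c₀ ∷ concat Cs) F) ⟩
      ∑ Ω (resample (c₀ ∷ concat Cs) F)  ≤⟨ ∑-bound Ω (λ w _ → inner w) ⟩
      length Ω * riemannSum m K (length Cs)  ∎
      where
      open ≤-Reasoning
      dominated : ∀ k Cs w → (∀ C → C ∈ Cs → ¬ All (λ c → label w c < k) C) → allMissed k Cs w ≡ 1
      dominated k []       w h = refl
      dominated k (C ∷ Cs) w h = cong₂ _*_ (one (below k C w) refl) (dominated k Cs w (λ C C∈ → h C (there C∈)))
        where
        one : ∀ b → below k C w ≡ b → 1 ∸ below k C w ≡ 1
        one zero    e = cong (1 ∸_) e
        one (suc b) e = ⊥-elim (h C (here refl) (below-all k C w (λ e′ → case sym e ⨾ e′ of λ ())))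
      F≤ : ∀ w → F w ≤ allMissed (label w c₀) Cs w
      F≤ w = of (F w) refl
        where
        of : ∀ f → F w ≡ f → F w ≤ allMissed (label w c₀) Cs w
        of zero    e = ≤-trans (≤-reflexive e) z≤n
        of (suc f) e = ≤-trans (F≤1 w) (≤-reflexive (sym (dominated (label w c₀) Cs w (F≢0 w (λ e′ → case sym e ⨾ e′ of λ ())))))
      inner : ∀ w → resample (c₀ ∷ concat Cs) F w ≤ riemannSum m K (length Cs)
      inner w = begin
        ∑ X (λ x → resample (concat Cs) F (w [ c₀ ]≔ x))                       ≤⟨ ∑-mono X (λ x → resample-mono-at (concat Cs) c₀ (toℕ x) (λ i → All.lookup c₀∉ i refl)
                          (λ w e → subst (λ k → F w ≤ allMissed k Cs w) e (F≤ w)) (w [ c₀ ]≔ x) (cong toℕ (lookup∘update c₀ w x))) ⟩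
        ∑ X (λ x → resample (concat Cs) (allMissed (toℕ x) Cs) (w [ c₀ ]≔ x))  ≤⟨ ∑-mono X (λ x → resample-allMissed Cs (<⇒≤ (toℕ<n x)) u ls (w [ c₀ ]≔ x)) ⟩
        ∑ X (λ x → (K ^ m ∸ toℕ x ^ m) ^ length Cs)  ≡⟨ ∑-toℕ K (λ k → (K ^ m ∸ k ^ m) ^ length Cs) ⟩
        riemannSum m K (length Cs)  ∎

-- Failure probability of a hub

module Planning where
  open Averaging public

  length-filter : ∀ {a p} {X : Set a} {P : X → Set p} (P? : ∀ x → Dec (P x)) (xs : List X) → length (filter P? xs) ≡ ∑ xs (λ x → ⟦ P? x ⟧)
  length-filter P? xs = sym (∑-filter xs P? ⨾ ∑-cong-∈ (filter P? xs) (λ x x∈ → ⟦⟧-yes (P? x) (proj₂ (∈-filter⁻ P? {xs = xs} x∈))) ⨾ ∑-1 (filter P? xs))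

  unique-concat-map : ∀ {a b} {X : Set a} {Y : Set b} (f : X → List Y) (ws : List X) → Unique ws → (∀ {u} → u ∈ ws → Unique (f u)) →
                      (∀ {u u′ y} → u ∈ ws → u′ ∈ ws → y ∈ f u → y ∈ f u′ → u ≡ u′) → Unique (concat (map f ws))
  unique-concat-map f []       _        _  _    = []
  unique-concat-map f (w ∷ ws) (w∉ ∷ u) uf disj =
    Unique.++⁺ (uf (here refl)) (unique-concat-map f ws u (λ i → uf (there i)) (λ i j → disj (there i) (there j))) apart
    where
    apart : ∀ {y} → y ∈ f w × y ∈ concat (map f ws) → ⊥
    apart (y∈ , y∈′) with ∈-concat⁻′ (map f ws) y∈′
    ... | l , y∈l , l∈ with ∈-map⁻ f l∈
    ...   | u′ , u′∈ , refl = All.lookup w∉ u′∈ (disj (here refl) (there u′∈) y∈ y∈l)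

  -- What follows the first entry of `p ++ x ∷ r`, so that a walk from a root can be written with
  -- its starting vertex in front.
  tailFrom : ∀ {a} {X : Set a} → List X → X → List X → List X
  tailFrom []      x r = r
  tailFrom (_ ∷ p) x r = p ++ x ∷ r

  headOr-tailFrom : ∀ {a} {X : Set a} (p : List X) x r → p ++ x ∷ r ≡ headOr x p ∷ tailFrom p x r
  headOr-tailFrom []      x r = refl
  headOr-tailFrom (_ ∷ p) x r = refl

  length-tailFrom : ∀ {a} {X : Set a} (p : List X) x r → length (tailFrom p x r) ≡ length p + length r
  length-tailFrom []      x r = refl
  length-tailFrom (_ ∷ p) x r = length-++ p ⨾ +-suc (length p) (length r)

  lastOf-++ : ∀ {a} {X : Set a} (y : X) p x r → lastOf y (p ++ x ∷ r) ≡ lastOf x r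
  lastOf-++ y []      x r = refl
  lastOf-++ y (z ∷ p) x r = lastOf-++ z p x r

  lastOf-tailFrom : ∀ {a} {X : Set a} (p : List X) x r → lastOf (headOr x p) (tailFrom p x r) ≡ lastOf x r
  lastOf-tailFrom []      x r = refl
  lastOf-tailFrom (y ∷ p) x r = lastOf-++ y p x r

  linked-join : ∀ {a r} {X : Set a} {R : X → X → Set r} p {x s} → Linked R (p ++ x ∷ []) → Linked R (x ∷ s) → Linked R (p ++ x ∷ s)
  linked-join []          _       l′ = l′
  linked-join (y ∷ [])    (r ∷ _) l′ = r ∷ l′
  linked-join (y ∷ z ∷ p) (r ∷ l) l′ = r ∷ linked-join (z ∷ p) l l′

  nonbacktracking-join : ∀ {n} (p : List (Fin n)) {x u v} → NonBacktracking (p ++ x ∷ []) → x ≢ v → lastMaybe p ≢ just u →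
                         NonBacktracking (p ++ x ∷ u ∷ v ∷ [])
  nonbacktracking-join []              _  x≢v _  = x≢v , _
  nonbacktracking-join (y ∷ [])        _  x≢v ≢u = (λ e → ≢u (cong just e)) , x≢v , _
  nonbacktracking-join (y ∷ z ∷ [])    nb x≢v ≢u = proj₁ nb , nonbacktracking-join (z ∷ []) _ x≢v ≢u
  nonbacktracking-join (y ∷ z ∷ q ∷ p) nb x≢v ≢u = proj₁ nb , nonbacktracking-join (z ∷ q ∷ p) (proj₂ nb) x≢v ≢u

  module Plans {n m g R c K : ℕ} {A : Adj n} (reg : Regular (suc (suc m)) A) (P : PathCover A g c) (R≥ : g + g + 2 ≤ R) where
    open Regular reg
    open Ancestors P

    private
      V = allFin n
      d : ℕ
      d = suc (suc m)

      prev-≢ : ∀ {x b} → prev x ≡ just b → b ≢ x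
      prev-≢ e refl = ¬loop (prev-adjacent e)

    module _ (w : Vec (Fin K) n) where
      -- Paths with smaller labels come later, and index x < g.
      key rank : Fin n → ℕ
      key x  = (K ∸ label w (root x)) * g + index x
      rank x = key x * n + toℕ x

      rank-< : ∀ {v x} → key v < key x → rank v < rank x
      rank-< {v} {x} k< = digits-< {key v} {key x} {toℕ v} {toℕ x} {n} k< (toℕ<n v)

      key-label : ∀ {v x} → label w (root x) < label w (root v) → key v < key x
      key-label {v} {x} l< = digits-< {i = index v} {j = index x} {g = g} (∸-monoʳ-< l< (<⇒≤ (toℕ<n (lookup w (root v))))) (index< v)

      key-index : ∀ {v x} → root x ≡ root v → index v < index x → key v < key x
      key-index {v} {x} e i< rewrite e = +-monoʳ-< ((K ∸ label w (root v)) * g) i<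

      Candidate : Fin n → Fin n → Fin n → Set
      Candidate b v u = Adjacent A v u × b ≢ u × ¬ Adjacent A b u × (∀ x → Adjacent A u x → x ≢ v → rank v < rank x)

      candidate? : ∀ b v u → Dec (Candidate b v u)
      candidate? b v u = adjacent? A v u ×-dec ¬? (b ≟ u) ×-dec ¬? (adjacent? A b u)
                         ×-dec all? (λ x → adjacent? A u x →-dec (¬? (x ≟ v) →-dec (rank v <? rank x)))

      chosen : ∀ {Q : Fin n → Set} → Dec (∃ Q) → Maybe (Fin n)
      chosen (yes (u , _)) = just u
      chosen (no _)        = nothing

      pick : Maybe (Fin n) → Fin n → Maybe (Fin n)
      pick nothing  v = nothing
      pick (just b) v = chosen (any? (candidate? b v))

      target : Fin n → Maybe (Fin n)
      target v = pick (prev v) v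

      chosen-just : ∀ {Q : Fin n → Set} (q : Dec (∃ Q)) {u} → chosen q ≡ just u → Q u
      chosen-just (yes (_ , q)) refl = q

      chosen-nothing : ∀ {Q : Fin n → Set} (q : Dec (∃ Q)) → chosen q ≡ nothing → ¬ ∃ Q
      chosen-nothing (no ¬q) _ = ¬q

      pick-just : ∀ p v {u} → pick p v ≡ just u → ∃[ b ] (p ≡ just b × Candidate b v u)
      pick-just (just b) v e = b , refl , chosen-just (any? (candidate? b v)) e

      plan : HopPlan A
      plan = record
        { adj-sym = adj-sym ; rank = rank
        ; rank-inj = λ {x} {y} e → toℕ-injective (digits-injective {key x} {key y} {toℕ x} {toℕ y} {n} (toℕ<n x) (toℕ<n y) e)
        ; bound = suc (∑ V rank) ; rank< = λ x → s≤s (∈⇒≤∑ rank (∈-allFin x))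
        ; prev = prev ; prev-inj = prev-injective ; target = target ; target-ok = λ {v} {u} e → ok v u (pick-just (prev v) v e) }
        where
        ok : ∀ v u → ∃[ b ] (prev v ≡ just b × Candidate b v u) →
             ∃[ b ] (prev v ≡ just b × rank b < rank v × Adjacent A b v × Adjacent A v u × b ≢ u × ¬ Adjacent A b u
                     × (∀ x → Adjacent A u x → x ≢ v → rank v < rank x))
        ok v u (b , pv , vu , b≢u , b≁u , first) = b , pv
          , rank-< (key-index (prev-root pv) (≤-reflexive (sym (prev-index pv)))) , prev-adjacent pv , vu , b≢u , b≁u , first

    miss : Fin n → Vec (Fin K) n → ℕ
    miss v w = ⟦ nothing? (target w v) ⟧

    module Nice {v b : Fin n} (good : ¬ Bad R A v) (pv : prev v ≡ just b)
                (inside : ∀ u → Adjacent A v u → anc u ≢ [] × desc u ≢ []) where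

      ws : List (Fin n)
      ws = filter (λ u → adjacent? A v u ×-dec ¬? (u ≟ b)) V

      -- The successor of u is left out: it lies on the path of prev u, which is v itself or another member of the list.
      xs : Fin n → List (Fin n)
      xs u = filter (λ x → adjacent? A u x ×-dec ¬? (x ≟ v) ×-dec ¬? (≟just-dec (next u) x)) V

      groups : List (List (Fin n))
      groups = map (λ u → map root (xs u)) ws

      private
        ws⁻ : ∀ {u} → u ∈ ws → Adjacent A v u × u ≢ b
        ws⁻ u∈ = proj₂ (∈-filter⁻ (λ u → adjacent? A v u ×-dec ¬? (u ≟ b)) {xs = V} u∈)

        xs⁻ : ∀ u {x} → x ∈ xs u → Adjacent A u x × x ≢ v × next u ≢ just x
        xs⁻ u x∈ = proj₂ (∈-filter⁻ (λ x → adjacent? A u x ×-dec ¬? (x ≟ v) ×-dec ¬? (≟just-dec (next u) x)) {xs = V} x∈)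

        xs⁺ : ∀ {u x} → Adjacent A u x → x ≢ v → next u ≢ just x → x ∈ xs u
        xs⁺ {u} {x} ux x≢v ≢x = ∈-filter⁺ (λ x → adjacent? A u x ×-dec ¬? (x ≟ v) ×-dec ¬? (≟just-dec (next u) x)) (∈-allFin x) (ux , x≢v , ≢x)

        v≢b : v ≢ b
        v≢b e = prev-≢ pv (sym e)

        next-of : ∀ u → desc u ≢ [] → ∃[ s ] next u ≡ just s
        next-of u ≢[] with desc u
        ... | []    = ⊥-elim (≢[] refl)
        ... | s ∷ _ = s , refl

        prev-of : ∀ u → anc u ≢ [] → ∃[ p ] prev u ≡ just p
        prev-of u ≢[] with anc u
        ... | []    = ⊥-elim (≢[] refl)
        ... | y ∷ p = lastOf y p , refl

        adjacency-sum : ∀ x → ∑ V (λ y → ⟦ adjacent? A x y ⟧) ≡ d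
        adjacency-sum x = ∑-cong V (λ y → ⟦adjacent⟧ A x y) ⨾ deg x

      length-ws : length ws ≡ suc m
      length-ws = +-cancelʳ-≡ 1 (length ws) (suc m) (cong₂ _+_ (length-filter _ V) (sym (∑-single b)) ⨾ sym (∑-+ V _ _)
          ⨾ ∑-cong V (λ u → without (adjacent? A v u) (u ≟ b) (λ { refl → adj-sym (prev-adjacent pv) })) ⨾ adjacency-sum v ⨾ +-comm 1 (suc m))
        where
        without : ∀ {P Q : Set} (p : Dec P) (q : Dec Q) → (Q → P) → ⟦ p ×-dec ¬? q ⟧ + ⟦ q ⟧ ≡ ⟦ p ⟧
        without (yes _) (yes _) f = refl
        without (yes _) (no _)  f = refl
        without (no ¬p) (yes q) f = ⊥-elim (¬p (f q))
        without (no _)  (no _)  f = refl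

      length-xs : ∀ {u} → u ∈ ws → length (xs u) ≡ m
      length-xs {u} u∈ = +-cancelʳ-≡ 2 (length (xs u)) m (cong₂ _+_ (length-filter _ V) (sym (cong₂ _+_ (∑-single v) (∑-single s))) ⨾ cong (∑ V (λ x → ⟦ adjacent? A u x ×-dec ¬? (x ≟ v) ×-dec ¬? (≟just-dec (next u) x) ⟧) +_) (sym (∑-+ V _ _)) ⨾ sym (∑-+ V _ _)
          ⨾ ∑-cong V (λ x → without (adjacent? A u x) (x ≟ v) (x ≟ s) (≟just-dec (next u) x) (λ { refl → adj-sym (proj₁ (ws⁻ u∈)) }) (λ { refl → us })
              (λ { refl e → v≢s e }) (λ { refl → nu }) (λ e → just-injective (sym e ⨾ nu))) ⨾ adjacency-sum u ⨾ +-comm 2 m)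
        where
        s = proj₁ (next-of u (proj₂ (inside u (proj₁ (ws⁻ u∈)))))
        nu : next u ≡ just s
        nu = proj₂ (next-of u (proj₂ (inside u (proj₁ (ws⁻ u∈)))))
        us : Adjacent A u s
        us = prev-adjacent (next-step nu)
        -- If the successor of `u` were `v`, then `u` would be the predecessor `b`. Hence two
        -- different neighbours of `u` are excluded, and exactly `m` remain.
        v≢s : v ≢ s
        v≢s e = proj₂ (ws⁻ u∈) (just-injective (sym (next-step nu) ⨾ cong prev (sym e) ⨾ pv))
        without : ∀ {P Q S T : Set} (p : Dec P) (q : Dec Q) (s : Dec S) (t : Dec T) → (Q → P) → (S → P) → (Q → ¬ S) → (S → T) → (T → S) →
                  ⟦ p ×-dec ¬? q ×-dec ¬? t ⟧ + (⟦ q ⟧ + ⟦ s ⟧) ≡ ⟦ p ⟧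
        without (yes _) (yes q) (yes s) _       _ _ h _ _ = ⊥-elim (h q s)
        without (yes _) (yes _) (no _)  _       _ _ _ _ _ = refl
        without (yes _) (no _)  (yes _) (yes _) _ _ _ _ _ = refl
        without (yes _) (no _)  (yes s) (no ¬t) _ _ _ f _ = ⊥-elim (¬t (f s))
        without (yes _) (no _)  (no ¬s) (yes t) _ _ _ _ f = ⊥-elim (¬s (f t))
        without (yes _) (no _)  (no _)  (no _)  _ _ _ _ _ = refl
        without (no ¬p) (yes q) _       _       f _ _ _ _ = ⊥-elim (¬p (f q))
        without (no ¬p) (no _)  (yes s) _       _ f _ _ _ = ⊥-elim (¬p (f s))
        without (no _)  (no _)  (no _)  _       _ _ _ _ _ = refl

      -- A triangle would be a closed walk of length 3 at the good vertex `v`. This yields the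
      -- distance two between `b` and `u` that a hop requires.
      triangle-free : ∀ {u} → Adjacent A v u → u ≢ b → ¬ Adjacent A b u
      triangle-free {u} vu u≢b bu with walk-unique reg good v (u ∷ b ∷ v ∷ [])
          ((vu ∷ adj-sym bu ∷ prev-adjacent pv ∷ [-]) , v≢b , (λ { refl → ¬loop vu }) , _) refl
          (≤-trans (≤-trans (s≤s (s≤s (s≤s z≤n))) (+-monoˡ-≤ 2 (+-mono-≤ 1≤g 1≤g))) R≥)
        where
        1≤g : 1 ≤ g
        1≤g = ≤-trans (s≤s z≤n) (index< v)
      ... | (_ ∷ _ ∷ v≢v ∷ []) ∷ _ = v≢v refl

      private
        rootWalk : ∀ x r → Walk A (anc x ++ x ∷ r) → Walk A (root x ∷ tailFrom (anc x) x r)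
        rootWalk x r = subst (Walk A) (headOr-tailFrom (anc x) x r)

        -- Backtracking at `x` would make `u` the predecessor of `x`, and the successor of `u` was
        -- left out of `xs u`.
        coordinate-walk : ∀ {u x} → u ∈ ws → x ∈ xs u → Walk A (anc x ++ x ∷ u ∷ v ∷ [])
        coordinate-walk {u} {x} u∈ x∈ = linked-join (anc x) (proj₁ (up x)) (adj-sym ux ∷ adj-sym (proj₁ (ws⁻ u∈)) ∷ [-])
          , nonbacktracking-join (anc x) (nonbacktracking-unique (proj₂ (up x))) (proj₁ (proj₂ (xs⁻ u x∈)))
              (λ e → proj₂ (proj₂ (xs⁻ u x∈)) (prev⇒next e))
          where ux = proj₁ (xs⁻ u x∈)

        short₂ : ∀ x u v → length (tailFrom (anc x) x (u ∷ v ∷ [])) ≤ g + 1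
        short₂ x u v = ≤-trans (≤-reflexive (length-tailFrom (anc x) x (u ∷ v ∷ []) ⨾ +-suc (index x) 1)) (+-monoˡ-≤ 1 (index< x))

        short₀ : ∀ x → length (tailFrom (anc x) x []) ≤ g + 1
        short₀ x = ≤-trans (≤-reflexive (length-tailFrom (anc x) x [] ⨾ +-identityʳ (index x))) (≤-trans (<⇒≤ (index< x)) (m≤m+n g 1))

        -- Each walk has at most g - 1 edges along its path and two more to `v`; two of them
        -- together explain 2 g + 2.
        radius : ∀ {a b} → a ≤ g + 1 → b ≤ g + 1 → a + b ≤ R
        radius p q = ≤-trans (+-mono-≤ p q) (≤-trans (≤-reflexive (lem g)) R≥)
          where
          lem : ∀ g → g + 1 + (g + 1) ≡ g + g + 2
          lem = solve-∀

        same-list : ∀ {x y r s} → Walk A (anc x ++ x ∷ r) → Walk A (anc y ++ y ∷ s) → lastOf x r ≡ v → lastOf y s ≡ v →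
                    length (tailFrom (anc x) x r) ≤ g + 1 → length (tailFrom (anc y) y s) ≤ g + 1 → root x ≡ root y →
                    anc x ++ x ∷ r ≡ anc y ++ y ∷ s
        same-list {x} {y} {r} {s} wx wy lx ly sx sy e = headOr-tailFrom (anc x) x r ⨾ cong₂ _∷_ e tails ⨾ sym (headOr-tailFrom (anc y) y s)
          where
          tails : tailFrom (anc x) x r ≡ tailFrom (anc y) y s
          tails = walk-determined reg good (root x) (tailFrom (anc x) x r) (tailFrom (anc y) y s) (rootWalk x r wx)
            (subst (λ z → Walk A (z ∷ tailFrom (anc y) y s)) (sym e) (rootWalk y s wy)) (lastOf-tailFrom (anc x) x r ⨾ lx)
            (cong (λ z → lastOf z (tailFrom (anc y) y s)) e ⨾ lastOf-tailFrom (anc y) y s ⨾ ly) (radius sx sy)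

        snoc₃ : ∀ (p : List (Fin n)) {a b c} → p ++ a ∷ b ∷ c ∷ [] ≡ ((p ∷ʳ a) ∷ʳ b) ∷ʳ c
        snoc₃ p {a} {b} {c} = sym (++-assoc (p ∷ʳ a) (b ∷ []) (c ∷ []) ⨾ ++-assoc p (a ∷ []) (b ∷ c ∷ []))

        -- A common root forces the two walks to `v` to coincide, and they end in x, u, v and in x′,
        -- u′, v.
        distinct : ∀ {u u′ x x′} → u ∈ ws → u′ ∈ ws → x ∈ xs u → x′ ∈ xs u′ → root x ≡ root x′ → u ≡ u′ × x ≡ x′
        distinct {u} {u′} {x} {x′} u∈ u′∈ x∈ x′∈ e =
          let eq = sym (snoc₃ (anc x)) ⨾ same-list (coordinate-walk u∈ x∈) (coordinate-walk u′∈ x′∈) refl refl (short₂ x u v) (short₂ x′ u′ v) e ⨾ snoc₃ (anc x′)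
              e₁ = proj₁ (∷ʳ-injective ((anc x ∷ʳ x) ∷ʳ u) ((anc x′ ∷ʳ x′) ∷ʳ u′) eq)
              e₂ , u≡ = ∷ʳ-injective (anc x ∷ʳ x) (anc x′ ∷ʳ x′) e₁
          in u≡ , proj₂ (∷ʳ-injective (anc x) (anc x′) e₂)

        v-walk : Walk A (anc v ++ v ∷ [])
        v-walk = proj₁ (up v) , nonbacktracking-unique (proj₂ (up v))

        -- The path of `v` reaches `v` through `b`, the other walk through `u`.
        root-v-new : ∀ {u x} → u ∈ ws → x ∈ xs u → root v ≢ root x
        root-v-new {u} {x} u∈ x∈ e =
          let eq = cong (_∷ʳ v) (sym (proj₁ (prev-step pv))) ⨾ same-list v-walk (coordinate-walk u∈ x∈) refl refl (short₀ v) (short₂ x u v) e ⨾ snoc₃ (anc x)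
              e₁ = proj₁ (∷ʳ-injective (anc b ∷ʳ b) ((anc x ∷ʳ x) ∷ʳ u) eq)
          in proj₂ (ws⁻ u∈) (sym (proj₂ (∷ʳ-injective (anc b) (anc x ∷ʳ x) e₁)))

      unique-coordinates : Unique (root v ∷ concat groups)
      unique-coordinates = All.tabulate fresh ∷ unique-concat-map (λ u → map root (xs u)) ws
          (filter-unique (λ u → adjacent? A v u ×-dec ¬? (u ≟ b)) (allFin⁺ n))
          (λ {u} u∈ → unique-map-∈ root (filter-unique (λ x → adjacent? A u x ×-dec ¬? (x ≟ v) ×-dec ¬? (≟just-dec (next u) x)) (allFin⁺ n))
                     (λ x∈ y∈ e → proj₂ (distinct u∈ u∈ x∈ y∈ e)))
          apart
        where
        fresh : ∀ {z} → z ∈ concat groups → root v ≢ z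
        fresh z∈ with ∈-concat⁻′ groups z∈
        ... | l , z∈l , l∈ with ∈-map⁻ (λ u → map root (xs u)) l∈
        ...   | u , u∈ , refl with ∈-map⁻ root z∈l
        ...     | x , x∈ , refl = root-v-new u∈ x∈
        apart : ∀ {u u′ z} → u ∈ ws → u′ ∈ ws → z ∈ map root (xs u) → z ∈ map root (xs u′) → u ≡ u′
        apart u∈ u′∈ z∈ z∈′ with ∈-map⁻ root z∈ | ∈-map⁻ root z∈′
        ... | x , x∈ , refl | x′ , x′∈ , e = proj₁ (distinct u∈ u′∈ x∈ x′∈ e)

      group-lengths : All (λ C → length C ≡ m) groups
      group-lengths = AllP.map⁺ (All.tabulate (λ {u} u∈ → length-map root (xs u) ⨾ length-xs u∈))

      -- Smaller labels mean later paths, which settles the members of `xs u`. The successor of `u`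
      -- shares the path of the predecessor `p` of `u`: if `p` is `v`, it comes later on the path of
      -- `v`; otherwise `p` belongs to `xs u` and its path is later.
      all-smaller⇒candidate : ∀ w {u} → u ∈ ws → All (λ c → label w c < label w (root v)) (map root (xs u)) → Candidate w b v u
      all-smaller⇒candidate w {u} u∈ smaller = vu , (λ e → u≢b (sym e)) , triangle-free vu u≢b , later
        where
        vu = proj₁ (ws⁻ u∈)
        u≢b = proj₂ (ws⁻ u∈)
        p = proj₁ (prev-of u (proj₁ (inside u vu)))
        pu : prev u ≡ just p
        pu = proj₂ (prev-of u (proj₁ (inside u vu)))
        small : ∀ {x} → x ∈ xs u → label w (root x) < label w (root v)
        small x∈ = All.lookup smaller (∈-map⁺ root x∈)
        successor : ∀ {x} → next u ≡ just x → Dec (p ≡ v) → key w v < key w x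
        successor {x} nu (yes e) = key-index w (prev-root (next-step nu) ⨾ prev-root pu ⨾ cong root e)
          (subst (λ z → index z < index x) e (≤-trans (n≤1+n _) (≤-trans (≤-reflexive (cong suc (sym (prev-index pu)))) (≤-reflexive (sym (prev-index (next-step nu)))))))
        successor {x} nu (no p≢v) = key-label w (subst (λ r → label w r < label w (root v)) (sym (prev-root (next-step nu) ⨾ prev-root pu))
          (small (xs⁺ (adj-sym (prev-adjacent pu)) p≢v (prev≢next pu))))
        later : ∀ x → Adjacent A u x → x ≢ v → rank w v < rank w x
        later x ux x≢v = rank-< w (cases (≟just-dec (next u) x))
          where
          cases : Dec (next u ≡ just x) → key w v < key w x
          cases (yes nu) = successor nu (p ≟ v)
          cases (no ≢x)  = key-label w (small (xs⁺ ux x≢v ≢x))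

      -- The exponent counts the labels involved: one for `root v` and `m` for each of the `suc m`
      -- neighbours other than `b`.
      miss-average : K ^ suc (suc m * m) * ∑ (labelings n K) (miss v) ≤ length (labelings n K) * riemannSum m K (suc m)
      miss-average = subst₂ (λ a b → K ^ suc a * ∑ (labelings n K) (miss v) ≤ length (labelings n K) * riemannSum m K b) total (length-map _ ws ⨾ length-ws)
        (average {n} {K} {m} (root v) groups (miss v) unique-coordinates group-lengths (λ w → ⟦⟧-≤1 (nothing? (target w v))) blocked)
        where
        total : length (concat groups) ≡ suc m * m
        total = sym (∑-1 (concat groups)) ⨾ ∑-concat groups (λ _ → 1) ⨾ ∑-cong-∈ groups (λ C C∈ → ∑-1 C ⨾ All.lookup group-lengths C∈)
          ⨾ ∑-const groups m ⨾ cong (_* m) (length-map _ ws ⨾ length-ws)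
        blocked : ∀ w → miss v w ≢ 0 → ∀ C → C ∈ groups → ¬ All (λ c → label w c < label w (root v)) C
        blocked w ≢0 C C∈ smaller with ∈-map⁻ (λ u → map root (xs u)) C∈
        ... | u , u∈ , refl = chosen-nothing w (any? (candidate? w b v)) (cong (λ q → pick w q v) (sym pv) ⨾ ⟦⟧-≢0 (nothing? (target w v)) ≢0)
                          (u , all-smaller⇒candidate w u∈ smaller)

    -- It vanishes only where `Nice` applies; elsewhere it is at least 1 and pays for a possible
    -- miss.
    boundary : Fin n → ℕ
    boundary v = ⟦ bad? R A v ⟧ + rootless v + ∑ V (λ u → 𝟙 (adj? A v u) * (rootless u + childless u))

    private
      I = riemannSum m K (suc m)
      r : ℕ
      r = suc (suc m * m)
      Ω = labelings n K

    miss-bound : ∀ v → K ^ r * ∑ Ω (miss v) ≤ length Ω * (I + K ^ r * boundary v)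
    miss-bound v = cases (boundary v ≟ℕ 0)
      where
      open ≤-Reasoning
      cases : Dec (boundary v ≡ 0) → K ^ r * ∑ Ω (miss v) ≤ length Ω * (I + K ^ r * boundary v)
      cases (no ≢0) = begin
        K ^ r * ∑ Ω (miss v)  ≤⟨ *-monoʳ-≤ (K ^ r) (∑-bound Ω (λ w _ → ⟦⟧-≤1 (nothing? (target w v)))) ⟩
        K ^ r * (length Ω * 1)  ≤⟨ *-monoʳ-≤ (K ^ r) (*-monoʳ-≤ (length Ω) (n≢0⇒n>0 ≢0)) ⟩
        K ^ r * (length Ω * boundary v)  ≡⟨ lem (K ^ r) (length Ω) (boundary v) ⟩
        length Ω * (K ^ r * boundary v)  ≤⟨ *-monoʳ-≤ (length Ω) (m≤n+m _ I) ⟩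
        length Ω * (I + K ^ r * boundary v)  ∎
        where
        lem : ∀ a b c → a * (b * c) ≡ b * (a * c)
        lem = solve-∀
      cases (yes ≡0) = ≤-trans (Nice.miss-average good (proj₂ hasPrev) inside) (*-monoʳ-≤ (length Ω) (m≤m+n I _))
        where
        part₁ : ⟦ bad? R A v ⟧ + rootless v ≡ 0
        part₁ = m+n≡0⇒m≡0 _ ≡0
        good : ¬ Bad R A v
        good bd = case sym (⟦⟧-yes (bad? R A v) bd) ⨾ m+n≡0⇒m≡0 _ part₁ of λ ()
        hasAnc : anc v ≢ []
        hasAnc e = case sym (⟦⟧-yes (nil? (anc v)) e) ⨾ m+n≡0⇒n≡0 ⟦ bad? R A v ⟧ part₁ of λ ()
        last-of : ∀ l → l ≢ [] → ∃[ b ] lastMaybe l ≡ just b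
        last-of []      h = ⊥-elim (h refl)
        last-of (x ∷ l) h = lastOf x l , refl
        hasPrev : ∃[ b ] prev v ≡ just b
        hasPrev = last-of (anc v) hasAnc
        around : ∀ u → Adjacent A v u → rootless u + childless u ≡ 0
        around u vu = n≤0⇒n≡0 (begin
          rootless u + childless u  ≡⟨ sym (*-identityˡ _) ⨾ cong (λ e → 𝟙 e * (rootless u + childless u)) (sym vu) ⟩
          𝟙 (adj? A v u) * (rootless u + childless u)  ≤⟨ ∈⇒≤∑ (λ u → 𝟙 (adj? A v u) * (rootless u + childless u)) (∈-allFin u) ⟩
          ∑ V (λ u → 𝟙 (adj? A v u) * (rootless u + childless u))  ≡⟨ m+n≡0⇒n≡0 (⟦ bad? R A v ⟧ + rootless v) ≡0 ⟩
          0  ∎)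
        inside : ∀ u → Adjacent A v u → anc u ≢ [] × desc u ≢ []
        inside u vu = (λ e → case sym (⟦⟧-yes (nil? (anc u)) e) ⨾ m+n≡0⇒m≡0 _ (around u vu) of λ ())
                    , (λ e → case sym (⟦⟧-yes (nil? (desc u)) e) ⨾ m+n≡0⇒n≡0 (rootless u) (around u vu) of λ ())

    -- Each path has one first and one last vertex. Both affect their `d` neighbours, and the first
    -- one also affects itself.
    boundary-total : ∑ V boundary ≤ ∑ V (λ v → ⟦ bad? R A v ⟧) + (1 + 2 * d) * length (PathCover.paths P)
    boundary-total = begin
      ∑ V boundary  ≡⟨ ∑-+ V _ _ ⨾ cong₂ _+_ (∑-+ V _ _) (∑-swap V V _) ⟩
      (bads + ∑ V rootless) + ∑ V (λ u → ∑ V (λ v → 𝟙 (adj? A v u) * (rootless u + childless u)))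
        ≡⟨ cong (bads + ∑ V rootless +_) (∑-cong V (λ u → ∑-*ʳ V _ (λ v → 𝟙 (adj? A v u)) ⨾ cong (_* (rootless u + childless u)) (column reg u))
             ⨾ ∑-*ˡ V d _ ⨾ cong (d *_) (∑-+ V rootless childless)) ⟩
      (bads + ∑ V rootless) + d * (∑ V rootless + ∑ V childless)  ≤⟨ +-mono-≤ (+-monoʳ-≤ bads rootless-count) (*-monoʳ-≤ d (+-mono-≤ rootless-count childless-count)) ⟩
      (bads + p) + d * (p + p)  ≡⟨ lem bads p d ⟩
      bads + (1 + 2 * d) * p  ∎
      where
      open ≤-Reasoning
      bads = ∑ V (λ v → ⟦ bad? R A v ⟧)
      p = length (PathCover.paths P)
      lem : ∀ b p d → (b + p) + d * (p + p) ≡ b + (1 + 2 * d) * p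
      lem = solve-∀

    -- Some labelling does no worse than the average, so the bound for a given graph is
    -- deterministic.
    good-labeling : 0 < K → ∃[ B ] (Feasible A B × K ^ r * ∣ B ∣ ≤ n * I + K ^ r * ∑ V boundary)
    good-labeling 0<K with ∑-pick Ω (λ w → ∑ V (λ v → miss v w)) (K ^ r) (n * I + K ^ r * ∑ V boundary) nonempty expectation
      where
      open ≤-Reasoning
      nonempty : 0 < length Ω
      nonempty = ∈-length (∈-allVecs ∈-allFin (Vec.replicate n (fromℕ< 0<K)))
      expectation : K ^ r * ∑ Ω (λ w → ∑ V (λ v → miss v w)) ≤ length Ω * (n * I + K ^ r * ∑ V boundary)
      expectation = begin
        K ^ r * ∑ Ω (λ w → ∑ V (λ v → miss v w))  ≡⟨ cong (K ^ r *_) (∑-swap Ω V _) ⨾ sym (∑-*ˡ V (K ^ r) _) ⟩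
        ∑ V (λ v → K ^ r * ∑ Ω (miss v))  ≤⟨ ∑-mono V miss-bound ⟩
        ∑ V (λ v → length Ω * (I + K ^ r * boundary v))  ≡⟨ ∑-*ˡ V (length Ω) _ ⨾ cong (length Ω *_) (∑-+ V _ _ ⨾ cong₂ _+_ (∑-const V I ⨾ cong (_* I) (length-allFin n)) (∑-*ˡ V (K ^ r) boundary)) ⟩
        length Ω * (n * I + K ^ r * ∑ V boundary)  ∎
    ... | w , bound = let B , feas , ≤fails = feasible-plan (plan w) in B , feas , ≤-trans (*-monoʳ-≤ (K ^ r) ≤fails) bound

-- Choice of the constants

module Constants where
  open Planning public

  1≤prod1 : ∀ j f → (∀ i → 1 ≤ f i) → 1 ≤ prod1 j f
  1≤prod1 zero    f h = ≤-refl
  1≤prod1 (suc j) f h = *-mono-≤ (1≤prod1 j f h) (h (suc j))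

  1≤cNumer : ∀ m′ → 1 ≤ cNumer (suc (suc (suc m′)))
  1≤cNumer m′ = *-mono-≤ (1≤n! (suc (suc m′))) (m^n>0 (suc m′) (suc (suc m′)))

  -- With K labels the expected size of B is n I / K^(…); the Riemann error e and the boundary β each cost at most n / 2r.
  size-estimate : ∀ r K e N D q b n I β .{{_ : NonZero K}} .{{_ : NonZero q}} → 2 * r * e ≤ K → 2 * r * D * β ≤ n → 1 ≤ N →
                  D * I ≤ (N * K + e) * q → K * q * b ≤ n * I + K * q * β → r * (b * D) ≤ r * (N * n) + N * n
  size-estimate r K e N D q b n I β e≤ β≤ 1≤N I≤ bound = ≤-trans (*-cancelˡ-≤ 2 (*-cancelˡ-≤ K doubled))
      (+-monoʳ-≤ (r * (N * n)) (≤-trans (≤-reflexive (sym (*-identityˡ n))) (*-monoˡ-≤ n 1≤N)))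
    where
    open ≤-Reasoning
    scaled : K * (b * D) ≤ n * (N * K + e) + K * (β * D)
    scaled = *-cancelʳ-≤ _ _ q (begin
      K * (b * D) * q  ≡⟨ lem₁ K b D q ⟩
      D * (K * q * b)  ≤⟨ *-monoʳ-≤ D bound ⟩
      D * (n * I + K * q * β)  ≡⟨ lem₂ D n I K q β ⟩
      n * (D * I) + K * (β * D) * q  ≤⟨ +-monoˡ-≤ _ (*-monoʳ-≤ n I≤) ⟩
      n * ((N * K + e) * q) + K * (β * D) * q  ≡⟨ lem₃ n (N * K + e) q (K * (β * D)) ⟩
      (n * (N * K + e) + K * (β * D)) * q  ∎)
      where
      lem₁ : ∀ K b c q → K * (b * c) * q ≡ c * (K * q * b)
      lem₁ = solve-∀
      lem₂ : ∀ c n I K q β → c * (n * I + K * q * β) ≡ n * (c * I) + K * (β * c) * q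
      lem₂ = solve-∀
      lem₃ : ∀ n x q y → n * (x * q) + y * q ≡ (n * x + y) * q
      lem₃ = solve-∀
    doubled : K * (2 * (r * (b * D))) ≤ K * (2 * (r * (N * n) + n))
    doubled = begin
      K * (2 * (r * (b * D)))  ≡⟨ lem₁ K r (b * D) ⟩
      2 * r * (K * (b * D))  ≤⟨ *-monoʳ-≤ (2 * r) scaled ⟩
      2 * r * (n * (N * K + e) + K * (β * D))  ≡⟨ lem₂ r n N K e β D ⟩
      K * (2 * (r * (N * n))) + (2 * r * e * n + K * (2 * r * D * β)) ≤⟨ +-monoʳ-≤ (K * (2 * (r * (N * n)))) (+-mono-≤ (*-monoˡ-≤ n e≤) (*-monoʳ-≤ K β≤)) ⟩
      K * (2 * (r * (N * n))) + (K * n + K * n)  ≡⟨ lem₃ K (r * (N * n)) n ⟩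
      K * (2 * (r * (N * n) + n))  ∎
      where
      lem₁ : ∀ K r x → K * (2 * (r * x)) ≡ 2 * r * (K * x)
      lem₁ = solve-∀
      lem₂ : ∀ r n c K e β D → 2 * r * (n * (c * K + e) + K * (β * D)) ≡ K * (2 * (r * (c * n))) + (2 * r * e * n + K * (2 * r * D * β))
      lem₂ = solve-∀
      lem₃ : ∀ K x n → K * (2 * x) + (K * n + K * n) ≡ K * (2 * (x + n))
      lem₃ = solve-∀

  -- The number 25 + 48 d is 1 + 24 (1 + 2 d): one `n` for the bad vertices, and 12 (n + n) for the
  -- paths, each of which affects 1 + 2 d vertices. The successor of `Z` keeps `g` positive.
  boundary-estimate : ∀ g Z d n bads p β → g ≡ suc Z * (25 + 48 * d) → g * bads ≤ n → g * p ≤ 12 * (n + g * bads) →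
                      β ≤ bads + (1 + 2 * d) * p → Z * β ≤ n
  boundary-estimate g Z d n bads p β g≡ bads≤ p≤ β≤ = ≤-trans (*-monoˡ-≤ β (n≤1+n Z)) (*-cancelˡ-≤ (25 + 48 * d) (begin
      (25 + 48 * d) * (suc Z * β)  ≡⟨ lem (25 + 48 * d) (suc Z) β ⟩
      suc Z * (25 + 48 * d) * β  ≡⟨ cong (_* β) (sym g≡) ⟩
      g * β  ≤⟨ *-monoʳ-≤ g β≤ ⟩
      g * (bads + (1 + 2 * d) * p)  ≡⟨ lem₁ g bads (1 + 2 * d) p ⟩
      g * bads + (1 + 2 * d) * (g * p)  ≤⟨ +-mono-≤ bads≤ (*-monoʳ-≤ (1 + 2 * d) (≤-trans p≤ (*-monoʳ-≤ 12 (+-monoʳ-≤ n bads≤)))) ⟩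
      n + (1 + 2 * d) * (12 * (n + n))  ≡⟨ lem₂ n d ⟩
      (25 + 48 * d) * n  ∎))
    where
    open ≤-Reasoning
    lem : ∀ w z b → w * (z * b) ≡ z * w * b
    lem = solve-∀
    lem₁ : ∀ g b x p → g * (b + x * p) ≡ g * b + x * (g * p)
    lem₁ = solve-∀
    lem₂ : ∀ n d → n + (1 + 2 * d) * (12 * (n + n)) ≡ (25 + 48 * d) * n
    lem₂ = solve-∀

  module _ (m′ g R K r : ℕ) (0<g : 0 < g) (0<K : 0 < K) (R≡ : R ≡ g + g + 2) where
    private
      m d : ℕ
      m = suc m′
      d = suc (suc m)

    assemble : g ≡ suc (2 * r * cDenom d) * (25 + 48 * d) → 2 * r * riemannError m (suc m) ≤ K →
               ∀ {n} {A : Adj n} → Regular d A → g * lollipops≤ R A ≤ n →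
               ∃[ B ] (Feasible A B × r * (∣ B ∣ * cDenom d) ≤ r * (cNumer d * n) + cNumer d * n)
    assemble g≡ e≤ {n} {A} reg few = finish (good-labeling 0<K)
      where
      g≤R : g ≤ R
      g≤R = ≤-trans (≤-trans (m≤m+n g g) (m≤m+n (g + g) 2)) (≤-reflexive (sym R≡))
      P : PathCover A g (12 * Factorization.cost reg g≤R)
      P = path-cover {n} {suc m} {R} {g} {A} (s≤s z≤n) 0<g reg g≤R
      open Plans {n} {m} {g} {R} {12 * Factorization.cost reg g≤R} {K} {A} reg P (≤-reflexive (sym R≡))
      V = allFin n
      q β : ℕ
      q = (K ^ m) ^ suc m
      β = ∑ V boundary
      bads≤ : g * ∑ V (λ v → ⟦ bad? R A v ⟧) ≤ n
      bads≤ = ≤-trans (*-monoʳ-≤ g (bad-count R A)) few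
      β≤ : 2 * r * cDenom d * β ≤ n
      β≤ = boundary-estimate g (2 * r * cDenom d) d n (∑ V (λ v → ⟦ bad? R A v ⟧)) (length (PathCover.paths P)) β g≡ bads≤ (PathCover.few P) boundary-total
      -- One factor `K` belongs to the label of the hub's own root and one factor `K ^ m` to each of
      -- the `suc m` groups.
      K^r : K ^ suc (suc m * m) ≡ K * q
      K^r = cong (K *_) (cong (K ^_) (*-comm (suc m) m) ⨾ sym (^-*-assoc K m (suc m)))
      finish : ∃[ B ] (Feasible A B × K ^ suc (suc m * m) * ∣ B ∣ ≤ n * riemannSum m K (suc m) + K ^ suc (suc m * m) * β) →
               ∃[ B ] (Feasible A B × r * (∣ B ∣ * cDenom d) ≤ r * (cNumer d * n) + cNumer d * n)
      finish (B , feas , bound) = B , feas ,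
        size-estimate r K (riemannError m (suc m)) (cNumer d) (cDenom d) q ∣ B ∣ n (riemannSum m K (suc m)) β
          {{>-nonZero 0<K}} {{m^n≢0 (K ^ m) (suc m) {{m^n≢0 K m {{>-nonZero 0<K}}}}}} e≤ β≤ (1≤cNumer m′) (riemannSum-bound m′ K (suc m))
          (subst (λ x → x * ∣ B ∣ ≤ n * riemannSum m K (suc m) + x * β) K^r bound)

  feasible-set : ∀ m′ r → let d = suc (suc (suc m′)) in ∃[ R ] ∃[ q ] (∀ n (A : Adj n) → Regular d A → q * lollipops≤ R A ≤ n →
                 ∃[ B ] (Feasible A B × r * (∣ B ∣ * cDenom d) ≤ r * (cNumer d * n) + cNumer d * n))
  feasible-set m′ r = g + g + 2 , g , λ n A reg few →
      assemble m′ g (g + g + 2) (suc e) r (s≤s z≤n) (s≤s z≤n) refl refl (n≤1+n e) reg few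
    where
    -- With `K` = `suc e` the Riemann error is at most K / 2r, and `g` makes the total of `boundary`
    -- at most n / (2 r cDenom d); together they fit into a relative error of 1 / r.
    e g : ℕ
    e = 2 * r * riemannError (suc m′) (suc (suc m′))
    g = suc (2 * r * cDenom (suc (suc (suc m′)))) * (25 + 48 * suc (suc (suc m′)))

-- Translation between natural and rational inequalities

module Rationals where
  open Constants public

  toℚ-toℚᵘ : ∀ k → ℚ.toℚᵘ (toℚ k) ℚᵘ.≃ ℚᵘ.mkℚᵘ (ℤ.+ k) 0
  toℚ-toℚᵘ k = ℚP.toℚᵘ-fromℚᵘ (ℚᵘ.mkℚᵘ (ℤ.+ k) 0)

  toℚ-+ : ∀ a b → toℚ (a + b) ≡ toℚ a ℚ.+ toℚ b
  toℚ-+ a b = ℚP.toℚᵘ-injective (begin-equality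
    ℚ.toℚᵘ (toℚ (a + b))  ≃⟨ toℚ-toℚᵘ (a + b) ⟩
    ℚᵘ.mkℚᵘ (ℤ.+ (a + b)) 0  ≃⟨ ℚᵘ.*≡* (cong (ℤ._* ℤ.+ 1) (sym (cong₂ ℤ._+_ (ℤP.*-identityʳ (ℤ.+ a)) (ℤP.*-identityʳ (ℤ.+ b))))) ⟩
    ℚᵘ.mkℚᵘ (ℤ.+ a) 0 ℚᵘ.+ ℚᵘ.mkℚᵘ (ℤ.+ b) 0         ≃⟨ ℚᵘP.+-cong (toℚ-toℚᵘ a) (toℚ-toℚᵘ b) ⟨
    ℚ.toℚᵘ (toℚ a) ℚᵘ.+ ℚ.toℚᵘ (toℚ b)               ≃⟨ ℚP.toℚᵘ-homo-+ (toℚ a) (toℚ b) ⟨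
    ℚ.toℚᵘ (toℚ a ℚ.+ toℚ b)  ∎)
    where open ℚᵘP.≤-Reasoning

  toℚ-* : ∀ a b → toℚ (a * b) ≡ toℚ a ℚ.* toℚ b
  toℚ-* a b = ℚP.toℚᵘ-injective (begin-equality
    ℚ.toℚᵘ (toℚ (a * b))  ≃⟨ toℚ-toℚᵘ (a * b) ⟩
    ℚᵘ.mkℚᵘ (ℤ.+ (a * b)) 0  ≃⟨ ℚᵘ.*≡* (cong (ℤ._* ℤ.+ 1) (ℤP.pos-* a b)) ⟩
    ℚᵘ.mkℚᵘ (ℤ.+ a) 0 ℚᵘ.* ℚᵘ.mkℚᵘ (ℤ.+ b) 0         ≃⟨ ℚᵘP.*-cong (toℚ-toℚᵘ a) (toℚ-toℚᵘ b) ⟨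
    ℚ.toℚᵘ (toℚ a) ℚᵘ.* ℚ.toℚᵘ (toℚ b)               ≃⟨ ℚP.toℚᵘ-homo-* (toℚ a) (toℚ b) ⟨
    ℚ.toℚᵘ (toℚ a ℚ.* toℚ b)  ∎)
    where open ℚᵘP.≤-Reasoning

  toℚ-mono : ∀ {a b} → a ≤ b → toℚ a ℚ.≤ toℚ b
  toℚ-mono {a} {b} a≤b = ℚP.toℚᵘ-cancel-≤ (begin
    ℚ.toℚᵘ (toℚ a)  ≃⟨ toℚ-toℚᵘ a ⟩
    ℚᵘ.mkℚᵘ (ℤ.+ a) 0  ≤⟨ ℚᵘ.*≤* (ℤP.*-monoʳ-≤-nonNeg (ℤ.+ 1) (ℤ.+≤+ a≤b)) ⟩
    ℚᵘ.mkℚᵘ (ℤ.+ b) 0     ≃⟨ toℚ-toℚᵘ b ⟨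
    ℚ.toℚᵘ (toℚ b)  ∎)
    where open ℚᵘP.≤-Reasoning

  0≤toℚ : ∀ k → ℚ.0ℚ ℚ.≤ toℚ k
  0≤toℚ k = toℚ-mono {0} {k} z≤n

  -- Multiplying a positive fraction by its denominator gives its numerator, which is at least 1.
  archimedean : ∀ ε → ℚ.0ℚ ℚ.< ε → ∃[ r ] ℚ.1ℚ ℚ.≤ toℚ (suc r) ℚ.* ε
  archimedean (ℚ.mkℚ (ℤ.+ zero) b-1 _) (ℚ.*<* (ℤ.+<+ ()))
  archimedean (ℚ.mkℚ (ℤ.-[1+ _ ]) b-1 _) (ℚ.*<* ())
  archimedean ε@(ℚ.mkℚ (ℤ.+ suc a) b-1 _) _ = b-1 , ℚP.toℚᵘ-cancel-≤ (begin
    ℚᵘ.1ℚᵘ  ≤⟨ ℚᵘ.*≤* (subst₂ ℤ._≤_ refl (ℤP.pos-* (suc b-1 * suc a) 1) (ℤ.+≤+ (≤-trans (≤-reflexive (lem b-1)) (*-monoˡ-≤ 1 (*-monoʳ-≤ (suc b-1) (s≤s (z≤n {a}))))))) ⟩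
    ℚᵘ.mkℚᵘ (ℤ.+ suc b-1) 0 ℚᵘ.* ℚᵘ.mkℚᵘ (ℤ.+ suc a) b-1   ≃⟨ ℚᵘP.*-congʳ {ℚᵘ.mkℚᵘ (ℤ.+ suc a) b-1} (toℚ-toℚᵘ (suc b-1)) ⟨
    ℚ.toℚᵘ (toℚ (suc b-1)) ℚᵘ.* ℚ.toℚᵘ ε                   ≃⟨ ℚP.toℚᵘ-homo-* (toℚ (suc b-1)) ε ⟨
    ℚ.toℚᵘ (toℚ (suc b-1) ℚ.* ε)  ∎)
    where
    open ℚᵘP.≤-Reasoning
    lem : ∀ b → suc (b + 0 + 0) ≡ suc b * 1 * 1
    lem = solve-∀

  private
    toℚ-suc-positive : ∀ r → ℚ.Positive (toℚ (suc r))
    toℚ-suc-positive r = ℚ.positive (ℚP.<-≤-trans (ℚ.*<* (ℤ.+<+ (s≤s z≤n))) (toℚ-mono {1} {suc r} (s≤s z≤n)))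

    toℚ-nonNeg : ∀ k → ℚ.NonNegative (toℚ k)
    toℚ-nonNeg k = ℚ.nonNegative (0≤toℚ k)

  -- Scaled by `suc r`, the surplus `y` is absorbed by (r + 1) ε y.
  ≤-1+ε : ∀ {ε} r x y → ℚ.1ℚ ℚ.≤ toℚ (suc r) ℚ.* ε → suc r * x ≤ suc r * y + y → toℚ x ℚ.≤ (ℚ.1ℚ ℚ.+ ε) ℚ.* toℚ y
  ≤-1+ε {ε} r x y rε≥1 h = ℚP.*-cancelˡ-≤-pos (toℚ (suc r)) {{toℚ-suc-positive r}} (begin
    s ℚ.* toℚ x                                    ≡⟨ toℚ-* (suc r) x ⟨
    toℚ (suc r * x)  ≤⟨ toℚ-mono h ⟩
    toℚ (suc r * y + y)  ≡⟨ toℚ-+ (suc r * y) y ⟩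
    toℚ (suc r * y) ℚ.+ toℚ y  ≡⟨ cong₂ ℚ._+_ (toℚ-* (suc r) y) (sym (ℚP.*-identityˡ (toℚ y))) ⟩
    s ℚ.* toℚ y ℚ.+ ℚ.1ℚ ℚ.* toℚ y  ≤⟨ ℚP.+-monoʳ-≤ (s ℚ.* toℚ y) (ℚP.*-monoʳ-≤-nonNeg (toℚ y) {{toℚ-nonNeg y}} rε≥1) ⟩
    s ℚ.* toℚ y ℚ.+ (s ℚ.* ε) ℚ.* toℚ y  ≡⟨ cong (s ℚ.* toℚ y ℚ.+_) (ℚP.*-assoc s ε (toℚ y)) ⟩
    s ℚ.* toℚ y ℚ.+ s ℚ.* (ε ℚ.* toℚ y)            ≡⟨ ℚP.*-distribˡ-+ s (toℚ y) (ε ℚ.* toℚ y) ⟨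
    s ℚ.* (toℚ y ℚ.+ ε ℚ.* toℚ y)                  ≡⟨ cong (λ z → s ℚ.* (z ℚ.+ ε ℚ.* toℚ y)) (ℚP.*-identityˡ (toℚ y)) ⟨
    s ℚ.* (ℚ.1ℚ ℚ.* toℚ y ℚ.+ ε ℚ.* toℚ y)         ≡⟨ cong (s ℚ.*_) (ℚP.*-distribʳ-+ (toℚ y) ℚ.1ℚ ε) ⟨
    s ℚ.* ((ℚ.1ℚ ℚ.+ ε) ℚ.* toℚ y)  ∎)
    where
    open ℚP.≤-Reasoning
    s = toℚ (suc r)

  1-δ-≤ : ∀ {δ} r x y → ℚ.1ℚ ℚ.≤ toℚ (suc r) ℚ.* δ → suc r * x ≤ suc r * y + x → (ℚ.1ℚ ℚ.- δ) ℚ.* toℚ x ℚ.≤ toℚ y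
  1-δ-≤ {δ} r x y rδ≥1 h = ℚP.*-cancelˡ-≤-pos (toℚ (suc r)) {{toℚ-suc-positive r}} (begin
    s ℚ.* ((ℚ.1ℚ ℚ.- δ) ℚ.* toℚ x)  ≡⟨ cong (s ℚ.*_) (ℚP.*-distribʳ-+ (toℚ x) ℚ.1ℚ (ℚ.- δ)) ⟩
    s ℚ.* (ℚ.1ℚ ℚ.* toℚ x ℚ.+ (ℚ.- δ) ℚ.* toℚ x)  ≡⟨ cong₂ (λ a b → s ℚ.* (a ℚ.+ b)) (ℚP.*-identityˡ (toℚ x)) (sym (ℚP.neg-distribˡ-* δ (toℚ x))) ⟩
    s ℚ.* (toℚ x ℚ.+ ℚ.- (δ ℚ.* toℚ x))  ≡⟨ ℚP.*-distribˡ-+ s (toℚ x) (ℚ.- (δ ℚ.* toℚ x)) ⟩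
    s ℚ.* toℚ x ℚ.+ s ℚ.* (ℚ.- (δ ℚ.* toℚ x))                        ≡⟨ cong (s ℚ.* toℚ x ℚ.+_) (ℚP.neg-distribʳ-* s (δ ℚ.* toℚ x)) ⟨
    s ℚ.* toℚ x ℚ.+ ℚ.- (s ℚ.* (δ ℚ.* toℚ x))                        ≡⟨ cong (λ z → s ℚ.* toℚ x ℚ.+ ℚ.- z) (ℚP.*-assoc s δ (toℚ x)) ⟨
    s ℚ.* toℚ x ℚ.+ ℚ.- ((s ℚ.* δ) ℚ.* toℚ x)  ≤⟨ ℚP.+-monoʳ-≤ (s ℚ.* toℚ x) (ℚP.neg-antimono-≤ (ℚP.*-monoʳ-≤-nonNeg (toℚ x) {{toℚ-nonNeg x}} rδ≥1)) ⟩
    s ℚ.* toℚ x ℚ.+ ℚ.- (ℚ.1ℚ ℚ.* toℚ x)  ≡⟨ cong₂ (λ a b → a ℚ.+ ℚ.- b) (sym (toℚ-* (suc r) x)) (ℚP.*-identityˡ (toℚ x)) ⟩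
    toℚ (suc r * x) ℚ.+ ℚ.- toℚ x  ≤⟨ ℚP.+-monoˡ-≤ (ℚ.- toℚ x) (toℚ-mono h) ⟩
    toℚ (suc r * y + x) ℚ.+ ℚ.- toℚ x  ≡⟨ cong (ℚ._+ ℚ.- toℚ x) (toℚ-+ (suc r * y) x) ⟩
    toℚ (suc r * y) ℚ.+ toℚ x ℚ.+ ℚ.- toℚ x  ≡⟨ ℚP.+-assoc (toℚ (suc r * y)) (toℚ x) (ℚ.- toℚ x) ⟩
    toℚ (suc r * y) ℚ.+ (toℚ x ℚ.+ ℚ.- toℚ x)  ≡⟨ cong (toℚ (suc r * y) ℚ.+_) (ℚP.+-inverseʳ (toℚ x)) ⟩
    toℚ (suc r * y) ℚ.+ ℚ.0ℚ  ≡⟨ ℚP.+-identityʳ (toℚ (suc r * y)) ⟩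
    toℚ (suc r * y)  ≡⟨ toℚ-* (suc r) y ⟩
    s ℚ.* toℚ y  ∎)
    where
    open ℚP.≤-Reasoning
    s = toℚ (suc r)

-- Almost all regular graphs have a small feasible set

module AlmostAll where
  open Rationals public

  module _ (d r s : ℕ) where
    SmallFeasible : ∀ {n} → Adj n → Set
    SmallFeasible {n} A = ∃[ B ] (Feasible A B × r * (∣ B ∣ * cDenom d) ≤ r * (cNumer d * n) + cNumer d * n)

    -- For positive `s`, a probability of at least 1 - 1 / s is expressed by listing sufficiently
    -- many distinct good graphs out of all `numRegular d n`.
    Conclusion : ℕ → Set
    Conclusion n = Σ (List (Adj n)) λ L → Unique L × All (λ A → IsSimpleRegular d A × SmallFeasible A) L
                          × s * numRegular d n ≤ s * length L + numRegular d n

    from-sparse : ∀ R q n → (∀ (A : Adj n) → Regular d A → q * lollipops≤ R A ≤ n → SmallFeasible A) →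
                  s * length (regularGraphs d n) ≤ s * length (filter (λ A → q * lollipops≤ R A ≤? n) (regularGraphs d n)) + length (regularGraphs d n) →
                  Conclusion n
    from-sparse R q n feasible few = filter sparse? (regularGraphs d n) , filter-unique sparse? (unique-regularGraphs d n) , All.tabulate good , few
      where
      sparse? : (A : Adj n) → Dec (q * lollipops≤ R A ≤ n)
      sparse? A = q * lollipops≤ R A ≤? n
      good : ∀ {A} → A ∈ filter sparse? (regularGraphs d n) → IsSimpleRegular d A × SmallFeasible A
      good {A} A∈ = let A∈RL , sparse = ∈-filter⁻ sparse? {xs = regularGraphs d n} A∈
                        regular = ∈-regularGraphs⁻ {d} {n} A∈RL
                    in regular , feasible A (toRegular {n} {d} {A} regular) sparse

  almost-all-feasible : ∀ m r s → ∃[ N ] (∀ n → N ≤ n → Conclusion (suc (suc (suc m))) r s n)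
  almost-all-feasible m r s = combine (feasible-set m r)
    where
    d : ℕ
    d = suc (suc (suc m))
    combine : ∃[ R ] ∃[ q ] (∀ n (A : Adj n) → Regular d A → q * lollipops≤ R A ≤ n → SmallFeasible d r s A) →
              ∃[ N ] (∀ n → N ≤ n → Conclusion d r s n)
    combine (R , q , feasible) = let N , few = few-lollipops d R q s (s≤s (s≤s z≤n)) in
      N , λ n N≤n → from-sparse d r s R q n (feasible n) (few n N≤n)

open import Defs
open import Data.Nat using (ℕ; _≤_; _*_)
open import Data.Nat.Divisibility using (_∣_)
open import Data.Fin.Subset using (Subset; ∣_∣)
open import Data.List using (List; length)
open import Data.List.Relation.Unary.All using (All)
open import Data.List.Relation.Unary.Unique.Propositional using (Unique)
open import Data.Product using (Σ; _×_)
open import Data.Rational using (ℚ; 0ℚ; 1ℚ; _+_; _-_; _<_) renaming (_*_ to _*ℚ_; _≤_ to _≤ℚ_)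
open import Data.Nat using (suc; s≤s)
open import Data.Product using (_,_)
open Rationals using (archimedean; ≤-1+ε; 1-δ-≤)
open AlmostAll using (almost-all-feasible)

theorem1p3 : (d : ℕ) → 4 ≤ d →
    (ε δ : ℚ) → 0ℚ < ε → 0ℚ < δ →
    Σ ℕ λ N → (n : ℕ) → N ≤ n → 2 ∣ d * n →
    Σ (List (Adj n)) λ L →
    Unique L
    × All (λ A → IsSimpleRegular d A
    × Σ (Subset n) λ B → Feasible A B
    × toℚ (∣ B ∣ * cDenom d) ≤ℚ (1ℚ + ε) *ℚ toℚ (cNumer d * n)) L
    × (1ℚ - δ) *ℚ toℚ (numRegular d n) ≤ℚ toℚ (length L)
theorem1p3 d@(suc (suc (suc m))) (s≤s (s≤s (s≤s _))) ε δ 0<ε 0<δ =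
  -- The relative error becomes 1 / (r + 1), at most ε, and the fraction of exceptional graphs 1 /
  -- (s + 1), at most δ.
  let r , rε≥1 = archimedean ε 0<ε
      s , sδ≥1 = archimedean δ 0<δ
      N , almost-all = almost-all-feasible m (suc r) (suc s)
  in N , λ n N≤n _ →
    let L , unique , feasible , many = almost-all n N≤n
    in L , unique
     , All.map (λ (regular , B , feasibleB , small) →
         regular , B , feasibleB , ≤-1+ε r (∣ B ∣ * cDenom d) (cNumer d * n) rε≥1 small) feasible
     , 1-δ-≤ s (numRegular d n) (length L) sδ≥1 many
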